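{- Let $D\ge 2$ be an integer and let $\gamma,\nu$ be real numbers with $0<\nu\ll\gamma\ll 1$. Then there exists a threshold $n_0=n_0(D,\gamma,\nu)$ such that the following holds. If $n\ge n_0$, $G$ is a $\gamma$-non-extremal graph on $n$ vertices with minimum degree $\delta(G)\ge (1/2-\nu)n$, and $T$ is a tree on $n$ vertices with maximum degree $\Delta(T)\le D$, then $T$ is a subgraph of $G$ (i.e. $G$ contains a copy of $T$).
   Context: All graphs are simple. For a graph $G=(V,E)$ on $n$ vertices and $0<\gamma<1/4$, $G$ is called $\gamma$-non-extremal if for every pair of (not necessarily disjoint) subsets $A,B\subseteq V$ with $|A|=|B|=\lfloor n/2\rfloor$ we have $e(A,B)>\gamma n^2$, where $e(A,B)$ is the number of edges with one endpoint in $A$ and the other in $B$; otherwise $G$ is $\gamma$-extremal. The notation $\alpha\ll\beta$ means that $\alpha$ is sufficiently small compared to $\beta$ (concretely, $\alpha\le\beta^c$ for a suitable positive integer constant $c$); so the hypothesis means $\gamma$ is a sufficiently small positive constant and $\nu$ is sufficiently small with respect to $\gamma$. -}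

module Defs where

open import Data.Nat using (ℕ; zero; suc; _+_; _≤_; _<_; _/_)
open import Data.Bool using (Bool; true; false; _∧_; _∨_; if_then_else_)
open import Data.Fin using (Fin; toℕ)
open import Data.Fin.Subset using (Subset; Side; inside; outside; ∣_∣)
open import Data.Nat.ListAction using (sum)
open import Data.List using (List; []; _∷_; map; length; allFin; lookup)
open import Data.Vec as Vec using ()
open import Data.List.Relation.Unary.Unique.Propositional using (Unique)
open import Data.Product using (Σ; ∃; _×_; _,_)
open import Data.Integer using (+_)
open import Data.Rational as ℚ using (ℚ)
open import Relation.Binary.PropositionalEquality using (_≡_)
open import Relation.Nullary using (¬_)
open import Function.Definitions using (Injective)

record Graph (n : ℕ) : Set where
  field
    adj   : Fin n → Fin n → Bool
    sym   : ∀ u v → adj u v ≡ adj v u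
    irrefl : ∀ v → adj v v ≡ false
open Graph public

_~[_]_ : ∀ {n} → Fin n → Graph n → Fin n → Set
u ~[ G ] v = adj G u v ≡ true

count : ∀ {n} → (Fin n → Bool) → ℕ
count {n} p = sum (map (λ v → if p v then 1 else 0) (allFin n))

deg : ∀ {n} → Graph n → Fin n → ℕ
deg G v = count (λ w → adj G v w)

ℕ→ℚ : ℕ → ℚ
ℕ→ℚ k = (+ k) ℚ./ 1

MinDegreeAtLeast : ∀ {n} → Graph n → ℚ → Set
MinDegreeAtLeast {n} G x = ∀ v → x ℚ.≤ ℕ→ℚ (deg G v)

MaxDegreeAtMost : ∀ {n} → Graph n → ℕ → Set
MaxDegreeAtMost G D = ∀ v → deg G v ≤ D

isIn : Side → Bool
isIn inside  = true
isIn outside = false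

_∈ᵇ_ : ∀ {n} → Fin n → Subset n → Bool
x ∈ᵇ A = isIn (Vec.lookup A x)

-- e(A,B): number of (unordered) edges uv of G with one endpoint in A and
-- the other in B.  Each edge {u,v} is counted once, via the pair u < v.
eAB : ∀ {n} → Graph n → Subset n → Subset n → ℕ
eAB {n} G A B =
  sum (map (λ u → count (λ v →
        if Data.Nat._<ᵇ_ (toℕ u) (toℕ v)
        then adj G u v ∧ ((u ∈ᵇ A ∧ v ∈ᵇ B) ∨ (u ∈ᵇ B ∧ v ∈ᵇ A))
        else false)) (allFin n))
  where import Data.Nat

NonExtremal : ∀ {n} → ℚ → Graph n → Set
NonExtremal {n} γ G =
  (A B : Subset n) → ∣ A ∣ ≡ n / 2 → ∣ B ∣ ≡ n / 2 →
  γ ℚ.* ℕ→ℚ (n Data.Nat.* n) ℚ.< ℕ→ℚ (eAB G A B)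
  where import Data.Nat

data Walk {n} (G : Graph n) : Fin n → Fin n → Set where
  here  : ∀ v → Walk G v v
  step  : ∀ {u v w} → u ~[ G ] v → Walk G v w → Walk G u w

Connected : ∀ {n} → Graph n → Set
Connected G = ∀ u v → Walk G u v

Path : ∀ {n} → Graph n → List (Fin n) → Set
Path G []           = Data.Unit.⊤ where import Data.Unit
Path G (v ∷ [])     = Data.Unit.⊤ where import Data.Unit
Path G (u ∷ v ∷ vs) = u ~[ G ] v × Path G (v ∷ vs)

Cycle : ∀ {n} → Graph n → List (Fin n) → Set
Cycle G [] = Data.Empty.⊥ where import Data.Empty
Cycle G (v₀ ∷ vs) =
  3 ≤ length (v₀ ∷ vs) × Unique (v₀ ∷ vs) × Path G (v₀ ∷ vs) ×
  lookup (v₀ ∷ vs) (Data.Fin.fromℕ (length vs)) ~[ G ] v₀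
  where import Data.Fin

Acyclic : ∀ {n} → Graph n → Set
Acyclic G = ∀ cs → ¬ Cycle G cs

IsTree : ∀ {n} → Graph n → Set
IsTree G = Connected G × Acyclic G

SubgraphOf : ∀ {m n} → Graph m → Graph n → Set
SubgraphOf {m} {n} T G =
  Σ (Fin m → Fin n) λ φ → Injective _≡_ _≡_ φ ×
    (∀ u v → u ~[ T ] v → φ u ~[ G ] φ v)

{-# OPTIONS --safe #-}
module Submission where

open import Defs hiding (sym; here; step)
open import Data.Bool using (Bool; T; true; false; _∧_; _∨_; not; if_then_else_)
open import Data.Bool.Properties using (¬-not)
open import Data.Empty using (⊥; ⊥-elim)
open import Data.Fin as Fin using (Fin; toℕ; fromℕ<)
import Data.Fin.Properties as Fin
open import Data.Fin.Subset using (Subset; ∣_∣)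
open import Data.Integer as ℤ using (-[1+_])
import Data.Integer.Properties as ℤ
open import Data.List using (List; []; _∷_; _++_; map; length; upTo; cartesianProduct)
import Data.List.Properties as List
open import Data.List.Membership.Propositional using (_∈_)
open import Data.List.Membership.Propositional.Properties using (∈-map⁺; ∈-++⁺ˡ; ∈-++⁺ʳ; ∈-cartesianProduct⁺; ∈-cartesianProduct⁻; ∈-upTo⁺; ∈-upTo⁻)
open import Data.List.Relation.Unary.All as All using (All; []; _∷_)
import Data.List.Relation.Unary.All.Properties as All
open import Data.List.Relation.Unary.AllPairs using ([]; _∷_)
open import Data.List.Relation.Unary.Any using (here; there)
open import Data.List.Relation.Unary.Unique.Propositional using (Unique)
open import Data.Nat using (ℕ; zero; suc; _+_; _*_; _∸_; _^_; _/_; _%_; _≤_; _<_; _≤ᵇ_; _<ᵇ_; _≡ᵇ_; _≟_; _≤?_; _<?_; z≤n; s≤s; NonZero; >-nonZero)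
open import Data.Nat.DivMod using (m≡m%n+[m/n]*n; m%n<n; m/n*n≤m; m<n⇒m%n≡m; n/n≡1; [m+n]%n≡m%n; [m+kn]%n≡m%n; m*n/n≡m; %-distribˡ-+; /-monoˡ-≤)
open import Data.Nat.Properties
open import Data.Nat.ListAction using () renaming (sum to sumᴸ)
import Data.List
open import Data.Nat.Tactic.RingSolver using (solve-∀)
open import Data.Product using (Σ; _×_; _,_; proj₁; proj₂)
open import Data.Rational as ℚ using ()
import Data.Rational.Properties as ℚ
open import Data.Rational.Unnormalised as ℚᵘ using ()
import Data.Rational.Unnormalised.Properties as ℚᵘ
open import Data.Sum using (_⊎_; inj₁; inj₂)
open import Data.Vec as Vec using (Vec; []; _∷_)
import Data.Vec.Properties as Vec
open import Function using (_∘_; id)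
open import Relation.Binary.Definitions using (Tri; tri<; tri≈; tri>)
open import Relation.Binary.PropositionalEquality hiding ([_]; J)
open import Relation.Nullary using (yes; no)

-- Since G is non-extremal and all degrees are at least about n/2, the pairs of neighbourhoods
-- N(u), N(v), and also the pairs of non-neighbourhoods of size about n/2, span a positive density of edges.  These are
-- polynomially many conditions, so a derandomised Chernoff bound cuts V(G) into M equal parts which inherit them; M is
-- a constant.  Then a bad pair of a bijection between two parts can always be repaired by rotating three values, so any
-- two parts have a perfect matching in G.  Even more, one part has matchings to D + 1 others such that for all u, w a
-- constant proportion of its vertices z is adjacent to u while all partners of z are adjacent to w.
--
-- The tree is cut into components of bounded size and a small set of free vertices such that every component hangs
-- from the rest by its own path of three edges; which paths are used is decided by averaging over a stationary Markov
-- chain on the levels.  Components of the same shape are embedded simultaneously by following matchings along their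
-- edges, so the parts are filled almost completely.  The free vertices follow greedily, as any two vertices of G are
-- joined by a positive density of paths of length three.  This embeds the tree up to a few vertices, to be added leaf by
-- leaf: if the parent of the next vertex is mapped to u and w is an unused vertex of G, then some vertex of the tree
-- mapped to a vertex z as above is moved to w, and z becomes the image of the new leaf.

-- Two vertices of `G` may lack a common neighbour, while `N(u)` and `N(v)` always span many edges:
-- three is the least length in which connecting paths are guaranteed, and this dictates how
-- components hang. The proof is a balance of losses, and the constants must be chosen in one order.
-- With `g` the denominator of γ, so that `1/g ≤ γ`, the star constant `c` depends on `g` and `D`
-- only. The number `h` of levels is large against `c`: only a proportion of order `D³ / h` of the
-- tree is free, and `s` of the `M` parts are reserved for it. The number `L` of labels depends on
-- `h` and is enormous, and every label may waste most of one part, so `M` is chosen after `L`; the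
-- part size `N` comes last. About `(s + L) * N` vertices are missing at the end and spoil twice as
-- many absorbers, whereas for every pair of vertices of `G` the absorbers make up a proportion of
-- order `1 / (D * c)` of the tree. Hence `s + L` has to be small against `M / (D * c)`.

-- Indicator sums, counting and averaging.

⟦_⟧ : Bool → ℕ
⟦ true ⟧ = 1
⟦ false ⟧ = 0

∑ : ℕ → (ℕ → ℕ) → ℕ
∑ zero f = 0
∑ (suc n) f = ∑ n f + f n

# : ℕ → (ℕ → Bool) → ℕ
# n p = ∑ n (λ i → ⟦ p i ⟧)

∧-elim : ∀ {a b} → a ∧ b ≡ true → (a ≡ true) × (b ≡ true)
∧-elim {true} {true} _ = refl , refl

∧-intro : ∀ {a b} → a ≡ true → b ≡ true → a ∧ b ≡ true
∧-intro refl refl = refl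

true≢false : ∀ {a} {A : Set a} {b} → b ≡ true → b ≡ false → A
true≢false refl ()

not-true : ∀ {b} → not b ≡ true → b ≡ false
not-true {false} _ = refl

not-false : ∀ {b} → b ≡ false → not b ≡ true
not-false refl = refl

bool-cases : ∀ b → (b ≡ true) ⊎ (b ≡ false)
bool-cases true = inj₁ refl
bool-cases false = inj₂ refl

⟦⟧≤1 : ∀ b → ⟦ b ⟧ ≤ 1
⟦⟧≤1 true = ≤-refl
⟦⟧≤1 false = z≤n

⟦⟧-mono : ∀ {a b} → (a ≡ true → b ≡ true) → ⟦ a ⟧ ≤ ⟦ b ⟧
⟦⟧-mono {true} h rewrite h refl = ≤-refl
⟦⟧-mono {false} h = z≤n

⟦⟧-true : ∀ {b} → b ≡ true → ⟦ b ⟧ ≡ 1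
⟦⟧-true refl = refl

⟦⟧-pos : ∀ {b} → 0 < ⟦ b ⟧ → b ≡ true
⟦⟧-pos {true} _ = refl

⟦⟧-∧ : ∀ a b → ⟦ a ∧ b ⟧ ≡ ⟦ a ⟧ * ⟦ b ⟧
⟦⟧-∧ true b = sym (+-identityʳ _)
⟦⟧-∧ false b = refl

⟦⟧-not : ∀ b → ⟦ b ⟧ + ⟦ not b ⟧ ≡ 1
⟦⟧-not true = refl
⟦⟧-not false = refl

T-true : ∀ {b} → T b → b ≡ true
T-true {true} _ = refl

true-T : ∀ {b} → b ≡ true → T b
true-T refl = _

abstract
  eqb : ℕ → ℕ → Bool
  eqb = _≡ᵇ_

  eqb-≡ : ∀ {i j} → eqb i j ≡ true → i ≡ j
  eqb-≡ {i} {j} h = ≡ᵇ⇒≡ i j (true-T h)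

  ≡-eqb : ∀ {i j} → i ≡ j → eqb i j ≡ true
  ≡-eqb {i} {j} e = T-true (≡⇒≡ᵇ i j e)

  leb : ℕ → ℕ → Bool
  leb = _≤ᵇ_

  leb-≤ : ∀ {i j} → leb i j ≡ true → i ≤ j
  leb-≤ {i} {j} h = ≤ᵇ⇒≤ i j (true-T h)

  ≤-leb : ∀ {i j} → i ≤ j → leb i j ≡ true
  ≤-leb e = T-true (≤⇒≤ᵇ e)

eqb-refl : ∀ i → eqb i i ≡ true
eqb-refl i = ≡-eqb {i} refl

eqb-≢ : ∀ {i j} → i ≢ j → eqb i j ≡ false
eqb-≢ {i} {j} h with bool-cases (eqb i j)
... | inj₁ e = ⊥-elim (h (eqb-≡ e))
... | inj₂ e = e

ltb : ℕ → ℕ → Bool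
ltb i j = leb (suc i) j

-- Certificates for linear arithmetic: A ≤ B is a combination of hypotheses, and the equation is left to the ring solver.
linear : ∀ {A B} k {a b} s → .{{NonZero k}} → A ≤ B → k * a + B + s ≡ k * b + A → a ≤ b
linear {A} {B} k {a} {b} s A≤B e = *-cancelˡ-≤ k (+-cancelʳ-≤ A (k * a) (k * b) (begin
  k * a + A     ≤⟨ +-monoʳ-≤ (k * a) A≤B ⟩
  k * a + B     ≤⟨ m≤m+n _ s ⟩
  k * a + B + s ≡⟨ e ⟩
  k * b + A     ∎))
  where open ≤-Reasoning

∑-mono : ∀ n {f g} → (∀ i → i < n → f i ≤ g i) → ∑ n f ≤ ∑ n g
∑-mono zero h = z≤n
∑-mono (suc n) h = +-mono-≤ (∑-mono n (λ i l → h i (m<n⇒m<1+n l))) (h n ≤-refl)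

∑-cong : ∀ n {f g} → (∀ i → i < n → f i ≡ g i) → ∑ n f ≡ ∑ n g
∑-cong zero h = refl
∑-cong (suc n) h = cong₂ _+_ (∑-cong n (λ i l → h i (m<n⇒m<1+n l))) (h n ≤-refl)

∑-+ : ∀ n f g → ∑ n (λ i → f i + g i) ≡ ∑ n f + ∑ n g
∑-+ zero f g = refl
∑-+ (suc n) f g rewrite ∑-+ n f g = lem (∑ n f) (∑ n g) (f n) (g n)
  where
  lem : ∀ a b c d → a + b + (c + d) ≡ a + c + (b + d)
  lem = solve-∀

∑-* : ∀ n c f → ∑ n (λ i → c * f i) ≡ c * ∑ n f
∑-* zero c f = sym (*-zeroʳ c)
∑-* (suc n) c f rewrite ∑-* n c f = sym (*-distribˡ-+ c _ _)

∑-const : ∀ n c → ∑ n (λ _ → c) ≡ n * c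
∑-const zero c = refl
∑-const (suc n) c rewrite ∑-const n c = +-comm (n * c) c

∑-0 : ∀ n → ∑ n (λ _ → 0) ≡ 0
∑-0 n = trans (∑-const n 0) (*-zeroʳ n)

∑-swap : ∀ m n (f : ℕ → ℕ → ℕ) → ∑ m (λ i → ∑ n (f i)) ≡ ∑ n (λ j → ∑ m (λ i → f i j))
∑-swap zero n f = sym (∑-0 n)
∑-swap (suc m) n f rewrite ∑-swap m n f = sym (∑-+ n _ _)

∑-pick : ∀ n f i → i < n → f i ≤ ∑ n f
∑-pick (suc n) f i (s≤s i≤n) with m≤n⇒m<n∨m≡n i≤n
... | inj₁ l = ≤-trans (∑-pick n f i l) (m≤m+n _ _)
... | inj₂ refl = m≤n+m _ _

∑-split : ∀ m n f → ∑ (m + n) f ≡ ∑ m f + ∑ n (λ i → f (m + i))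
∑-split m zero f rewrite +-identityʳ m = sym (+-identityʳ _)
∑-split m (suc n) f rewrite +-suc m n | ∑-split m n f = +-assoc (∑ m f) _ _

∑-mono-≤ : ∀ {m n} f → m ≤ n → ∑ m f ≤ ∑ n f
∑-mono-≤ {m} {n} f m≤n = subst (λ k → ∑ m f ≤ ∑ k f) (m+[n∸m]≡n m≤n)
  (subst (∑ m f ≤_) (sym (∑-split m (n ∸ m) f)) (m≤m+n _ _))

-- Together with `avg-≥` this takes the place of every random choice.
avg-≤ : ∀ n f → 0 < n → Σ ℕ λ i → i < n × n * f i ≤ ∑ n f
avg-≤ (suc zero) f _ = 0 , s≤s z≤n , ≤-reflexive (+-identityʳ _)
avg-≤ (suc (suc n)) f _ with avg-≤ (suc n) f (s≤s z≤n)
... | i , i<n , h with f i ≤? f (suc n)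
... | yes l = i , m<n⇒m<1+n i<n , ≤-trans (≤-reflexive (+-comm (f i) _)) (+-mono-≤ h l)
... | no l = suc n , ≤-refl , ≤-trans (≤-reflexive (+-comm (f (suc n)) _))
      (+-monoˡ-≤ _ (≤-trans (*-monoʳ-≤ (suc n) (<⇒≤ (≰⇒> l))) h))

avg-≥ : ∀ n f → 0 < n → Σ ℕ λ i → i < n × ∑ n f ≤ n * f i
avg-≥ (suc zero) f _ = 0 , s≤s z≤n , ≤-reflexive (sym (+-identityʳ _))
avg-≥ (suc (suc n)) f _ with avg-≥ (suc n) f (s≤s z≤n)
... | i , i<n , h with f (suc n) ≤? f i
... | yes l = i , m<n⇒m<1+n i<n , ≤-trans (+-mono-≤ h l) (≤-reflexive (+-comm _ (f i)))
... | no l = suc n , ≤-refl , ≤-trans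
      (+-monoˡ-≤ _ (≤-trans h (*-monoʳ-≤ (suc n) (<⇒≤ (≰⇒> l))))) (≤-reflexive (+-comm _ (f (suc n))))

search : ∀ n (p : ℕ → Bool) → (Σ ℕ λ i → i < n × p i ≡ true) ⊎ (∀ i → i < n → p i ≡ false)
search zero p = inj₂ (λ i ())
search (suc n) p with bool-cases (p n)
... | inj₁ h = inj₁ (n , ≤-refl , h)
... | inj₂ h with search n p
... | inj₁ (i , l , e) = inj₁ (i , m<n⇒m<1+n l , e)
... | inj₂ k = inj₂ λ i l → aux i (m≤n⇒m<n∨m≡n (≤-pred l))
  where
  aux : ∀ i → i < n ⊎ i ≡ n → p i ≡ false
  aux i (inj₁ l) = k i l
  aux i (inj₂ refl) = h

#-mono : ∀ n {p q} → (∀ i → i < n → p i ≡ true → q i ≡ true) → # n p ≤ # n q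
#-mono n h = ∑-mono n (λ i l → ⟦⟧-mono (h i l))

#-cong : ∀ n {p q} → (∀ i → i < n → p i ≡ q i) → # n p ≡ # n q
#-cong n h = ∑-cong n (λ i l → cong ⟦_⟧ (h i l))

#-≤ : ∀ n p → # n p ≤ n
#-≤ n p = ≤-trans (∑-mono n (λ i _ → ⟦⟧≤1 (p i))) (≤-reflexive (trans (∑-const n 1) (*-identityʳ n)))

#-all : ∀ n {p} → (∀ i → i < n → p i ≡ true) → # n p ≡ n
#-all n h = trans (∑-cong n (λ i l → ⟦⟧-true (h i l))) (trans (∑-const n 1) (*-identityʳ n))

#-none : ∀ n {p} → (∀ i → i < n → p i ≡ false) → # n p ≡ 0
#-none n h = trans (∑-cong n (λ i l → cong ⟦_⟧ (h i l))) (∑-0 n)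

#-not : ∀ n p → # n p + # n (not ∘ p) ≡ n
#-not n p = trans (sym (∑-+ n _ _)) (trans (∑-cong n (λ i _ → ⟦⟧-not (p i))) (trans (∑-const n 1) (*-identityʳ n)))

#-pos : ∀ n p → 0 < # n p → Σ ℕ λ i → i < n × p i ≡ true
#-pos n p h with search n p
... | inj₁ w = w
... | inj₂ k = ⊥-elim (n≮0 (subst (0 <_) (#-none n k) h))

#-cover : ∀ n {r p q} → (∀ i → i < n → r i ≡ true → (p i ≡ true) ⊎ (q i ≡ true)) → # n r ≤ # n p + # n q
#-cover n {r} {p} {q} h = ≤-trans (∑-mono n aux) (≤-reflexive (∑-+ n _ _))
  where
  aux : ∀ i → i < n → ⟦ r i ⟧ ≤ ⟦ p i ⟧ + ⟦ q i ⟧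
  aux i l with bool-cases (r i)
  ... | inj₂ e rewrite e = z≤n
  ... | inj₁ e rewrite e with h i l e
  ... | inj₁ e′ rewrite e′ = s≤s z≤n
  ... | inj₂ e′ rewrite e′ = m≤n+m 1 _

#-more : ∀ n {p q} → # n q < # n p → Σ ℕ λ i → i < n × p i ≡ true × q i ≡ false
#-more n {p} {q} h with search n (λ i → p i ∧ not (q i))
... | inj₁ (i , l , e) = i , l , proj₁ (∧-elim e) , not-true (proj₂ (∧-elim e))
... | inj₂ k = ⊥-elim (<⇒≱ h (#-mono n aux))
  where
  aux : ∀ i → i < n → p i ≡ true → q i ≡ true
  aux i l e with bool-cases (q i)
  ... | inj₁ e′ = e′
  ... | inj₂ e′ = true≢false (∧-intro e (not-false e′)) (k i l)

#-unique : ∀ n p → (∀ i j → i < n → j < n → p i ≡ true → p j ≡ true → i ≡ j) → # n p ≤ 1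
#-unique zero p h = z≤n
#-unique (suc n) p h with bool-cases (p n)
... | inj₂ e rewrite e | +-identityʳ (# n p) = #-unique n p (λ i j a b → h i j (m<n⇒m<1+n a) (m<n⇒m<1+n b))
... | inj₁ e rewrite e = ≤-reflexive (cong (_+ 1) (#-none n aux))
  where
  aux : ∀ i → i < n → p i ≡ false
  aux i l with bool-cases (p i)
  ... | inj₂ e′ = e′
  ... | inj₁ e′ = ⊥-elim (<⇒≢ l (h i n (m<n⇒m<1+n l) ≤-refl e′ e))

#-point : ∀ n i → i < n → # n (eqb i) ≡ 1
#-point n i l = ≤-antisym
  (#-unique n (eqb i) (λ a b _ _ e e′ → trans (sym (eqb-≡ e)) (eqb-≡ e′)))
  (≤-trans (≤-reflexive (sym (⟦⟧-true (eqb-refl i)))) (∑-pick n (λ j → ⟦ eqb i j ⟧) i l))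

∑-point : ∀ n i (f : ℕ → ℕ) → i < n → ∑ n (λ j → ⟦ eqb i j ⟧ * f j) ≡ f i
∑-point n i f l = trans (∑-cong n (λ j _ → aux j))
    (trans (∑-* n (f i) (λ j → ⟦ eqb i j ⟧)) (trans (cong (λ z → f i * z) (#-point n i l)) (*-identityʳ _)))
  where
  aux : ∀ j → ⟦ eqb i j ⟧ * f j ≡ f i * ⟦ eqb i j ⟧
  aux j with bool-cases (eqb i j)
  ... | inj₁ e rewrite e | sym (eqb-≡ e) = *-comm 1 (f i)
  ... | inj₂ e rewrite e = sym (*-zeroʳ (f i))

-- Double counting of the pairs `(r , i)` with `key i ≡ r`: each `r` on the left lies in some pair,
-- each `i` in at most one. No witness has to be chosen as a function of `r`.
#-key : ∀ t m {q p} (key : ℕ → ℕ) →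
  (∀ r → r < t → q r ≡ true → Σ ℕ λ i → i < m × p i ≡ true × key i ≡ r) → # t q ≤ # m p
#-key t m {q} {p} key h = begin
  # t q                                       ≤⟨ ∑-mono t step ⟩
  ∑ t (λ r → # m (λ i → p i ∧ eqb (key i) r)) ≡⟨ ∑-swap t m (λ r i → ⟦ p i ∧ eqb (key i) r ⟧) ⟩
  ∑ m (λ i → # t (λ r → p i ∧ eqb (key i) r)) ≤⟨ ∑-mono m col ⟩
  # m p                                       ∎
  where
  open ≤-Reasoning
  step : ∀ r → r < t → ⟦ q r ⟧ ≤ # m (λ i → p i ∧ eqb (key i) r)
  step r l with bool-cases (q r)
  ... | inj₂ e rewrite e = z≤n
  ... | inj₁ e rewrite e with h r l e
  ... | i , i<m , pi , ki = ≤-trans (≤-reflexive (sym (⟦⟧-true (∧-intro pi (≡-eqb ki)))))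
                             (∑-pick m (λ i → ⟦ p i ∧ eqb (key i) r ⟧) i i<m)
  col : ∀ i → i < m → # t (λ r → p i ∧ eqb (key i) r) ≤ ⟦ p i ⟧
  col i l with bool-cases (p i)
  ... | inj₁ e rewrite e = #-unique t _ (λ a b _ _ x y → trans (sym (eqb-≡ x)) (eqb-≡ y))
  ... | inj₂ e rewrite e = ≤-reflexive (∑-0 t)

#-inj : ∀ t m {q p} (f : ℕ → ℕ) → (∀ i → i < t → q i ≡ true → f i < m × p (f i) ≡ true) →
  (∀ i j → i < t → j < t → q i ≡ true → q j ≡ true → f i ≡ f j → i ≡ j) → # t q ≤ # m p
#-inj t m {q} {p} f h inj = begin
  # t q                                       ≤⟨ ∑-mono t step ⟩
  ∑ t (λ i → # m (λ j → q i ∧ (p j ∧ eqb (f i) j))) ≡⟨ ∑-swap t m (λ i j → ⟦ q i ∧ (p j ∧ eqb (f i) j) ⟧) ⟩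
  ∑ m (λ j → # t (λ i → q i ∧ (p j ∧ eqb (f i) j))) ≤⟨ ∑-mono m col ⟩
  # m p                                       ∎
  where
  open ≤-Reasoning
  step : ∀ i → i < t → ⟦ q i ⟧ ≤ # m (λ j → q i ∧ (p j ∧ eqb (f i) j))
  step i l with bool-cases (q i)
  ... | inj₂ e rewrite e = z≤n
  ... | inj₁ e = ≤-trans (≤-reflexive (cong ⟦_⟧ (trans e (sym
                   (∧-intro {q i} e (∧-intro {p (f i)} (proj₂ (h i l e)) (eqb-refl (f i))))))))
                 (∑-pick m (λ j → ⟦ q i ∧ (p j ∧ eqb (f i) j) ⟧) (f i) (proj₁ (h i l e)))
  col : ∀ j → j < m → # t (λ i → q i ∧ (p j ∧ eqb (f i) j)) ≤ ⟦ p j ⟧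
  col j l with bool-cases (p j)
  ... | inj₂ e = ≤-trans (≤-reflexive (#-none t (λ i _ → aux i))) z≤n
    where
    aux : ∀ i → q i ∧ (p j ∧ eqb (f i) j) ≡ false
    aux i with bool-cases (q i ∧ (p j ∧ eqb (f i) j))
    ... | inj₂ z = z
    ... | inj₁ z = true≢false (proj₁ (∧-elim {p j} (proj₂ (∧-elim {q i} z)))) e
  ... | inj₁ e rewrite e = #-unique t _ (λ a b la lb x y →
          inj a b la lb (proj₁ (∧-elim x)) (proj₁ (∧-elim y))
            (trans (eqb-≡ (proj₂ (∧-elim {q a} x))) (sym (eqb-≡ (proj₂ (∧-elim {q b} y))))))

∑ᴸ : ∀ {A : Set} → List A → (A → ℕ) → ℕ
∑ᴸ [] f = 0
∑ᴸ (x ∷ xs) f = f x + ∑ᴸ xs f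

∑ᴸ-mono : ∀ {A : Set} (xs : List A) {f g} → (∀ x → f x ≤ g x) → ∑ᴸ xs f ≤ ∑ᴸ xs g
∑ᴸ-mono [] h = z≤n
∑ᴸ-mono (x ∷ xs) h = +-mono-≤ (h x) (∑ᴸ-mono xs h)

∑ᴸ-cong : ∀ {A : Set} (xs : List A) {f g} → (∀ x → f x ≡ g x) → ∑ᴸ xs f ≡ ∑ᴸ xs g
∑ᴸ-cong [] h = refl
∑ᴸ-cong (x ∷ xs) h = cong₂ _+_ (h x) (∑ᴸ-cong xs h)

∑ᴸ-+ : ∀ {A : Set} (xs : List A) f g → ∑ᴸ xs (λ x → f x + g x) ≡ ∑ᴸ xs f + ∑ᴸ xs g
∑ᴸ-+ [] f g = refl
∑ᴸ-+ (x ∷ xs) f g rewrite ∑ᴸ-+ xs f g = lem (f x) (g x) (∑ᴸ xs f) (∑ᴸ xs g)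
  where
  lem : ∀ a b c d → a + b + (c + d) ≡ a + c + (b + d)
  lem = solve-∀

∑ᴸ-* : ∀ {A : Set} (xs : List A) c f → ∑ᴸ xs (λ x → c * f x) ≡ c * ∑ᴸ xs f
∑ᴸ-* [] c f = sym (*-zeroʳ c)
∑ᴸ-* (x ∷ xs) c f rewrite ∑ᴸ-* xs c f = sym (*-distribˡ-+ c _ _)

∑ᴸ-one : ∀ {A : Set} (xs : List A) → ∑ᴸ xs (λ _ → 1) ≡ length xs
∑ᴸ-one [] = refl
∑ᴸ-one (x ∷ xs) = cong suc (∑ᴸ-one xs)

∑ᴸ-pick : ∀ {A : Set} {xs : List A} (f : A → ℕ) {x} → x ∈ xs → f x ≤ ∑ᴸ xs f
∑ᴸ-pick f (here refl) = m≤m+n _ _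
∑ᴸ-pick f (there i) = ≤-trans (∑ᴸ-pick f i) (m≤n+m _ _)

∑ᴸ-∑-swap : ∀ {A : Set} (xs : List A) n (f : ℕ → A → ℕ) → ∑ n (λ i → ∑ᴸ xs (f i)) ≡ ∑ᴸ xs (λ x → ∑ n (λ i → f i x))
∑ᴸ-∑-swap [] n f = ∑-0 n
∑ᴸ-∑-swap (x ∷ xs) n f = trans (∑-+ n _ _) (cong (λ z → ∑ n (λ i → f i x) + z) (∑ᴸ-∑-swap xs n f))

-- Power inequalities and the derandomised Chernoff bound.

-- Bernoulli's inequality `(1 + 1/q)^j ≥ 1 + j/q`, with denominators cleared.
bernoulli : ∀ q j → q ^ j * (q + j) ≤ q * suc q ^ j
bernoulli q zero = ≤-reflexive (lem q)
  where
  lem : ∀ q → 1 * (q + 0) ≡ q * 1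
  lem = solve-∀
bernoulli q (suc j) = begin
  q * q ^ j * (q + suc j)              ≤⟨ m≤m+n _ _ ⟩
  q * q ^ j * (q + suc j) + q ^ j * j  ≡⟨ e₁ q j (q ^ j) ⟩
  suc q * (q ^ j * (q + j))            ≤⟨ *-monoʳ-≤ (suc q) (bernoulli q j) ⟩
  suc q * (q * suc q ^ j)              ≡⟨ e₂ (suc q) q (suc q ^ j) ⟩
  q * (suc q * suc q ^ j)              ∎
  where
  open ≤-Reasoning
  e₁ : ∀ q j x → q * x * (q + suc j) + x * j ≡ suc q * (x * (q + j))
  e₁ = solve-∀
  e₂ : ∀ a b c → a * (b * c) ≡ b * (a * c)
  e₂ = solve-∀

-- The same for a base below one: `(1 − 1/(q+1))^a ≥ 1 − a/(q+1)`, where `c` is the numerator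
-- `q + 1 − a`.
bernoulli⁻ : ∀ a c q → c + a ≡ suc q → suc q ^ a * c ≤ q ^ a * suc q
bernoulli⁻ zero c q e = ≤-reflexive (cong (1 *_) (trans (sym (+-identityʳ c)) e))
bernoulli⁻ (suc a) c q e = begin
  suc q * suc q ^ a * c       ≡⟨ e₁ (suc q) (suc q ^ a) c ⟩
  suc q ^ a * (suc q * c)     ≤⟨ *-monoʳ-≤ (suc q ^ a) le ⟩
  suc q ^ a * (q * suc c)     ≡⟨ e₂ (suc q ^ a) q (suc c) ⟩
  q * (suc q ^ a * suc c)     ≤⟨ *-monoʳ-≤ q (bernoulli⁻ a (suc c) q (trans (sym (+-suc c a)) e)) ⟩
  q * (q ^ a * suc q)         ≡⟨ sym (*-assoc q _ _) ⟩
  q * q ^ a * suc q           ∎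
  where
  open ≤-Reasoning
  e₁ : ∀ a b c → a * b * c ≡ b * (a * c)
  e₁ = solve-∀
  e₂ : ∀ a b c → a * (b * c) ≡ b * (a * c)
  e₂ = solve-∀
  c≤q : c ≤ q
  c≤q = ≤-trans (m≤m+n c a) (≤-reflexive (suc-injective (trans (sym (+-suc c a)) e)))
  le : suc q * c ≤ q * suc c
  le = ≤-trans (+-monoˡ-≤ (q * c) c≤q) (≤-reflexive (sym (*-suc q c)))

^-pos : ∀ q j → 0 < q → 0 < q ^ j
^-pos (suc q) zero _ = s≤s z≤n
^-pos (suc q) (suc j) _ = *-mono-≤ {1} {suc q} (s≤s z≤n) (^-pos (suc q) j (s≤s z≤n))

^-distribʳ : ∀ j a b → (a * b) ^ j ≡ a ^ j * b ^ j
^-distribʳ zero a b = refl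
^-distribʳ (suc j) a b = trans (cong (λ z → a * b * z) (^-distribʳ j a b)) (lem a b (a ^ j) (b ^ j))
  where
  lem : ∀ a b x y → a * b * (x * y) ≡ a * x * (b * y)
  lem = solve-∀

pos* : ∀ {a b} → 0 < a → 0 < b → 0 < a * b
pos* p q = *-mono-≤ p q

-- The remainder is at most 4, hence at most the quotient once `J ≥ 20`.
J≤6j : ∀ J → 20 ≤ J → J ≤ 6 * (J / 5)
J≤6j J h = begin
  J                       ≡⟨ m≡m%n+[m/n]*n J 5 ⟩
  J % 5 + J / 5 * 5       ≤⟨ +-monoˡ-≤ (J / 5 * 5) (≤-trans (≤-pred (m%n<n J 5)) (/-monoˡ-≤ 5 h)) ⟩
  J / 5 + J / 5 * 5       ≡⟨ cong (λ z → J / 5 + z) (*-comm (J / 5) 5) ⟩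
  6 * (J / 5)             ∎
  where open ≤-Reasoning

-- For `j = J / 5` Bernoulli gives `j * Q ^ j ≤ Q * suc Q ^ j`. Its fifth power carries `j ^ 5`:
-- four of these factors pay for `J ^ 4 ≤ 1296 * j ^ 4`, the fifth one for all constants.
exp-beats-quartic : ∀ C Q → 0 < Q → Σ ℕ λ J₀ → ∀ J → J₀ ≤ J → C * J ^ 4 * Q ^ J < suc Q ^ J
exp-beats-quartic C Q Q>0 = 20 + (K + 1) * 5 , main
  where
  K = 1296 * C * Q ^ 5
  main : ∀ J → 20 + (K + 1) * 5 ≤ J → C * J ^ 4 * Q ^ J < suc Q ^ J
  main J h = *-cancelˡ-< (Q ^ 5) _ _ (begin-strict
    Q ^ 5 * (C * J ^ 4 * Q ^ J)             ≤⟨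
        *-monoʳ-≤ (Q ^ 5) (*-monoˡ-≤ (Q ^ J) (*-monoʳ-≤ C (^-monoˡ-≤ 4 (J≤6j J (≤-trans (m≤m+n 20 _) h))))) ⟩
    Q ^ 5 * (C * (6 * j) ^ 4 * Q ^ J)       ≡⟨ e₁ (Q ^ 5) C j (Q ^ J) ⟩
    K * (j ^ 4 * Q ^ J)                     <⟨ *-monoˡ-< (j ^ 4 * Q ^ J) K<j ⟩
    j * (j ^ 4 * Q ^ J)                     ≡⟨ sym (*-assoc j (j ^ 4) (Q ^ J)) ⟩
    j ^ 5 * Q ^ J                           ≤⟨ pow5 ⟩
    Q ^ 5 * suc Q ^ J                       ∎)
    where
    open ≤-Reasoning
    j = J / 5
    K<j : K < j
    K<j = subst (_≤ j) (trans (m*n/n≡m (K + 1) 5) (+-comm K 1)) (/-monoˡ-≤ 5 (≤-trans (m≤n+m _ 20) h))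
    instance
      nz : NonZero (j ^ 4 * Q ^ J)
      nz = >-nonZero (pos* (^-pos j 4 (≤-trans (s≤s z≤n) K<j)) (^-pos Q J Q>0))
    e₁ : ∀ q c j x → q * (c * ((6 * j) * ((6 * j) * ((6 * j) * ((6 * j) * 1)))) * x) ≡ 1296 * c * q *
        ((j * (j * (j * (j * 1)))) * x)
    e₁ = solve-∀
    r = J % 5
    J≡ : j * 5 + r ≡ J
    J≡ = trans (+-comm _ r) (sym (m≡m%n+[m/n]*n J 5))
    base : j * Q ^ j ≤ Q * suc Q ^ j
    base = ≤-trans (≤-trans (≤-reflexive (*-comm j _)) (*-monoʳ-≤ (Q ^ j) (m≤n+m j Q))) (bernoulli Q j)
    split : ∀ x → (x ^ j) ^ 5 * x ^ r ≡ x ^ J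
    split x = trans (cong (_* x ^ r) (^-*-assoc x j 5)) (trans (sym (^-distribˡ-+-* x (j * 5) r)) (cong (x ^_) J≡))
    dist : ∀ a b → (a * b) ^ 5 ≡ a ^ 5 * b ^ 5
    dist = ^-distribʳ 5
    pow5 : j ^ 5 * Q ^ J ≤ Q ^ 5 * suc Q ^ J
    pow5 = begin
      j ^ 5 * Q ^ J                           ≡⟨ cong (j ^ 5 *_) (sym (split Q)) ⟩
      j ^ 5 * ((Q ^ j) ^ 5 * Q ^ r)           ≡⟨ sym (*-assoc (j ^ 5) _ _) ⟩
      j ^ 5 * (Q ^ j) ^ 5 * Q ^ r             ≡⟨ cong (_* Q ^ r) (sym (dist j (Q ^ j))) ⟩
      (j * Q ^ j) ^ 5 * Q ^ r                 ≤⟨ *-mono-≤ (^-monoˡ-≤ 5 base) (^-monoˡ-≤ r (n≤1+n Q)) ⟩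
      (Q * suc Q ^ j) ^ 5 * suc Q ^ r         ≡⟨ cong (_* suc Q ^ r) (dist Q (suc Q ^ j)) ⟩
      Q ^ 5 * (suc Q ^ j) ^ 5 * suc Q ^ r     ≡⟨ *-assoc (Q ^ 5) _ _ ⟩
      Q ^ 5 * ((suc Q ^ j) ^ 5 * suc Q ^ r)   ≡⟨ cong (Q ^ 5 *_) (split (suc Q)) ⟩
      Q ^ 5 * suc Q ^ J                       ∎

-- The multiplier of a weight, scaled by `q`: `1 + a/q` after a miss and `1 − (B − a)/q` after a
-- hit. If hits have frequency `a/B`, the mean is exactly `q`.
fac : ℕ → ℕ → ℕ → Bool → ℕ
fac q B a false = q + a
fac q B a true = q + a ∸ B

-- A miss: `(1 + 1/q)^a` is at most `(q+1)/(q+1−a)` by `bernoulli⁻`, and `1 + a/q` falls short of it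
-- only by a second-order term of relative size about `a²/q²`, which `4 * (a * a) ≤ q` keeps below
-- `1/(4 q)`. Here `p / (4 * q)` is `1 − 1/(4 q)`.
factor-up : ∀ q a p → 4 * (a * a) ≤ q → a ≤ q → suc p ≡ 4 * q → q * suc q ^ a * p ≤ (q + a) * q ^ a * (4 * q)
factor-up q a p h a≤q e = *-cancelʳ-≤ _ _ (suc q) (begin
  q * suc q ^ a * p * suc q             ≡⟨ e₁ q (suc q ^ a) p (suc q) ⟩
  suc q ^ a * q * (p * suc q)           ≤⟨ *-monoʳ-≤ (suc q ^ a * q) key ⟩
  suc q ^ a * q * ((q + a) * (4 * c))   ≡⟨ e₂ (suc q ^ a) q (q + a) c ⟩
  (q + a) * (4 * q) * (suc q ^ a * c)   ≤⟨ *-monoʳ-≤ ((q + a) * (4 * q)) (bernoulli⁻ a c q c+a) ⟩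
  (q + a) * (4 * q) * (q ^ a * suc q)   ≡⟨ e₃ (q + a) (4 * q) (q ^ a) (suc q) ⟩
  (q + a) * q ^ a * (4 * q) * suc q     ∎)
  where
  open ≤-Reasoning
  c′ = q ∸ a
  c = suc c′
  q≡ : c′ + a ≡ q
  q≡ = m∸n+n≡m a≤q
  c+a : c + a ≡ suc q
  c+a = cong suc q≡
  e₁ : ∀ q x p y → q * x * p * y ≡ x * q * (p * y)
  e₁ = solve-∀
  e₂ : ∀ x q y c → x * q * (y * (4 * c)) ≡ y * (4 * q) * (x * c)
  e₂ = solve-∀
  e₃ : ∀ y z x s → y * z * (x * s) ≡ y * x * z * s
  e₃ = solve-∀
  e₄ : ∀ c a → 4 * (c + a) * suc (c + a) + 4 * a ≡ (c + a + a) * (4 * suc c) + 4 * (a * a)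
  e₄ = solve-∀
  key : p * suc q ≤ (q + a) * (4 * c)
  key = +-cancelʳ-≤ (suc q) _ _ (begin
    p * suc q + suc q                     ≡⟨ +-comm _ (suc q) ⟩
    suc p * suc q                         ≡⟨ cong (_* suc q) e ⟩
    4 * q * suc q                         ≤⟨ m≤m+n _ _ ⟩
    4 * q * suc q + 4 * a                 ≡⟨
        subst (λ x → 4 * x * suc x + 4 * a ≡ (x + a) * (4 * c) + 4 * (a * a)) q≡ (e₄ c′ a) ⟩
    (q + a) * (4 * c) + 4 * (a * a)       ≤⟨ +-monoʳ-≤ _ (≤-trans h (n≤1+n q)) ⟩
    (q + a) * (4 * c) + suc q             ∎)

-- A hit, with `d = B − a`: `(1 − d/q) (1 + 1/q)^d ≥ (1 − d/q) (1 + d/q) = 1 − d²/q²`.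
factor-down : ∀ q d p → 4 * (d * d) ≤ q → d ≤ q → suc p ≡ 4 * q → q * q ^ d * p ≤ (q ∸ d) * suc q ^ d * (4 * q)
factor-down q d p h d≤q e = begin
  q * q ^ d * p                         ≡⟨ e₁ q (q ^ d) p ⟩
  q ^ d * (q * p)                       ≤⟨ *-monoʳ-≤ (q ^ d) key ⟩
  q ^ d * (4 * (q ∸ d) * (q + d))       ≡⟨ e₂ (q ^ d) (4 * (q ∸ d)) (q + d) ⟩
  4 * (q ∸ d) * (q ^ d * (q + d))       ≤⟨ *-monoʳ-≤ (4 * (q ∸ d)) (bernoulli q d) ⟩
  4 * (q ∸ d) * (q * suc q ^ d)         ≡⟨ e₃ (q ∸ d) q (suc q ^ d) ⟩
  (q ∸ d) * suc q ^ d * (4 * q)         ∎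
  where
  open ≤-Reasoning
  q≡ : (q ∸ d) + d ≡ q
  q≡ = m∸n+n≡m d≤q
  e₁ : ∀ q x p → q * x * p ≡ x * (q * p)
  e₁ = solve-∀
  e₂ : ∀ x y z → x * (y * z) ≡ y * (x * z)
  e₂ = solve-∀
  e₃ : ∀ c q x → 4 * c * (q * x) ≡ c * x * (4 * q)
  e₃ = solve-∀
  e₄ : ∀ c d → (c + d) * (4 * (c + d)) ≡ 4 * c * (c + d + d) + 4 * (d * d)
  e₄ = solve-∀
  key : q * p ≤ 4 * (q ∸ d) * (q + d)
  key = +-cancelʳ-≤ q _ _ (begin
    q * p + q                          ≡⟨ +-comm _ q ⟩
    q + q * p                          ≡⟨ sym (*-suc q p) ⟩
    q * suc p                          ≡⟨ cong (q *_) e ⟩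
    q * (4 * q)                        ≡⟨ subst (λ x → x * (4 * x) ≡ 4 * (q ∸ d) * (x + d) + 4 * (d * d)) q≡
        (e₄ (q ∸ d) d) ⟩
    4 * (q ∸ d) * (q + d) + 4 * (d * d) ≤⟨ +-monoʳ-≤ _ h ⟩
    4 * (q ∸ d) * (q + d) + q          ∎)

-- fac q B a κ / q is compared with (1 + 1/q)^(a − B κ); each step loses a factor 1 − 1/(4 q) only.
factor : ∀ B q p a κ → 4 * (B * B) ≡ q → suc p ≡ 4 * q → a ≤ B → 0 < B →
  q * suc q ^ a * q ^ (B * ⟦ κ ⟧) * p ≤ fac q B a κ * suc q ^ (B * ⟦ κ ⟧) * q ^ a * (4 * q)
factor B q p a κ eq ep a≤B B>0 = go κ
  where
  sq : ∀ {d} → d ≤ B → 4 * (d * d) ≤ q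
  sq l = ≤-trans (*-monoʳ-≤ 4 (*-mono-≤ l l)) (≤-reflexive eq)
  d≤q : ∀ {d} → d ≤ B → d ≤ q
  d≤q {d} l = ≤-trans l (≤-trans (m≤m*n B B {{>-nonZero B>0}}) (≤-trans (m≤m+n (B * B) _) (≤-reflexive eq)))
  go : ∀ κ → q * suc q ^ a * q ^ (B * ⟦ κ ⟧) * p ≤ fac q B a κ * suc q ^ (B * ⟦ κ ⟧) * q ^ a * (4 * q)
  go false rewrite *-zeroʳ B | *-identityʳ (q * suc q ^ a) | *-identityʳ (q + a) =
      factor-up q a p (sq a≤B) (d≤q a≤B) ep
  go true rewrite *-identityʳ B = begin
    q * suc q ^ a * q ^ B * p                    ≡⟨ cong (λ z → q * suc q ^ a * z * p) (pw q) ⟩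
    q * suc q ^ a * (q ^ a * q ^ d) * p          ≡⟨ e₁ q (suc q ^ a) (q ^ a) (q ^ d) p ⟩
    suc q ^ a * q ^ a * (q * q ^ d * p)          ≤⟨
        *-monoʳ-≤ (suc q ^ a * q ^ a) (factor-down q d p (sq (m∸n≤m B a)) (d≤q (m∸n≤m B a)) ep) ⟩
    suc q ^ a * q ^ a * ((q ∸ d) * suc q ^ d * (4 * q)) ≡⟨ e₂ (suc q ^ a) (q ^ a) (q ∸ d) (suc q ^ d) (4 * q) ⟩
    (q ∸ d) * (suc q ^ a * suc q ^ d) * q ^ a * (4 * q) ≡⟨ cong₂ (λ y z → y * z * q ^ a * (4 * q)) fe
        (sym (pw (suc q))) ⟩
    (q + a ∸ B) * suc q ^ B * q ^ a * (4 * q)    ∎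
    where
    open ≤-Reasoning
    d = B ∸ a
    B≡ : a + d ≡ B
    B≡ = m+[n∸m]≡n a≤B
    pw : ∀ x → x ^ B ≡ x ^ a * x ^ d
    pw x = trans (cong (x ^_) (sym B≡)) (^-distribˡ-+-* x a d)
    fe : q ∸ d ≡ q + a ∸ B
    fe = sym (trans (cong₂ _∸_ (+-comm q a) (sym B≡)) ([m+n]∸[m+o]≡n∸o a q d))
    e₁ : ∀ q x y z p → q * x * (y * z) * p ≡ x * y * (q * z * p)
    e₁ = solve-∀
    e₂ : ∀ x y c z f → x * y * (c * z * f) ≡ c * (x * z) * y * f
    e₂ = solve-∀

-- In quotients: `1 + 1/(16 q) ≤ (1 + 1/q) (1 − 1/(4 q))²`. The gain `1/q` outweighs two losses of
-- `1/(4 q)`; the square matches the squaring in `weighted-final`.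
rate-loss : ∀ q p → 0 < q → suc p ≡ 4 * q → suc (16 * q) * (q * (4 * q * (4 * q))) ≤ suc q * (p * p) * (16 * q)
rate-loss (suc q) p _ e = subst
    (λ z → suc (16 * suc q) * (suc q * (4 * suc q * (4 * suc q))) ≤ suc (suc q) * (z * z) * (16 * suc q))
  (sym (suc-injective (trans e (e₁ q)))) (≤-trans (m≤m+n _ (16 * suc q * (7 * q * suc q + 1))) (≤-reflexive (e₂ q)))
  where
  e₁ : ∀ q → 4 * suc q ≡ suc (3 + 4 * q)
  e₁ = solve-∀
  e₂ : ∀ q → suc (16 * suc q) * (suc q * (4 * suc q * (4 * suc q))) + 16 * suc q * (7 * q * suc q + 1)
     ≡ suc (suc q) * ((3 + 4 * q) * (3 + 4 * q)) * (16 * suc q)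
  e₂ = solve-∀

-- Method of conditional expectations.  The requirement r should be hit at rate a r t / B in step t; its weight
-- is the product of the factors fac q B (a r t) κ over the steps made so far, κ telling whether the step hit r.
module Drive (B C : ℕ) (B>0 : 0 < B) where

  -- The least `q` that satisfies `4 * (d * d) ≤ q` for all `d ≤ B`.
  q = 4 * (B * B)
  Q = 16 * q
  p = 4 * q ∸ 1

  q>0 : 0 < q
  q>0 = pos* {4} (s≤s z≤n) (pos* B>0 B>0)

  suc-p : suc p ≡ 4 * q
  suc-p = m+[n∸m]≡n (pos* {4} (s≤s z≤n) q>0)

  p>0 : 0 < p
  p>0 = ≤-pred (≤-trans (s≤s (s≤s z≤n)) (≤-trans (*-monoʳ-≤ 4 q>0) (≤-reflexive (sym suc-p))))

  J₀ : ℕ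
  J₀ = proj₁ (exp-beats-quartic C Q (pos* {16} (s≤s z≤n) q>0))

  -- Says `w / q^t ≥ (1 + 1/q)^(A − B H) (1 − 1/(4 q))^t`, cross-multiplied because `A − B H` may
  -- have either sign.
  Weighted : ℕ → ℕ → ℕ → ℕ → Set
  Weighted t A H w = q ^ t * suc q ^ A * q ^ (B * H) * p ^ t ≤ w * suc q ^ (B * H) * q ^ A * (4 * q) ^ t

  weighted-step : ∀ {t A H w} a κ → a ≤ B → Weighted t A H w → Weighted (suc t) (A + a) (H + ⟦ κ ⟧) (w * fac q B a κ)
  weighted-step {t} {A} {H} {w} a κ a≤B h = begin
    q ^ suc t * suc q ^ (A + a) * q ^ (B * (H + k)) * p ^ suc t
      ≡⟨ cong₂ (λ x y → q ^ suc t * x * y * p ^ suc t) (^-distribˡ-+-* (suc q) A a) (powB q) ⟩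
    q ^ suc t * (suc q ^ A * suc q ^ a) * (q ^ (B * H) * q ^ (B * k)) * p ^ suc t
      ≡⟨ e₁ q (q ^ t) (suc q ^ A) (suc q ^ a) (q ^ (B * H)) (q ^ (B * k)) p (p ^ t) ⟩
    q ^ t * suc q ^ A * q ^ (B * H) * p ^ t * (q * suc q ^ a * q ^ (B * k) * p)
      ≤⟨ *-mono-≤ h (factor B q p a κ refl suc-p a≤B B>0) ⟩
    w * suc q ^ (B * H) * q ^ A * (4 * q) ^ t * (f * suc q ^ (B * k) * q ^ a * (4 * q))
      ≡⟨ e₂ w (suc q ^ (B * H)) (q ^ A) ((4 * q) ^ t) f (suc q ^ (B * k)) (q ^ a) (4 * q) ⟩
    w * f * (suc q ^ (B * H) * suc q ^ (B * k)) * (q ^ A * q ^ a) * (4 * q) ^ suc t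
      ≡⟨ cong₂ (λ x y → w * f * x * y * (4 * q) ^ suc t) (sym (powB (suc q))) (sym (^-distribˡ-+-* q A a)) ⟩
    w * f * suc q ^ (B * (H + k)) * q ^ (A + a) * (4 * q) ^ suc t ∎
    where
    open ≤-Reasoning
    k = ⟦ κ ⟧
    f = fac q B a κ
    powB : ∀ x → x ^ (B * (H + k)) ≡ x ^ (B * H) * x ^ (B * k)
    powB x = trans (cong (x ^_) (*-distribˡ-+ B H k)) (^-distribˡ-+-* x (B * H) (B * k))
    e₁ : ∀ q x y z u v p w → q * x * (y * z) * (u * v) * (p * w) ≡ x * y * u * w * (q * z * v * p)
    e₁ = solve-∀
    e₂ : ∀ w x y z f u v g → w * x * y * z * (f * u * v * g) ≡ w * f * (x * u) * (y * v) * (g * z)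
    e₂ = solve-∀

  weighted-pos : ∀ {t A H w} → Weighted t A H w → 0 < w
  weighted-pos {t} {A} {H} {zero} h =
      ⊥-elim (n≮0 (≤-trans (pos* (pos* (pos* (^-pos q t q>0) (^-pos (suc q) A (s≤s z≤n))) (^-pos q (B * H) q>0))
      (^-pos p t p>0)) h))
  weighted-pos {w = suc w} h = s≤s z≤n

  -- If the deficit `e = A − B * H` exceeded `J / 2`, this single weight would be too large for the
  -- total `R * q ^ J`. Squaring replaces `e` by `2 * e ≥ J` and leaves `(1 + 1/(16 q))^J ≤ R²`,
  -- against the quartic bound on `R²`.
  weighted-final : ∀ J A H w R → J₀ ≤ J → R * R ≤ C * J ^ 4 → w ≤ R * q ^ J → Weighted J A H w →
      2 * A ≤ 2 * (B * H) + J
  weighted-final J A H w R J₀≤J hR w≤ hw with 2 * A ≤? 2 * (B * H) + J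
  ... | yes l = l
  ... | no ¬l = ⊥-elim (<⇒≱ (proj₂ (exp-beats-quartic C Q (pos* {16} (s≤s z≤n) q>0)) J J₀≤J) contra)
    where
    open ≤-Reasoning
    K = B * H
    big : 2 * K + J < 2 * A
    big = ≰⇒> ¬l
    K≤A : K ≤ A
    K≤A = *-cancelˡ-≤ 2 (≤-trans (m≤m+n _ J) (<⇒≤ big))
    e = A ∸ K
    A≡ : A ≡ K + e
    A≡ = sym (m+[n∸m]≡n K≤A)
    J≤2e : J ≤ 2 * e
    J≤2e = +-cancelˡ-≤ (2 * K) _ _ (≤-trans (<⇒≤ big) (≤-reflexive (trans (cong (2 *_) A≡) (*-distribˡ-+ 2 K e))))
    x = 2 * e ∸ J
    2e≡ : e + e ≡ J + x
    2e≡ = trans (cong (e +_) (sym (+-identityʳ e))) (sym (m+[n∸m]≡n J≤2e))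
    s = suc q
    f = 4 * q
    P>0 : 0 < q ^ J * s ^ K * q ^ K
    P>0 = pos* (pos* (^-pos q J q>0) (^-pos s K (s≤s z≤n))) (^-pos q K q>0)
    c₁ : ∀ a b c d g → a * (b * d) * c * g ≡ a * b * c * (d * g)
    c₁ = solve-∀
    c₂ : ∀ r a b c d g → r * a * b * (c * d) * g ≡ a * b * c * (r * d * g)
    c₂ = solve-∀
    one : s ^ e * p ^ J ≤ R * q ^ e * f ^ J
    one = *-cancelˡ-≤ (q ^ J * s ^ K * q ^ K) {{>-nonZero P>0}} (begin
      q ^ J * s ^ K * q ^ K * (s ^ e * p ^ J)    ≡⟨ sym (c₁ (q ^ J) (s ^ K) (q ^ K) (s ^ e) (p ^ J)) ⟩
      q ^ J * (s ^ K * s ^ e) * q ^ K * p ^ J    ≡⟨ cong (λ z → q ^ J * z * q ^ K * p ^ J)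
          (trans (sym (^-distribˡ-+-* s K e)) (cong (s ^_) (sym A≡))) ⟩
      q ^ J * s ^ A * q ^ K * p ^ J              ≤⟨ hw ⟩
      w * s ^ K * q ^ A * f ^ J                  ≤⟨ *-monoˡ-≤ (f ^ J) (*-monoˡ-≤ (q ^ A) (*-monoˡ-≤ (s ^ K) w≤)) ⟩
      R * q ^ J * s ^ K * q ^ A * f ^ J          ≡⟨ cong (λ z → R * q ^ J * s ^ K * z * f ^ J)
          (trans (cong (q ^_) A≡) (^-distribˡ-+-* q K e)) ⟩
      R * q ^ J * s ^ K * (q ^ K * q ^ e) * f ^ J ≡⟨ c₂ R (q ^ J) (s ^ K) (q ^ K) (q ^ e) (f ^ J) ⟩
      q ^ J * s ^ K * q ^ K * (R * q ^ e * f ^ J) ∎)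
    c₃ : ∀ a b → a * b * (a * b) ≡ a * a * (b * b)
    c₃ = solve-∀
    c₄ : ∀ a b c → a * b * c * (a * b * c) ≡ a * a * (b * b) * (c * c)
    c₄ = solve-∀
    sq : ∀ y → y ^ e * y ^ e ≡ y ^ J * y ^ x
    sq y = trans (sym (^-distribˡ-+-* y e e)) (trans (cong (y ^_) 2e≡) (^-distribˡ-+-* y J x))
    c₅ : ∀ a b c → a * b * c ≡ b * (a * c)
    c₅ = solve-∀
    c₆ : ∀ r a b c → r * (a * b) * c ≡ b * (r * a * c)
    c₆ = solve-∀
    two : s ^ J * (p ^ J * p ^ J) ≤ R * R * q ^ J * (f ^ J * f ^ J)
    two = *-cancelˡ-≤ (q ^ x) {{>-nonZero (^-pos q x q>0)}} (begin
      q ^ x * (s ^ J * (p ^ J * p ^ J))               ≤⟨ *-monoˡ-≤ _ (^-monoˡ-≤ x (n≤1+n q)) ⟩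
      s ^ x * (s ^ J * (p ^ J * p ^ J))               ≡⟨ sym (c₅ (s ^ J) (s ^ x) (p ^ J * p ^ J)) ⟩
      s ^ J * s ^ x * (p ^ J * p ^ J)                 ≡⟨ cong (_* (p ^ J * p ^ J)) (sym (sq s)) ⟩
      s ^ e * s ^ e * (p ^ J * p ^ J)                 ≡⟨ sym (c₃ (s ^ e) (p ^ J)) ⟩
      s ^ e * p ^ J * (s ^ e * p ^ J)                 ≤⟨ *-mono-≤ one one ⟩
      R * q ^ e * f ^ J * (R * q ^ e * f ^ J)         ≡⟨ c₄ R (q ^ e) (f ^ J) ⟩
      R * R * (q ^ e * q ^ e) * (f ^ J * f ^ J)       ≡⟨ cong (λ z → R * R * z * (f ^ J * f ^ J)) (sq q) ⟩
      R * R * (q ^ J * q ^ x) * (f ^ J * f ^ J)       ≡⟨ c₆ (R * R) (q ^ J) (q ^ x) (f ^ J * f ^ J) ⟩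
      q ^ x * (R * R * q ^ J * (f ^ J * f ^ J))       ∎)
    dist3 : ∀ a b c → (a * (b * c)) ^ J ≡ a ^ J * (b ^ J * c ^ J)
    dist3 a b c = trans (^-distribʳ J a (b * c)) (cong (a ^ J *_) (^-distribʳ J b c))
    c₇ : ∀ r a b c → r * a * b * c ≡ a * b * (r * c)
    c₇ = solve-∀
    contra : suc Q ^ J ≤ C * J ^ 4 * Q ^ J
    contra = ≤-trans (*-cancelˡ-≤ (q ^ J * (f ^ J * f ^ J))
        {{>-nonZero (pos* (^-pos q J q>0) (pos* (^-pos f J f>0) (^-pos f J f>0)))}} (begin
      q ^ J * (f ^ J * f ^ J) * suc Q ^ J             ≡⟨ *-comm _ (suc Q ^ J) ⟩
      suc Q ^ J * (q ^ J * (f ^ J * f ^ J))           ≡⟨ cong (suc Q ^ J *_) (sym (dist3 q f f)) ⟩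
      suc Q ^ J * (q * (f * f)) ^ J                   ≡⟨ sym (^-distribʳ J (suc Q) (q * (f * f))) ⟩
      (suc Q * (q * (f * f))) ^ J                     ≤⟨ ^-monoˡ-≤ J (rate-loss q p q>0 suc-p) ⟩
      (s * (p * p) * Q) ^ J                           ≡⟨ ^-distribʳ J (s * (p * p)) Q ⟩
      (s * (p * p)) ^ J * Q ^ J                       ≡⟨ cong (_* Q ^ J) (dist3 s p p) ⟩
      s ^ J * (p ^ J * p ^ J) * Q ^ J                 ≤⟨ *-monoˡ-≤ (Q ^ J) two ⟩
      R * R * q ^ J * (f ^ J * f ^ J) * Q ^ J         ≡⟨ c₇ (R * R) (q ^ J) (f ^ J * f ^ J) (Q ^ J) ⟩
      q ^ J * (f ^ J * f ^ J) * (R * R * Q ^ J)       ∎)) (*-monoˡ-≤ (Q ^ J) hR)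
      where
      f>0 : 0 < f
      f>0 = pos* {4} (s≤s z≤n) q>0

  -- The total weight starts at `R` and grows by at most the factor `q` per step, so no single
  -- weight ever exceeds `R * q ^ J`. The positivity of weights handed to `next` lets a step deduce
  -- from a positive remaining weight that its choices are admissible.
  drive : ∀ {Req State : Set} (J : ℕ) → J₀ ≤ J → (reqs : List Req) → length reqs * length reqs ≤ C * J ^ 4 →
    (a : Req → ℕ → ℕ) → (∀ r t → a r t ≤ B) →
    (Inv : ℕ → State → Set) (hit : ℕ → State → Req → ℕ) (s₀ : State) → Inv 0 s₀ → (∀ r → hit 0 s₀ r ≡ 0) →
    (∀ t s → t < J → Inv t s → (w : Req → ℕ) → (∀ r → 0 < w r) →
      Σ State λ s′ → Inv (suc t) s′ × Σ (Req → Bool) λ κ →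
        (∀ r → hit (suc t) s′ r ≡ hit t s r + ⟦ κ r ⟧) ×
        ∑ᴸ reqs (λ r → w r * fac q B (a r t) (κ r)) ≤ q * ∑ᴸ reqs w) →
    Σ State λ s → Inv J s × (∀ r → r ∈ reqs → 2 * ∑ J (a r) ≤ 2 * (B * hit J s r) + J)
  drive {Req} {State} J J₀≤J reqs hR a a≤B Inv hit s₀ inv₀ hit₀ next = finish (run J ≤-refl)
    where
    R = length reqs
    Run : ℕ → Set
    Run t = Σ State λ s → Inv t s × Σ (Req → ℕ) λ w → (∀ r → Weighted t (∑ t (a r)) (hit t s r) (w r)) × ∑ᴸ reqs
        w ≤ R * q ^ t
    run : ∀ t → t ≤ J → Run t
    run zero _ = s₀ , inv₀ , (λ _ → 1) ,
      (λ r → subst (λ z → Weighted 0 0 z 1) (sym (hit₀ r))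
               (subst (λ z → 1 * 1 * q ^ z * 1 ≤ 1 * suc q ^ z * 1 * 1) (sym (*-zeroʳ B)) ≤-refl)) ,
      ≤-reflexive (trans (∑ᴸ-one reqs) (sym (*-identityʳ R)))
    run (suc t) t<J with run t (<⇒≤ t<J)
    ... | s , inv , w , hw , tot with next t s t<J inv w (λ r → weighted-pos {t} {∑ t (a r)} {hit t s r} {w r} (hw r))
    ... | s′ , inv′ , κ , hit′ , tot′ = s′ , inv′ , (λ r → w r * fac q B (a r t) (κ r)) ,
      (λ r → subst (λ z → Weighted (suc t) (∑ (suc t) (a r)) z (w r * fac q B (a r t) (κ r))) (sym (hit′ r))
               (weighted-step {t} {∑ t (a r)} {hit t s r} {w r} (a r t) (κ r) (a≤B r t) (hw r))) ,
      ≤-trans tot′ (≤-trans (*-monoʳ-≤ q tot) (≤-reflexive (lem q R (q ^ t))))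
      where
      lem : ∀ q r x → q * (r * x) ≡ r * (q * x)
      lem = solve-∀
    finish : Run J → Σ State λ s → Inv J s × (∀ r → r ∈ reqs → 2 * ∑ J (a r) ≤ 2 * (B * hit J s r) + J)
    finish (s , inv , w , hw , tot) = s , inv , λ r i →
      weighted-final J (∑ J (a r)) (hit J s r) (w r) R J₀≤J hR (≤-trans (∑ᴸ-pick w i) tot) (hw r)

-- Cyclic shifts of blocks and equipartitions.

upd : ∀ {A : Set} → (ℕ → A) → ℕ → A → ℕ → A
upd f t v i = if eqb t i then v else f i

upd-same : ∀ {A : Set} (f : ℕ → A) t v → upd f t v t ≡ v
upd-same f t v rewrite eqb-refl t = refl

upd-other : ∀ {A : Set} (f : ℕ → A) {t} v {i} → t ≢ i → upd f t v i ≡ f i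
upd-other f v h rewrite eqb-≢ h = refl

upd-below : ∀ {A : Set} (f : ℕ → A) {t} v {i} → i < t → upd f t v i ≡ f i
upd-below f v l = upd-other f v (≢-sym (<⇒≢ l))

length-cartesianProduct : ∀ {A B : Set} (xs : List A) (ys : List B) → length (cartesianProduct xs ys) ≡ length
    xs * length ys
length-cartesianProduct [] ys = refl
length-cartesianProduct (x ∷ xs) ys = trans (List.length-++ (map (x ,_) ys))
  (cong₂ _+_ (List.length-map (x ,_) ys) (length-cartesianProduct xs ys))

∑-front : ∀ n f → ∑ (suc n) f ≡ f 0 + ∑ n (f ∘ suc)
∑-front n f = ∑-split 1 n f

∑-block : ∀ N M f → ∑ (N * M) f ≡ ∑ N (λ b → ∑ M (λ x → f (b * M + x)))
∑-block zero M f = refl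
∑-block (suc N) M f = begin
  ∑ (M + N * M) f       ≡⟨ cong (λ z → ∑ z f) (+-comm M (N * M)) ⟩
  ∑ (N * M + M) f       ≡⟨ ∑-split (N * M) M f ⟩
  ∑ (N * M) f + ∑ M (λ x → f (N * M + x)) ≡⟨ cong (_+ ∑ M (λ x → f (N * M + x))) (∑-block N M f) ⟩
  ∑ N (λ b → ∑ M (λ x → f (b * M + x))) + ∑ M (λ x → f (N * M + x)) ∎
  where open ≡-Reasoning

div-unique : ∀ M i i′ x x′ → x < M → x′ < M → i * M + x ≡ i′ * M + x′ → (i ≡ i′) × (x ≡ x′)
div-unique M zero zero x x′ l l′ e = refl , e
div-unique M zero (suc i′) x x′ l l′ e =
    ⊥-elim (<⇒≱ l (≤-trans (m≤m+n M _) (≤-reflexive (trans (sym (+-assoc M (i′ * M) x′)) (sym e)))))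
div-unique M (suc i) zero x x′ l l′ e =
    ⊥-elim (<⇒≱ l′ (≤-trans (m≤m+n M _) (≤-reflexive (trans (sym (+-assoc M (i * M) x)) e))))
div-unique M (suc i) (suc i′) x x′ l l′ e
  with div-unique M i i′ x x′ l l′
      (+-cancelˡ-≡ M _ _ (trans (sym (+-assoc M (i * M) x)) (trans e (+-assoc M (i′ * M) x′))))
... | p , q = cong suc p , q

div-bound : ∀ {N M i x} → i < N → x < M → i * M + x < N * M
div-bound {N} {M} {i} {x} l m =
    ≤-trans (+-monoʳ-< (i * M) m) (≤-trans (≤-reflexive (+-comm (i * M) M)) (*-monoˡ-≤ M l))

module _ (m : ℕ) where
  private M = suc m

  ∑-cycle : ∀ (g : ℕ → ℕ) j → ∑ M (λ v → g ((j + v) % M)) ≡ ∑ M g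
  ∑-cycle g zero = ∑-cong M (λ v l → cong g (m<n⇒m%n≡m l))
  ∑-cycle g (suc j) = +-cancelˡ-≡ (h j) _ _ (begin
    h j + ∑ M (λ v → h (suc (j + v)))            ≡⟨ cong₂ _+_ (cong h (sym (+-identityʳ j)))
        (∑-cong M (λ v _ → cong h (sym (+-suc j v)))) ⟩
    h (j + 0) + ∑ M (λ v → h (j + suc v))        ≡⟨ sym (∑-front M (λ v → h (j + v))) ⟩
    ∑ M (λ v → h (j + v)) + h (j + M)            ≡⟨ cong₂ _+_ (∑-cycle g j) (cong g ([m+n]%n≡m%n j M)) ⟩
    ∑ M g + h j                                  ≡⟨ +-comm _ (h j) ⟩
    h j + ∑ M g                                  ∎)
    where
    open ≡-Reasoning
    h : ℕ → ℕ
    h i = g (i % M)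

  %-cancel : ∀ o {j j′} → j < M → j′ < M → (j + o) % M ≡ (j′ + o) % M → j ≡ j′
  %-cancel o {j} {j′} l l′ e = trans (sym (back j l)) (trans (cong (λ z → (z + c % M) % M) e) (back j′ l′))
    where
    -- `o + m * o` is a multiple of `suc m`, so adding `c` undoes the shift by `o`.
    c = m * o
    lem : ∀ j m o → j + o + m * o ≡ j + o * suc m
    lem = solve-∀
    back : ∀ j → j < M → ((j + o) % M + c % M) % M ≡ j
    back j l = trans (sym (%-distribˡ-+ (j + o) c M))
        (trans (cong (_% M) (lem j m o)) (trans ([m+kn]%n≡m%n j o M) (m<n⇒m%n≡m l)))

fac-def : ∀ q M a b → M ≤ q → fac q M a b + M * ⟦ b ⟧ ≡ q + a
fac-def q M a false _ = trans (cong (q + a +_) (*-zeroʳ M)) (+-identityʳ _)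
fac-def q M a true M≤q = trans (cong (q + a ∸ M +_) (*-identityʳ M)) (m∸n+n≡m (≤-trans M≤q (m≤m+n q a)))

-- A uniform shift hits with frequency exactly `# M κ / M`, the rate for which `fac` has mean `q`.
fac-sum : ∀ q M (κ : ℕ → Bool) → M ≤ q → ∑ M (λ v → fac q M (# M κ) (κ v)) ≡ M * q
fac-sum q M κ M≤q = +-cancelʳ-≡ (M * a) _ _ (begin
  ∑ M (λ v → fac q M a (κ v)) + M * a                     ≡⟨ cong (∑ M (λ v → fac q M a (κ v)) +_)
      (sym (∑-* M M (λ v → ⟦ κ v ⟧))) ⟩
  ∑ M (λ v → fac q M a (κ v)) + ∑ M (λ v → M * ⟦ κ v ⟧)   ≡⟨ sym (∑-+ M _ _) ⟩
  ∑ M (λ v → fac q M a (κ v) + M * ⟦ κ v ⟧)               ≡⟨ ∑-cong M (λ v _ → fac-def q M a (κ v) M≤q) ⟩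
  ∑ M (λ _ → q + a)                                       ≡⟨ ∑-const M (q + a) ⟩
  M * (q + a)                                             ≡⟨ *-distribˡ-+ M q a ⟩
  M * q + M * a                                           ∎)
  where
  open ≡-Reasoning
  a = # M κ

-- `fair` bounds every trace of `X` from below. Read the other way it bounds the size of `X` by any
-- one trace; this is how a vertex with few neighbours in one part is seen to have many
-- non-neighbours overall.
record Equipartition (M N : ℕ) (fam : List (ℕ → Bool)) : Set where
  field
    V : ℕ → ℕ → ℕ
    V-bound : ∀ {j i} → j < M → i < N → V j i < N * M
    V-inj : ∀ {j i j′ i′} → j < M → i < N → j′ < M → i′ < N → V j i ≡ V j′ i′ → (j ≡ j′) × (i ≡ i′)
    fair : ∀ X → X ∈ fam → ∀ j → j < M → 2 * # (N * M) X ≤ 2 * (M * # N (λ i → X (V j i))) + N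

-- The vertices are cut into N blocks of M consecutive ones; each block is shifted cyclically and its
-- j-th vertex goes to part j.
equipartition : ∀ M → 0 < M → ∀ C → Σ ℕ λ N₀ → ∀ N → N₀ ≤ N → (fam : List (ℕ → Bool)) →
  length fam * M * (length fam * M) ≤ C * N ^ 4 → Equipartition M N fam
equipartition (suc m) _ C = J₀ , main
  where
  M = suc m
  open Drive M C (s≤s z≤n)
  M≤q : M ≤ q
  M≤q = ≤-trans (m≤m*n M M) (m≤m+n (M * M) _)
  main : ∀ N → J₀ ≤ N → (fam : List (ℕ → Bool)) → length fam * M * (length fam * M) ≤ C * N ^ 4 →
      Equipartition M N fam
  main N J₀≤N fam small = record { V = V o ; V-bound = λ {j} {i} j< i< →
      div-bound i< (m%n<n (j + o i) M) ; V-inj = inj ; fair = fair }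
    where
    Req = (ℕ → Bool) × ℕ
    V : (ℕ → ℕ) → ℕ → ℕ → ℕ
    V o j i = i * M + (j + o i) % M
    reqs : List Req
    reqs = cartesianProduct fam (upTo M)
    len : length reqs ≡ length fam * M
    len = trans (length-cartesianProduct fam (upTo M)) (cong (length fam *_) (List.length-upTo M))
    rate-of : Req → ℕ → ℕ
    rate-of (X , j) b = # M (λ x → X (b * M + x))
    hit : ℕ → (ℕ → ℕ) → Req → ℕ
    hit t o (X , j) = # t (λ b → X (V o j b))
    next : ∀ t (o : ℕ → ℕ) → t < N → ℕ → (w : Req → ℕ) → (∀ r → 0 < w r) → Σ (ℕ → ℕ) λ o′ → ℕ × Σ (Req → Bool) λ κ →
      (∀ r → hit (suc t) o′ r ≡ hit t o r + ⟦ κ r ⟧) × ∑ᴸ reqs (λ r → w r * fac q M (rate-of r t) (κ r)) ≤ q *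
          ∑ᴸ reqs w
    next t o _ z w _ = upd o t v , z , κ v , hits , *-cancelˡ-≤ M (≤-trans (proj₂ (proj₂ best)) (≤-reflexive total))
      where
      κ : ℕ → Req → Bool
      κ v (X , j) = X (t * M + (j + v) % M)
      F : ℕ → ℕ
      F v = ∑ᴸ reqs (λ r → w r * fac q M (rate-of r t) (κ v r))
      best = avg-≤ M F (s≤s z≤n)
      v = proj₁ best
      col : ∀ r → ∑ M (λ v → w r * fac q M (rate-of r t) (κ v r)) ≡ M * q * w r
      col r@(X , j) = begin
        ∑ M (λ v → w r * fac q M (rate-of r t) (κ v r))  ≡⟨ ∑-* M (w r) _ ⟩
        w r * ∑ M (λ v → fac q M (rate-of r t) (κ v r))  ≡⟨
            cong (w r *_) (∑-cycle m (λ x → fac q M (rate-of r t) (X (t * M + x))) j) ⟩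
        w r * ∑ M (λ x → fac q M (rate-of r t) (X (t * M + x))) ≡⟨
            cong (w r *_) (fac-sum q M (λ x → X (t * M + x)) M≤q) ⟩
        w r * (M * q)                                    ≡⟨ *-comm (w r) _ ⟩
        M * q * w r                                      ∎
        where open ≡-Reasoning
      total : ∑ M F ≡ M * (q * ∑ᴸ reqs w)
      total = trans (∑ᴸ-∑-swap reqs M _) (trans (∑ᴸ-cong reqs col) (trans (∑ᴸ-* reqs (M * q) w) (*-assoc M q _)))
      hits : ∀ r → hit (suc t) (upd o t v) r ≡ hit t o r + ⟦ κ v r ⟧
      hits (X , j) = cong₂ _+_
        (#-cong t (λ b l → cong (λ z → X (b * M + (j + z) % M)) (upd-below o v l)))
        (cong (λ z → ⟦ X (t * M + (j + z) % M) ⟧) (upd-same o t v))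
    done = drive N J₀≤N reqs (subst (λ z → z * z ≤ C * N ^ 4) (sym len) small) rate-of
      (λ r t → #-≤ M _) (λ _ _ → ℕ) hit (λ _ → 0) 0 (λ r → refl) next
    o = proj₁ done
    inj : ∀ {j i j′ i′} → j < M → i < N → j′ < M → i′ < N → V o j i ≡ V o j′ i′ → (j ≡ j′) × (i ≡ i′)
    inj {j} {i} {j′} {i′} jl il jl′ il′ e with div-unique M i i′ _ _ (m%n<n (j + o i) M) (m%n<n (j′ + o i′) M) e
    ... | refl , e′ = %-cancel m (o i) jl jl′ e′ , refl
    fair : ∀ X → X ∈ fam → ∀ j → j < M → 2 * # (N * M) X ≤ 2 * (M * # N (λ i → X (V o j i))) + N
    fair X X∈ j jl = ≤-trans (≤-reflexive (cong (2 *_) (∑-block N M (λ x → ⟦ X x ⟧))))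
      (proj₂ (proj₂ done) (X , j) (∈-cartesianProduct⁺ X∈ (∈-upTo⁺ jl)))

-- Consequences of non-extremality, globally and inside the parts.

-- 1/g and 1/(64 g) play the roles of γ and ν.
record Dense (n g : ℕ) : Set where
  field
    E : ℕ → ℕ → Bool
    E-sym : ∀ u v → E u v ≡ E v u
    E-irrefl : ∀ v → E v v ≡ false
    degree : ∀ v → v < n → 64 * g * n ≤ 2 * (64 * g) * # n (E v) + 2 * n
    nonextremal : ∀ a b → # n a ≡ n / 2 → # n b ≡ n / 2 →
      n * n ≤ g * ∑ n (λ x → # n (λ y → a x ∧ (b y ∧ E x y)))

-- Non-extremality speaks of sets of size exactly `n / 2`. Other sets are brought to that size, with
-- no new elements unless they are too small.
resize : ∀ n (a : ℕ → Bool) h → h ≤ n → Σ (ℕ → Bool) λ a′ → # n a′ ≡ h × # n (λ x → a′ x ∧ not (a x)) ≤ h ∸ # n a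
resize n a zero _ = (λ _ → false) , ∑-0 n , ≤-trans (≤-reflexive (∑-0 n)) z≤n
resize (suc n) a (suc h) (s≤s h≤n) with bool-cases (a n)
... | inj₁ an with resize n a h h≤n
... | a′ , e , d = upd a′ n true ,
  trans (cong₂ _+_ (trans (#-cong n (λ i l → upd-below a′ true l)) e) (cong ⟦_⟧ (upd-same a′ n true))) (+-comm h 1) ,
  (begin
    # n (λ x → upd a′ n true x ∧ not (a x)) + ⟦ upd a′ n true n ∧ not (a n) ⟧
      ≡⟨ cong₂ _+_ (#-cong n (λ i l → cong (_∧ not (a i)) (upd-below a′ true l)))
          (cong ⟦_⟧ (cong₂ _∧_ (upd-same a′ n true) (cong not an))) ⟩
    # n (λ x → a′ x ∧ not (a x)) + 0  ≡⟨ +-identityʳ _ ⟩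
    # n (λ x → a′ x ∧ not (a x))      ≤⟨ d ⟩
    h ∸ # n a                         ≡⟨ cong (suc h ∸_) (trans (+-comm 1 _) (cong (λ z → # n a + ⟦ z ⟧) (sym an))) ⟩
    suc h ∸ (# n a + ⟦ a n ⟧)         ∎)
  where open ≤-Reasoning
resize (suc n) a (suc h) (s≤s h≤n) | inj₂ an with m≤n⇒m<n∨m≡n h≤n
... | inj₂ refl = (λ _ → true) , #-all (suc n) (λ _ _ → refl) ,
    ≤-reflexive (sym (trans (cong (_∸ # (suc n) a) (sym (#-not (suc n) a))) (m+n∸m≡n (# (suc n) a) _)))
... | inj₁ h<n with resize n a (suc h) h<n
... | a′ , e , d = upd a′ n false ,
  trans (cong₂ _+_ (trans (#-cong n (λ i l → upd-below a′ false l)) e) (cong ⟦_⟧ (upd-same a′ n false)))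
      (+-identityʳ _) ,
  (begin
    # n (λ x → upd a′ n false x ∧ not (a x)) + ⟦ upd a′ n false n ∧ not (a n) ⟧
      ≡⟨ cong₂ _+_ (#-cong n (λ i l → cong (_∧ not (a i)) (upd-below a′ false l)))
          (cong (λ z → ⟦ z ∧ not (a n) ⟧) (upd-same a′ n false)) ⟩
    # n (λ x → a′ x ∧ not (a x)) + 0  ≡⟨ +-identityʳ _ ⟩
    # n (λ x → a′ x ∧ not (a x))      ≤⟨ d ⟩
    suc h ∸ # n a                     ≡⟨
        cong (suc h ∸_) (sym (trans (cong (λ z → # n a + ⟦ z ⟧) an) (+-identityʳ _))) ⟩
    suc h ∸ (# n a + ⟦ a n ⟧)         ∎)
  where open ≤-Reasoning

-- The constants record successive losses: a density `1/(4 g)` becomes `1/(8 g)` in a part, the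
-- degree slack `2 * n` becomes `4 * N`, and `crossing` tolerates `6 * N` so that a small set of
-- frozen positions may be removed beforehand.
record Host (n g M N : ℕ) (E : ℕ → ℕ → Bool) : Set where
  field
    V : ℕ → ℕ → ℕ
    V-bound : ∀ {j i} → j < M → i < N → V j i < n
    V-inj : ∀ {j i j′ i′} → j < M → i < N → j′ < M → i′ < N → V j i ≡ V j′ i′ → (j ≡ j′) × (i ≡ i′)
    rich : ℕ → ℕ → Bool
    many-rich : ∀ {u v j} → u < n → v < n → j < M → N ≤ 8 * g * # N (λ i → E u (V j i) ∧ rich v (V j i))
    rich-codegree : ∀ {v x j} → v < n → x < n → rich v x ≡ true → j < M →
        N ≤ 8 * g * # N (λ i → E v (V j i) ∧ E x (V j i))
    part-degree : ∀ {v j} → v < n → j < M → 64 * g * N ≤ 2 * (64 * g) * # N (λ i → E v (V j i)) + 4 * N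
    crossing : ∀ {j k} → j < M → k < M → ∀ S R →
      64 * g * N ≤ 2 * (64 * g) * # N S + 6 * N → 64 * g * N ≤ 2 * (64 * g) * # N R + 6 * N →
      Σ ℕ λ s → Σ ℕ λ r → s < N × r < N × S s ≡ true × R r ≡ true × E (V j s) (V k r) ≡ true

module _ {n g : ℕ} (g>0 : 0 < g) (n>0 : 0 < n) (G : Dense n g) where
  open Dense G
  private
    w = 64 * g
    w>0 : 0 < w
    w>0 = pos* {64} (s≤s z≤n) g>0

  -- Resizing adds at most `t n / (64 g)` elements to each set, and an element lies in at most `n`
  -- pairs. For `t ≤ 16` this accounts for at most half of the `n² / g` adjacent pairs.
  large-pair : ∀ t → t ≤ 16 → ∀ (a b : ℕ → Bool) → w * n ≤ 2 * w * # n a + 2 * t * n →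
      w * n ≤ 2 * w * # n b + 2 * t * n →
    n * n ≤ 2 * g * ∑ n (λ x → # n (λ y → a x ∧ (b y ∧ E x y)))
  large-pair t t≤16 a b ha hb = *-cancelˡ-≤ w {{>-nonZero w>0}} final
    where
    h = n / 2
    h≤n : h ≤ n
    h≤n = ≤-trans (m≤m*n h 2) (m/n*n≤m n 2)
    missing : ∀ c d → d ≤ h ∸ c → w * n ≤ 2 * w * c + 2 * t * n → w * d ≤ t * n
    missing c zero _ _ = ≤-trans (≤-reflexive (*-zeroʳ w)) z≤n
    missing c d@(suc _) d≤ hc = linear 2 0
        (+-mono-≤ (+-mono-≤ hc (*-monoʳ-≤ (2 * w) sum≤)) (*-monoʳ-≤ w (m/n*n≤m n 2))) (e₁ w t c d n h)
      where
      c≤h : c ≤ h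
      c≤h with c ≤? h
      ... | yes l = l
      ... | no ¬l = ⊥-elim (n≮0 (≤-trans d≤ (≤-reflexive (m≤n⇒m∸n≡0 (<⇒≤ (≰⇒> ¬l))))))
      sum≤ : c + d ≤ h
      sum≤ = ≤-trans (+-monoʳ-≤ c d≤) (≤-reflexive (m+[n∸m]≡n c≤h))
      e₁ : ∀ w t c d n h → 2 * (w * d) + (2 * w * c + 2 * t * n + 2 * w * h + w * n) + 0
         ≡ 2 * (t * n) + (w * n + 2 * w * (c + d) + w * (h * 2))
      e₁ = solve-∀
    a⁺ = resize n a h h≤n
    b⁺ = resize n b h h≤n
    a′ = proj₁ a⁺
    b′ = proj₁ b⁺
    W = ∑ n (λ x → # n (λ y → a x ∧ (b y ∧ E x y)))
    W′ = ∑ n (λ x → # n (λ y → a′ x ∧ (b′ y ∧ E x y)))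
    da = # n (λ x → a′ x ∧ not (a x))
    db = # n (λ x → b′ x ∧ not (b x))
    point : ∀ p p′ q q′ e → ⟦ p′ ∧ (q′ ∧ e) ⟧ ≤ ⟦ p ∧ (q ∧ e) ⟧ + (⟦ p′ ∧ not p ⟧ + ⟦ q′ ∧ not q ⟧)
    point p false q q′ e = z≤n
    point p true q false e = z≤n
    point p true q true false = z≤n
    point false true q true true = m≤m+n 1 _
    point true true false true true = ≤-refl
    point true true true true true = ≤-refl
    rowsum : ∀ x → ∑ n (λ y → ⟦ a x ∧ (b y ∧ E x y) ⟧ + (⟦ a′ x ∧ not (a x) ⟧ + ⟦ b′ y ∧ not (b y) ⟧))
      ≡ # n (λ y → a x ∧ (b y ∧ E x y)) + (n * ⟦ a′ x ∧ not (a x) ⟧ + db)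
    rowsum x = trans (∑-+ n _ _) (cong (λ z → # n (λ y → a x ∧ (b y ∧ E x y)) + z)
        (trans (∑-+ n _ _) (cong (_+ db) (∑-const n _))))
    W′≤ : W′ ≤ W + (n * da + n * db)
    W′≤ = ≤-trans (∑-mono n (λ x _ → ≤-trans (∑-mono n (λ y _ → point (a x) (a′ x) (b y) (b′ y) (E x y)))
        (≤-reflexive (rowsum x))))
      (≤-reflexive (trans (∑-+ n _ _) (cong (W +_) (trans (∑-+ n _ _) (cong₂ _+_ (∑-* n n _) (∑-const n db))))))
    e₂ : ∀ w g W n x y → 2 * w * (g * (W + (n * x + n * y))) ≡ 2 * w * g * W + 2 * g * n * (w * x + w * y)
    e₂ = solve-∀
    e₃ : ∀ w g W n t → 2 * w * g * W + 2 * g * n * (t * n + t * n) ≡ 2 * w * g * W + 4 * g * t * (n * n)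
    e₃ = solve-∀
    e₄ : ∀ w g W m → 1 * (w * m) + (2 * w * g * W + w * m) + 0 ≡ 1 * (w * (2 * g * W)) + 2 * w * m
    e₄ = solve-∀
    e₅ : ∀ g → 4 * g * 16 ≡ 64 * g
    e₅ = solve-∀
    final : w * (n * n) ≤ w * (2 * g * W)
    final = linear 1 0 (begin
      2 * w * (n * n)                                     ≤⟨
          *-monoʳ-≤ (2 * w) (nonextremal a′ b′ (proj₁ (proj₂ a⁺)) (proj₁ (proj₂ b⁺))) ⟩
      2 * w * (g * W′)                                    ≤⟨ *-monoʳ-≤ (2 * w) (*-monoʳ-≤ g W′≤) ⟩
      2 * w * (g * (W + (n * da + n * db)))               ≡⟨ e₂ w g W n da db ⟩
      2 * w * g * W + 2 * g * n * (w * da + w * db)       ≤⟨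
          +-monoʳ-≤ (2 * w * g * W) (*-monoʳ-≤ (2 * g * n) (+-mono-≤
                                                               (missing (# n a) da (proj₂ (proj₂ a⁺)) ha)
                                                                   (missing (# n b) db (proj₂ (proj₂ b⁺)) hb))) ⟩
      2 * w * g * W + 2 * g * n * (t * n + t * n)         ≡⟨ e₃ w g W n t ⟩
      2 * w * g * W + 4 * g * t * (n * n)                 ≤⟨
          +-monoʳ-≤ (2 * w * g * W) (*-monoˡ-≤ (n * n) (≤-trans (*-monoʳ-≤ (4 * g) t≤16) (≤-reflexive (e₅ g)))) ⟩
      2 * w * g * W + w * (n * n)                         ∎) (e₄ w g W (n * n))
      where open ≤-Reasoning

  richᵇ : (ℕ → Bool) → ℕ → Bool
  richᵇ b x = leb n (4 * g * # n (λ y → b y ∧ E x y))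

  -- The vertices that are not rich contribute less than `n / (4 g)` each, so at most half of the
  -- sum; each rich vertex of `a` contributes at most `n`.
  many-richᵇ : ∀ (a b : ℕ → Bool) → n * n ≤ 2 * g * ∑ n (λ x → # n (λ y → a x ∧ (b y ∧ E x y))) →
    n ≤ 4 * g * # n (λ x → a x ∧ richᵇ b x)
  many-richᵇ a b h = *-cancelʳ-≤ _ _ n {{>-nonZero n>0}} (linear 1 0 (begin
    2 * (n * n)                                                           ≤⟨ *-monoʳ-≤ 2 h ⟩
    2 * (2 * g * ∑ n (λ x → # n (λ y → a x ∧ (b y ∧ E x y))))             ≡⟨ e₁ g _ ⟩
    4 * g * ∑ n (λ x → # n (λ y → a x ∧ (b y ∧ E x y)))                   ≡⟨ sym (∑-* n (4 * g) _) ⟩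
    ∑ n (λ x → 4 * g * # n (λ y → a x ∧ (b y ∧ E x y)))                   ≤⟨ ∑-mono n (λ x _ → row x) ⟩
    ∑ n (λ x → 4 * g * n * ⟦ a x ∧ richᵇ b x ⟧ + n)                       ≡⟨
        trans (∑-+ n _ _) (cong₂ _+_ (∑-* n (4 * g * n) _) (∑-const n n)) ⟩
    4 * g * n * # n (λ x → a x ∧ richᵇ b x) + n * n                       ∎) (e₂ n g _))
    where
    open ≤-Reasoning
    e₁ : ∀ g W → 2 * (2 * g * W) ≡ 4 * g * W
    e₁ = solve-∀
    e₂ : ∀ n g X → 1 * (n * n) + (4 * g * n * X + n * n) + 0 ≡ 1 * (4 * g * X * n) + 2 * (n * n)
    e₂ = solve-∀
    row : ∀ x → 4 * g * # n (λ y → a x ∧ (b y ∧ E x y)) ≤ 4 * g * n * ⟦ a x ∧ richᵇ b x ⟧ + n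
    row x with bool-cases (a x)
    ... | inj₂ e rewrite e = ≤-trans (≤-reflexive (trans (cong (4 * g *_) (∑-0 n)) (*-zeroʳ (4 * g)))) z≤n
    ... | inj₁ e rewrite e with bool-cases (richᵇ b x)
    ... | inj₁ r rewrite r = ≤-trans (*-monoʳ-≤ (4 * g) (#-≤ n _))
        (≤-trans (≤-reflexive (sym (*-identityʳ _))) (m≤m+n _ n))
    ... | inj₂ r with n ≤? 4 * g * # n (λ y → b y ∧ E x y)
    ... | yes l = true≢false (≤-leb l) r
    ... | no l = ≤-trans (<⇒≤ (≰⇒> l)) (m≤n+m n _)

#-∧-compl : ∀ n (p q : ℕ → Bool) {r : ℕ → Bool} → (∀ i → i < n → q i ≡ true → r i ≡ true) →
    (∀ i → i < n → p i ≡ true → r i ≡ true) →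
  # n (λ i → p i ∧ not (q i)) + # n q ≤ # n r
#-∧-compl n p q {r} hq hp = ≤-trans (≤-reflexive (sym (∑-+ n _ _))) (∑-mono n row)
  where
  row : ∀ i → i < n → ⟦ p i ∧ not (q i) ⟧ + ⟦ q i ⟧ ≤ ⟦ r i ⟧
  row i l with bool-cases (q i)
  ... | inj₁ e rewrite e | hq i l e with p i
  ... | true = ≤-refl
  ... | false = ≤-refl
  row i l | inj₂ e rewrite e with bool-cases (p i)
  ... | inj₁ e′ rewrite e′ | hp i l e′ = ≤-refl
  ... | inj₂ e′ rewrite e′ = z≤n

module _ {n g : ℕ} (g>0 : 0 < g) (n>0 : 0 < n) (G : Dense n g) (M N : ℕ) (w≤M : 64 * g ≤ M) (2w≤N : 128 * g ≤ N)
  (NM≤n : N * M ≤ n) (n<NM+M : n < N * M + M) where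
  open Dense G
  private
    w = 64 * g
    rb = richᵇ g>0 n>0 G
    M>0 : 0 < M
    M>0 = ≤-trans (pos* {64} (s≤s z≤n) g>0) w≤M
    N>0 : 0 < N
    N>0 = ≤-trans (pos* {128} (s≤s z≤n) g>0) 2w≤N
    instance
      nzM : NonZero M
      nzM = >-nonZero M>0
    wN≤MN : w * N ≤ M * N
    wN≤MN = *-monoˡ-≤ N w≤M
    2wM≤MN : 128 * g * M ≤ M * N
    2wM≤MN = ≤-trans (*-monoˡ-≤ M 2w≤N) (≤-reflexive (*-comm N M))
    pairs : List (ℕ × ℕ)
    pairs = cartesianProduct (upTo n) (upTo n)
    non : ℕ → ℕ → Bool
    non v x = not (E v x)
    f₁ : ℕ → ℕ → Bool
    f₁ v = E v
    f₂ f₃ f₄ f₅ : ℕ × ℕ → ℕ → Bool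
    f₂ (v , x) y = E v y ∧ E x y
    f₃ (v , x) y = non v y ∧ E x y
    f₄ (u , v) x = E u x ∧ rb (E v) x
    f₅ (u , v) x = non u x ∧ rb (non v) x

  -- `f₁` serves `part-degree`, `f₂` serves `rich-codegree` and `f₄` serves `many-rich`. In `f₃` and
  -- `f₅` non-neighbours appear in place of some neighbours; they serve `crossing`.
  host-family : List (ℕ → Bool)
  host-family = map f₁ (upTo n) ++ map f₂ pairs ++ map f₃ pairs ++ map f₄ pairs ++ map f₅ pairs

  host-family-length : length host-family ≡ n + 4 * (n * n)
  host-family-length = trans (len f₁ (upTo n) (map f₂ pairs ++ map f₃ pairs ++ map f₄ pairs ++ map f₅ pairs))
    (cong₂ _+_ (List.length-upTo n) (trans (len f₂ pairs _) (trans (cong₂ _+_ lp (trans (len f₃ pairs _) (cong₂ _+_ lp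
      (trans (len f₄ pairs _) (cong₂ _+_ lp (trans (List.length-map f₅ pairs) lp)))))) (lem (n * n)))))
    where
    len : ∀ {A B : Set} (f : A → B) xs ys → length (map f xs ++ ys) ≡ length xs + length ys
    len f xs ys = trans (List.length-++ (map f xs)) (cong (_+ length ys) (List.length-map f xs))
    lp : length pairs ≡ n * n
    lp = trans (length-cartesianProduct (upTo n) (upTo n)) (cong₂ _*_ (List.length-upTo n) (List.length-upTo n))
    lem : ∀ x → x + (x + (x + x)) ≡ 4 * x
    lem = solve-∀

  module _ (P : Equipartition M N host-family) where
    open Equipartition P
    private
      count-in : (ℕ → Bool) → ℕ → ℕ
      count-in X j = # N (λ i → X (V j i))

      fair′ : ∀ X → X ∈ host-family → ∀ {j} → j < M → 2 * # n X ≤ 2 * (M * count-in X j) + N + 2 * M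
      fair′ X X∈ {j} jl = ≤-trans (*-monoʳ-≤ 2 tail)
          (≤-trans (≤-reflexive (*-distribˡ-+ 2 (# (N * M) X) M)) (+-monoˡ-≤ (2 * M) (fair X X∈ j jl)))
        where
        tail : # n X ≤ # (N * M) X + M
        tail = ≤-trans (∑-mono-≤ (λ i → ⟦ X i ⟧) (<⇒≤ n<NM+M))
            (≤-trans (≤-reflexive (∑-split (N * M) M (λ i → ⟦ X i ⟧))) (+-monoʳ-≤ (# (N * M) X) (#-≤ M _)))

      dense-in : ∀ X → X ∈ host-family → n ≤ 4 * g * # n X → ∀ {j} → j < M → N ≤ 8 * g * count-in X j
      dense-in X X∈ big {j} jl = *-cancelˡ-≤ M (linear 16 (14 * (M * N)) (+-mono-≤ (+-mono-≤ (+-mono-≤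
          (*-monoʳ-≤ 32 NM≤n) (*-monoʳ-≤ 32 big)) (*-monoʳ-≤ (64 * g) (fair′ X X∈ jl))) (+-mono-≤ wN≤MN 2wM≤MN))
              (e M N g n (# n X) (count-in X j)))
        where
        e : ∀ M N g n X h → 16 * (M * N) +
            (32 * n + 32 * (4 * g * X) + 64 * g * (2 * (M * h) + N + 2 * M) + (M * N + M * N)) + 14 * (M * N)
          ≡ 16 * (M * (8 * g * h)) + (32 * (N * M) + 32 * n + 64 * g * (2 * X) + (64 * g * N + 128 * g * M))
        e = solve-∀

      ∈₁ : ∀ {v} → v < n → E v ∈ host-family
      ∈₁ l = ∈-++⁺ˡ (∈-map⁺ f₁ (∈-upTo⁺ l))
      ∈p : ∀ {u v} → u < n → v < n → (u , v) ∈ pairs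
      ∈p l m = ∈-cartesianProduct⁺ (∈-upTo⁺ l) (∈-upTo⁺ m)
      ∈₂ : ∀ {u v} → u < n → v < n → f₂ (u , v) ∈ host-family
      ∈₂ l m = ∈-++⁺ʳ (map f₁ (upTo n)) (∈-++⁺ˡ (∈-map⁺ f₂ (∈p l m)))
      ∈₃ : ∀ {u v} → u < n → v < n → f₃ (u , v) ∈ host-family
      ∈₃ l m = ∈-++⁺ʳ (map f₁ (upTo n)) (∈-++⁺ʳ (map f₂ pairs) (∈-++⁺ˡ (∈-map⁺ f₃ (∈p l m))))
      ∈₄ : ∀ {u v} → u < n → v < n → f₄ (u , v) ∈ host-family
      ∈₄ l m = ∈-++⁺ʳ (map f₁ (upTo n)) (∈-++⁺ʳ (map f₂ pairs) (∈-++⁺ʳ (map f₃ pairs) (∈-++⁺ˡ (∈-map⁺ f₄ (∈p l m)))))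
      ∈₅ : ∀ {u v} → u < n → v < n → f₅ (u , v) ∈ host-family
      ∈₅ l m = ∈-++⁺ʳ (map f₁ (upTo n))
          (∈-++⁺ʳ (map f₂ pairs) (∈-++⁺ʳ (map f₃ pairs) (∈-++⁺ʳ (map f₄ pairs) (∈-map⁺ f₅ (∈p l m)))))

      W : (ℕ → Bool) → (ℕ → Bool) → ℕ
      W a b = ∑ n (λ x → # n (λ y → a x ∧ (b y ∧ E x y)))

      degree′ : ∀ v → v < n → w * n ≤ 2 * w * # n (E v) + 2 * 1 * n
      degree′ v l = degree v l

      rich-vertices : ∀ {u v} → u < n → v < n → n ≤ 4 * g * # n (f₄ (u , v))
      rich-vertices {u} {v} l m = many-richᵇ g>0 n>0 G (E u) (E v)
          (large-pair g>0 n>0 G 1 (s≤s z≤n) (E u) (E v) (degree′ u l) (degree′ v m))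

      shrink : ∀ w x n d → x ≤ n → 2 ≤ w → w * n ≤ 2 * w * d + 2 * n → w * x ≤ 2 * w * d + 2 * x
      shrink w x n d x≤n 2≤w h = aux (n ∸ x) (m+[n∸m]≡n x≤n) h
        where
        e : ∀ w x r d → 1 * (w * x) + (2 * w * d + 2 * (x + r) + w * r) + 0 ≡ 1 * (2 * w * d + 2 * x) +
            (w * (x + r) + 2 * r)
        e = solve-∀
        aux : ∀ {n} r → x + r ≡ n → w * n ≤ 2 * w * d + 2 * n → w * x ≤ 2 * w * d + 2 * x
        aux r refl h = linear 1 0 (+-mono-≤ h (*-monoˡ-≤ r 2≤w)) (e w x r d)

      part-degree′ : ∀ {v j} → v < n → j < M → w * N ≤ 2 * w * count-in (E v) j + 4 * N
      part-degree′ {v} {j} l jl = *-cancelˡ-≤ M (linear 1 0 (+-mono-≤ (+-mono-≤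
           (shrink w (N * M) n (# n (E v)) NM≤n (≤-trans (s≤s (s≤s z≤n)) (*-monoʳ-≤ 64 g>0)) (degree v l))
           (*-monoʳ-≤ w (fair′ (E v) (∈₁ l) jl))) (+-mono-≤ wN≤MN 2wM≤MN)) (e g M N (# n (E v)) (count-in (E v) j)))
        where
        e : ∀ g M N d c → 1 * (M * (64 * g * N)) +
            (2 * (64 * g) * d + 2 * (N * M) + 64 * g * (2 * (M * c) + N + 2 * M) + (M * N + M * N)) + 0
          ≡ 1 * (M * (2 * (64 * g) * c + 4 * N)) + (64 * g * (N * M) + 64 * g * (2 * d) + (64 * g * N + 128 * g * M))
        e = solve-∀

      -- `F` and `S` are disjoint and each has almost half of the part; at most `5 N / (64 g)`
      -- positions lie outside both. `X` avoids `F` and has at least `8 N / (64 g)` positions, so it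
      -- cannot avoid `S` as well.
      meet : ∀ (F S X : ℕ → Bool) → w * N ≤ 2 * w * # N F + 4 * N → w * N ≤ 2 * w * # N S + 6 * N →
        (∀ i → i < N → S i ≡ true → F i ≡ false) → (∀ i → i < N → X i ≡ true → F i ≡ false) →
        N ≤ 8 * g * # N X → Σ ℕ λ i → i < N × X i ≡ true × S i ≡ true
      meet F S X hF hS SF XF hX with search N (λ i → X i ∧ S i)
      ... | inj₁ (i , l , e) = i , l , ∧-elim e
      ... | inj₂ none = ⊥-elim (<⇒≱ N>0 (linear 6 0 (+-mono-≤ (+-mono-≤ (*-monoʳ-≤ 16 hX′) (*-monoʳ-≤ (2 * w) both))
             (+-mono-≤ hF hS)) (e g N (# N F) (# N S) (# N (λ i → X i ∧ not (S i))) (# N (not ∘ F)))))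
        where
        X⊆ : # N X ≤ # N (λ i → X i ∧ not (S i))
        X⊆ = #-mono N λ i l Xi → ∧-intro Xi (not-false (lem i l Xi))
          where
          lem : ∀ i → i < N → X i ≡ true → S i ≡ false
          lem i l Xi with bool-cases (S i)
          ... | inj₂ h = h
          ... | inj₁ h = true≢false (∧-intro Xi h) (none i l)
        hX′ : N ≤ 8 * g * # N (λ i → X i ∧ not (S i))
        hX′ = ≤-trans hX (*-monoʳ-≤ (8 * g) X⊆)
        both : # N (λ i → X i ∧ not (S i)) + # N S + # N F ≤ N
        both = ≤-trans (+-monoˡ-≤ (# N F)
            (#-∧-compl N X S {not ∘ F} (λ i l e → not-false (SF i l e)) (λ i l e → not-false (XF i l e))))
          (≤-reflexive (trans (+-comm (# N (not ∘ F)) (# N F)) (#-not N F)))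
        e : ∀ g N f s x y → 6 * N + (16 * (8 * g * x) + 2 * (64 * g) * N +
            (2 * (64 * g) * f + 4 * N + (2 * (64 * g) * s + 6 * N))) + 0
          ≡ 6 * 0 + (16 * N + 2 * (64 * g) * (x + s + f) + (64 * g * N + 64 * g * N))
        e = solve-∀

      -- In part `j` the neighbours of `x` are confined to the complement of `S`, to about half of
      -- the part. By `fair` the degree of `x` is then at most about `n / 2`.
      non-degree : ∀ {x j} (S : ℕ → Bool) → x < n → j < M → w * N ≤ 2 * w * # N S + 6 * N →
        (∀ i → i < N → S i ≡ true → E x (V j i) ≡ false) → w * n ≤ 2 * w * # n (non x) + 2 * 4 * n
      non-degree {x} {j} S l jl hS SF =
          linear 1 0 (+-mono-≤ (+-mono-≤ (*-monoʳ-≤ (2 * w) (≤-reflexive (sym (#-not n (E x)))))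
          (*-monoʳ-≤ w (fair′ (E x) (∈₁ l) jl))) (+-mono-≤ (+-mono-≤ (*-monoʳ-≤ M hS) (*-monoʳ-≤ (2 * w * M) disj))
          (+-mono-≤ (+-mono-≤ wN≤MN 2wM≤MN) (+-mono-≤ (*-monoʳ-≤ w NM≤n) (*-monoʳ-≤ 8 NM≤n)))))
          (e g M N n (# n (E x)) (# n (non x)) (count-in (E x) j) (# N S))
        where
        disj : # N S + count-in (E x) j ≤ N
        disj = ≤-trans (+-monoˡ-≤ _ (#-mono N (λ i l Si → not-false (SF i l Si))))
            (≤-reflexive (trans (+-comm _ (count-in (E x) j)) (#-not N (λ i → E x (V j i)))))
        e : ∀ g M N n d a c s → 1 * (64 * g * n)
            + (2 * (64 * g) * (d + a) + 64 * g * (2 * (M * c) + N + 2 * M) +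
                (M * (2 * (64 * g) * s + 6 * N) + 2 * (64 * g) * M * N
              + (M * N + M * N + (64 * g * n + 8 * n)))) + 0
          ≡ 1 * (2 * (64 * g) * a + 2 * 4 * n)
            + (2 * (64 * g) * n + 64 * g * (2 * d) +
                (M * (64 * g * N) + 2 * (64 * g) * M * (s + c) +
                (64 * g * N + 128 * g * M + (64 * g * (N * M) + 8 * (N * M)))))
        e = solve-∀

      V<n : ∀ {j i} → j < M → i < N → V j i < n
      V<n jl il = ≤-trans (V-bound jl il) NM≤n

      large-nonempty : ∀ S → w * N ≤ 2 * w * # N S + 6 * N → Σ ℕ λ i → i < N × S i ≡ true
      large-nonempty S h = #-pos N S (aux (# N S) refl)
        where
        aux : ∀ k → # N S ≡ k → 0 < # N S
        aux (suc k) e rewrite e = s≤s z≤n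
        aux zero e = ⊥-elim (<⇒≱ N>0 (linear 58 0
            (+-mono-≤ (subst (λ z → w * N ≤ 2 * w * z + 6 * N) e h) (*-monoˡ-≤ N (*-monoʳ-≤ 64 g>0))) (lem g N)))
          where
          lem : ∀ g N → 58 * N + (2 * (64 * g) * 0 + 6 * N + 64 * g * N) + 0 ≡ 58 * 0 + (64 * g * N + 64 * 1 * N)
          lem = solve-∀

      -- Suppose there is no edge between `S` and `R`, and take `xs` in `S` and `xr` in `R`. Both
      -- have about `n / 2` non-neighbours, so many non-neighbours of `xr` are joined to many
      -- non-neighbours of `xs`. By `meet` one of the former, `x₁`, lies in `S`; again by `meet` a
      -- neighbour of `x₁` not adjacent to `xs` lies in `R`, a contradiction.
      crossing′ : ∀ {j k} → j < M → k < M → ∀ S R → w * N ≤ 2 * w * # N S + 6 * N → w * N ≤ 2 * w * # N R + 6 * N →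
        Σ ℕ λ s → Σ ℕ λ r → s < N × r < N × S s ≡ true × R r ≡ true × E (V j s) (V k r) ≡ true
      crossing′ {j} {k} jl kl S R hS hR with search N (λ s → S s ∧ not (eqb 0 (# N (λ r → R r ∧ E (V j s) (V k r)))))
      ... | inj₁ (s , sl , e) = s , r , sl , rl , proj₁ (∧-elim {S s} e) , ∧-elim er
        where
        pos : 0 < # N (λ r → R r ∧ E (V j s) (V k r))
        pos = aux _ (proj₂ (∧-elim {S s} e))
          where
          aux : ∀ k → not (eqb 0 k) ≡ true → 0 < k
          aux (suc k) _ = s≤s z≤n
          aux zero h = true≢false (eqb-refl 0) (not-true h)
        hit = #-pos N _ pos
        r = proj₁ hit
        rl = proj₁ (proj₂ hit)
        er = proj₂ (proj₂ hit)
      ... | inj₂ none = ⊥-elim contra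
        where
        apart : ∀ s r → s < N → r < N → S s ≡ true → R r ≡ true → E (V j s) (V k r) ≡ false
        apart s r sl rl Ss Rr with bool-cases (E (V j s) (V k r))
        ... | inj₂ h = h
        ... | inj₁ h = true≢false (∧-intro Ss
            (not-false (eqb-≢ (<⇒≢ (≤-trans (≤-reflexive (sym (⟦⟧-true (∧-intro Rr h))))
            (∑-pick N (λ r → ⟦ R r ∧ E (V j s) (V k r) ⟧) r rl)))))) (none s sl)
        S₀ = large-nonempty S hS
        R₀ = large-nonempty R hR
        xs = V j (proj₁ S₀)
        xr = V k (proj₁ R₀)
        xs< : xs < n
        xs< = V<n jl (proj₁ (proj₂ S₀))
        xr< : xr < n
        xr< = V<n kl (proj₁ (proj₂ R₀))
        SF : ∀ i → i < N → S i ≡ true → E xr (V j i) ≡ false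
        SF i l Si = trans (E-sym xr (V j i)) (apart i _ l (proj₁ (proj₂ R₀)) Si (proj₂ (proj₂ R₀)))
        RF : ∀ i → i < N → R i ≡ true → E xs (V k i) ≡ false
        RF i l Ri = apart _ i (proj₁ (proj₂ S₀)) l (proj₂ (proj₂ S₀)) Ri
        big : n ≤ 4 * g * # n (f₅ (xr , xs))
        big = many-richᵇ g>0 n>0 G (non xr) (non xs)
            (large-pair g>0 n>0 G 4 (s≤s (s≤s (s≤s (s≤s z≤n)))) (non xr) (non xs)
          (non-degree S xr< jl hS SF) (non-degree R xs< kl hR RF))
        first = meet (λ i → E xr (V j i)) S (λ i → f₅ (xr , xs) (V j i)) (part-degree′ xr< jl) hS SF
          (λ i _ h → not-true (proj₁ (∧-elim h))) (dense-in (f₅ (xr , xs)) (∈₅ xr< xs<) big jl)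
        i₁ = proj₁ first
        x₁ = V j i₁
        rich₁ : rb (non xs) x₁ ≡ true
        rich₁ = proj₂ (∧-elim {non xr x₁} (proj₁ (proj₂ (proj₂ first))))
        second = meet (λ i → E xs (V k i)) R (λ i → f₃ (xs , x₁) (V k i)) (part-degree′ xs< kl) hR RF
          (λ i _ h → not-true (proj₁ (∧-elim h)))
              (dense-in (f₃ (xs , x₁)) (∈₃ xs< (V<n jl (proj₁ (proj₂ first)))) (leb-≤ rich₁) kl)
        contra : ⊥
        contra = true≢false (proj₂ (∧-elim {non xs (V k (proj₁ second))} (proj₁ (proj₂ (proj₂ second)))))
          (apart i₁ (proj₁ second) (proj₁ (proj₂ first)) (proj₁ (proj₂ second)) (proj₂ (proj₂ (proj₂ first)))
              (proj₂ (proj₂ (proj₂ second))))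

    host : Host n g M N E
    host = record
      { V = V
      ; V-bound = V<n
      ; V-inj = V-inj
      ; rich = λ v x → rb (E v) x
      ; many-rich = λ {u} {v} {j} l m jl → dense-in (f₄ (u , v)) (∈₄ l m) (rich-vertices l m) jl
      ; rich-codegree = λ {v} {x} {j} l m r jl → dense-in (f₂ (v , x)) (∈₂ l m) (leb-≤ r) jl
      ; part-degree = part-degree′
      ; crossing = crossing′
      }

-- Perfect matchings and stars of matchings between parts.

∑ᴸ-mono-∈ : ∀ {A : Set} (xs : List A) {f g} → (∀ x → x ∈ xs → f x ≤ g x) → ∑ᴸ xs f ≤ ∑ᴸ xs g
∑ᴸ-mono-∈ [] h = z≤n
∑ᴸ-mono-∈ (x ∷ xs) h = +-mono-≤ (h x (here refl)) (∑ᴸ-mono-∈ xs (λ y i → h y (there i)))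

∑ᴸ-pos : ∀ {A : Set} (xs : List A) (f : A → ℕ) → 0 < ∑ᴸ xs f → Σ A λ x → x ∈ xs × 0 < f x
∑ᴸ-pos (x ∷ xs) f h with f x in e
... | suc _ = x , here refl , ≤-trans (s≤s z≤n) (≤-reflexive (sym e))
... | zero with ∑ᴸ-pos xs f h
... | y , i , p = y , there i , p

allᵇ : ℕ → (ℕ → Bool) → Bool
allᵇ zero p = true
allᵇ (suc n) p = allᵇ n p ∧ p n

allᵇ-elim : ∀ n {p} → allᵇ n p ≡ true → ∀ i → i < n → p i ≡ true
allᵇ-elim (suc n) h i l with m≤n⇒m<n∨m≡n (≤-pred l)
... | inj₁ l′ = allᵇ-elim n (proj₁ (∧-elim h)) i l′
... | inj₂ refl = proj₂ (∧-elim {allᵇ n _} h)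

allᵇ-intro : ∀ n {p} → (∀ i → i < n → p i ≡ true) → allᵇ n p ≡ true
allᵇ-intro zero h = refl
allᵇ-intro (suc n) h = ∧-intro (allᵇ-intro n (λ i l → h i (m<n⇒m<1+n l))) (h n ≤-refl)

-- Bijections of all of `ℕ` that preserve the range below `N`, so that the inverse laws carry no
-- range hypotheses.
record Perm (N : ℕ) : Set where
  field
    to from : ℕ → ℕ
    to-from : ∀ x → to (from x) ≡ x
    from-to : ∀ x → from (to x) ≡ x
    to< : ∀ {x} → x < N → to x < N
    from< : ∀ {x} → x < N → from x < N
open Perm

to-inj : ∀ {N} (f : Perm N) {x y} → to f x ≡ to f y → x ≡ y
to-inj f {x} {y} e = trans (sym (from-to f x)) (trans (cong (from f) e) (from-to f y))

from-inj : ∀ {N} (f : Perm N) {x y} → from f x ≡ from f y → x ≡ y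
from-inj f {x} {y} e = trans (sym (to-from f x)) (trans (cong (to f) e) (to-from f y))

idᴾ : ∀ N → Perm N
idᴾ N = record { to = id ; from = id ; to-from = λ _ → refl ; from-to = λ _ → refl ; to< = id ; from< = id }

τ : ℕ → ℕ → ℕ → ℕ
τ a b x = if eqb x a then b else (if eqb x b then a else x)

τ-left : ∀ a b → τ a b a ≡ b
τ-left a b rewrite eqb-refl a = refl

τ-right : ∀ a b → τ a b b ≡ a
τ-right a b with bool-cases (eqb b a)
... | inj₁ e rewrite e = eqb-≡ e
... | inj₂ e rewrite e | eqb-refl b = refl

τ-other : ∀ a b {x} → x ≢ a → x ≢ b → τ a b x ≡ x
τ-other a b p q rewrite eqb-≢ p | eqb-≢ q = refl

τ-invol : ∀ a b x → τ a b (τ a b x) ≡ x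
τ-invol a b x with x ≟ a | x ≟ b
... | yes refl | _ = trans (cong (τ a b) (τ-left a b)) (τ-right a b)
... | no _ | yes refl = trans (cong (τ a b) (τ-right a b)) (τ-left a b)
... | no p | no q = trans (cong (τ a b) (τ-other a b p q)) (τ-other a b p q)

τ-< : ∀ {N a b x} → a < N → b < N → x < N → τ a b x < N
τ-< {N} {a} {b} {x} la lb lx with x ≟ a | x ≟ b
... | yes refl | _ = subst (_< N) (sym (τ-left a b)) lb
... | no _ | yes refl = subst (_< N) (sym (τ-right a b)) la
... | no p | no q = subst (_< N) (sym (τ-other a b p q)) lx

swapᴾ : ∀ {N} → Perm N → (a b : ℕ) → a < N → b < N → Perm N
swapᴾ f a b la lb = record
  { to = λ x → to f (τ a b x)
  ; from = λ x → τ a b (from f x)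
  ; to-from = λ x → trans (cong (to f) (τ-invol a b (from f x))) (to-from f x)
  ; from-to = λ x → trans (cong (τ a b) (from-to f (τ a b x))) (τ-invol a b x)
  ; to< = λ l → to< f (τ-< la lb l)
  ; from< = λ l → τ-< la lb (from< f l)
  }

#-from : ∀ {N} (f : Perm N) p → # N (λ x → p (from f x)) ≤ # N p
#-from {N} f p = #-inj N N (from f) (λ i l e → from< f l , e) (λ i j _ _ _ _ e → from-inj f e)

#-to : ∀ {N} (f : Perm N) p → # N p ≤ # N (λ x → p (to f x))
#-to {N} f p = #-inj N N (from f) (λ i l e → from< f l , trans (cong p (to-from f i)) e)
    (λ i j _ _ _ _ e → from-inj f e)

-- Some `l` preserves at least the average share `1/K` of the weight. Density is asked only where
-- the weight is positive, so earlier choices can be recorded in `y` by setting spoiled weights to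
-- zero.
best-choice : ∀ {Req : Set} N K (reqs : List Req) (y : Req → ℕ) (cand : ℕ → Req → Bool) → 0 < N →
  (∀ r → r ∈ reqs → 0 < y r → N ≤ K * # N (λ l → cand l r)) →
  Σ ℕ λ l → l < N × ∑ᴸ reqs y ≤ K * ∑ᴸ reqs (λ r → y r * ⟦ cand l r ⟧)
best-choice N K reqs y cand N>0 h = l , proj₁ (proj₂ best) , *-cancelˡ-≤ N {{>-nonZero N>0}} (begin
  N * ∑ᴸ reqs y                                        ≡⟨ sym (∑ᴸ-* reqs N y) ⟩
  ∑ᴸ reqs (λ r → N * y r)                              ≤⟨ ∑ᴸ-mono-∈ reqs row ⟩
  ∑ᴸ reqs (λ r → K * ∑ N (λ l → y r * ⟦ cand l r ⟧))   ≡⟨ ∑ᴸ-* reqs K _ ⟩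
  K * ∑ᴸ reqs (λ r → ∑ N (λ l → y r * ⟦ cand l r ⟧))   ≡⟨
      cong (K *_) (sym (∑ᴸ-∑-swap reqs N (λ l r → y r * ⟦ cand l r ⟧))) ⟩
  K * ∑ N F                                            ≤⟨ *-monoʳ-≤ K (proj₂ (proj₂ best)) ⟩
  K * (N * F l)                                        ≡⟨ e₁ K N (F l) ⟩
  N * (K * F l)                                        ∎)
  where
  open ≤-Reasoning
  F : ℕ → ℕ
  F l = ∑ᴸ reqs (λ r → y r * ⟦ cand l r ⟧)
  best = avg-≥ N F N>0
  l = proj₁ best
  e₁ : ∀ a b c → a * (b * c) ≡ b * (a * c)
  e₁ = solve-∀
  row : ∀ r → r ∈ reqs → N * y r ≤ K * ∑ N (λ l → y r * ⟦ cand l r ⟧)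
  row r i = ≤-trans (aux (y r) refl) (≤-reflexive (cong (K *_) (sym (∑-* N (y r) _))))
    where
    aux : ∀ m → y r ≡ m → N * m ≤ K * (m * # N (λ l → cand l r))
    aux zero _ = ≤-trans (≤-reflexive (*-zeroʳ N)) z≤n
    aux (suc m) e = ≤-trans (*-monoˡ-≤ (suc m) (h r i (subst (0 <_) (sym e) (s≤s z≤n))))
        (≤-reflexive (e₂ K _ (suc m)))
      where
      e₂ : ∀ a b c → a * b * c ≡ a * (c * b)
      e₂ = solve-∀

best-choices : ∀ {Req : Set} N K (reqs : List Req) (y : Req → ℕ) (cand : ℕ → ℕ → Req → Bool) → 0 < N →
  (∀ i r → r ∈ reqs → 0 < y r → N ≤ K * # N (λ l → cand i l r)) → ∀ m →
  Σ (ℕ → ℕ) λ l → (∀ i → l i < N) × ∑ᴸ reqs y ≤ K ^ m * ∑ᴸ reqs (λ r → y r * ⟦ allᵇ m (λ i → cand i (l i) r) ⟧)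
best-choices N K reqs y cand N>0 h zero = (λ _ → 0) , (λ _ → N>0) ,
  ≤-reflexive (trans (∑ᴸ-cong reqs (λ r → sym (*-identityʳ (y r)))) (sym (+-identityʳ _)))
best-choices N K reqs y cand N>0 h (suc m) with best-choices N K reqs y cand N>0 h m
... | l , l< , le with best-choice N K reqs (λ r → y r * ⟦ allᵇ m (λ i → cand i (l i) r) ⟧) (cand m) N>0
                        (λ r i p → h m r i (*pos (y r) p))
  where
  *pos : ∀ a {b} → 0 < a * b → 0 < a
  *pos (suc a) _ = s≤s z≤n
... | x , x< , le′ = upd l m x , bound , (begin
  ∑ᴸ reqs y                                                              ≤⟨ le ⟩
  K ^ m * ∑ᴸ reqs (λ r → y r * ⟦ allᵇ m (λ i → cand i (l i) r) ⟧)         ≤⟨ *-monoʳ-≤ (K ^ m) le′ ⟩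
  K ^ m * (K * ∑ᴸ reqs (λ r → y r * ⟦ allᵇ m (λ i → cand i (l i) r) ⟧ * ⟦ cand m x r ⟧)) ≡⟨ e₁ (K ^ m) K _ ⟩
  K * K ^ m * ∑ᴸ reqs (λ r → y r * ⟦ allᵇ m (λ i → cand i (l i) r) ⟧ * ⟦ cand m x r ⟧)   ≡⟨
      cong (K * K ^ m *_) (∑ᴸ-cong reqs col) ⟩
  K * K ^ m * ∑ᴸ reqs (λ r → y r * ⟦ allᵇ (suc m) (λ i → cand i (upd l m x i) r) ⟧) ∎)
  where
  open ≤-Reasoning
  e₁ : ∀ a b c → a * (b * c) ≡ b * a * c
  e₁ = solve-∀
  bound : ∀ i → upd l m x i < N
  bound i with bool-cases (eqb m i)
  ... | inj₁ e rewrite e = x<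
  ... | inj₂ e rewrite e = l< i
  allᵇ-cong : ∀ n {p q : ℕ → Bool} → (∀ i → i < n → p i ≡ q i) → allᵇ n p ≡ allᵇ n q
  allᵇ-cong zero h = refl
  allᵇ-cong (suc n) h = cong₂ _∧_ (allᵇ-cong n (λ i l → h i (m<n⇒m<1+n l))) (h n ≤-refl)
  col : ∀ r → y r * ⟦ allᵇ m (λ i → cand i (l i) r) ⟧ * ⟦ cand m x r ⟧ ≡ y r *
      ⟦ allᵇ (suc m) (λ i → cand i (upd l m x i) r) ⟧
  col r = trans (*-assoc (y r) _ _) (cong (y r *_) (trans (sym (⟦⟧-∧ (allᵇ m (λ i → cand i (l i) r)) (cand m x r)))
    (cong ⟦_⟧ (cong₂ _∧_ (allᵇ-cong m (λ i l′ → cong (λ z → cand i z r) (sym (upd-below l x l′))))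
        (cong (λ z → cand m z r) (sym (upd-same l m x)))))))

rotate : ∀ {N} (f : Perm N) u s t → u < N → s < N → t < N → u ≢ s → u ≢ t → Σ (Perm N) λ f₂ →
  (to f₂ u ≡ to f s) × (to f₂ t ≡ to f u) × (s ≢ t → to f₂ s ≡ to f t) ×
      (∀ z → z ≢ u → z ≢ s → z ≢ t → to f₂ z ≡ to f z)
rotate f u s t u< s< t< u≢s u≢t = swapᴾ (swapᴾ f u s u< s<) s t s< t< ,
  trans (cong (λ z → to f (τ u s z)) (τ-other s t u≢s u≢t)) (cong (to f) (τ-left u s)) ,
  trans (cong (λ z → to f (τ u s z)) (τ-right s t)) (cong (to f) (τ-right u s)) ,
  (λ s≢t → trans (cong (λ z → to f (τ u s z)) (τ-left s t)) (cong (to f) (τ-other u s (≢-sym u≢t) (≢-sym s≢t)))) ,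
  λ z p q o → trans (cong (λ z → to f (τ u s z)) (τ-other s t q o)) (cong (to f) (τ-other u s p q))

-- A bad value f u is repaired by rotating the values of f along u → s → t.
repair : ∀ {N} (ok : ℕ → ℕ → Bool) (fixed : ℕ → Bool) (f : Perm N) u s t → u < N → s < N → t < N →
  ok u (to f u) ≡ false → ok u (to f s) ≡ true → ok s (to f t) ≡ true → ok t (to f u) ≡ true →
  fixed u ≡ false → fixed s ≡ false → fixed t ≡ false → Σ (Perm N) λ f₂ →
  (∀ z → fixed z ≡ true → to f₂ z ≡ to f z) × # N (λ z → not (ok z (to f₂ z))) + 1 ≤ # N (λ z → not (ok z (to f z)))
repair {N} ok fixed f u s t u< s< t< bad us st tu fu fs ft with rotate f u s t u< s< t<
    (λ { refl → true≢false us bad }) (λ { refl → true≢false tu bad })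
... | f₂ , at-u , at-t , at-s , elsewhere = f₂ ,
  (λ z e → elsewhere z (λ { refl → true≢false e fu }) (λ { refl → true≢false e fs }) (λ { refl → true≢false e ft })) ,
  ≤-trans (+-mono-≤ (#-mono N (λ z _ h → better z (not-true h))) (≤-reflexive (sym (#-point N u u<))))
    (#-∧-compl N (λ z → not (ok z (to f z))) (eqb u)
        (λ z _ e → subst (λ z → not (ok z (to f z)) ≡ true) (eqb-≡ e) (not-false bad)) (λ _ _ e → e))
  where
  good-s : ok s (to f₂ s) ≡ true
  good-s with s ≟ t
  ... | yes refl = trans (cong (ok s) at-t) tu
  ... | no s≢t = trans (cong (ok s) (at-s s≢t)) st
  better : ∀ z → ok z (to f₂ z) ≡ false → not (ok z (to f z)) ∧ not (eqb u z) ≡ true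
  better z h with z ≟ u
  ... | yes refl = true≢false (trans (cong (ok u) at-u) us) h
  ... | no p with z ≟ s
  ... | yes refl = true≢false good-s h
  ... | no p′ with z ≟ t
  ... | yes refl = true≢false (trans (cong (ok t) at-t) tu) h
  ... | no p″ = ∧-intro (not-false (trans (cong (ok z) (sym (elsewhere z p p′ p″))) h)) (not-false (eqb-≢ (≢-sym p)))

-- The power is the loss in choosing a center and `D + 1` leaves at density `1/(16 g)` each. Only
-- `N / (64 g)` positions are chosen with care, rounding costs a factor 2, and half of the aimed
-- number of hits is guaranteed: together `4 * (64 * g)`.
star-constant : ℕ → ℕ → ℕ
star-constant g D = 4 * (64 * g) * ((16 * g) ^ suc (suc D))

module Stars {n g M N : ℕ} {E : ℕ → ℕ → Bool} (g>0 : 0 < g) (N>0 : 0 < N) (E-sym : ∀ u v → E u v ≡ E v u)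
    (H : Host n g M N E) where
  open Host H
  private w = 64 * g

  -- For a bad `u`, `S` holds the positions whose partner is adjacent to `u`, and `R` the values
  -- whose preimage is adjacent to the partner of `u`. An edge from `S` to `R` makes the rotation of
  -- `repair` legal; frozen positions are kept out of both sets. The bound `k` on bad positions
  -- drops each time.
  complete-matching : ∀ {a b} → a < M → b < M → (fixed : ℕ → Bool) → w * # N fixed ≤ N → ∀ k (f : Perm N) →
    (∀ z → z < N → fixed z ≡ true → E (V a z) (V b (to f z)) ≡ true) →
    # N (λ z → not (E (V a z) (V b (to f z)))) ≤ k →
    Σ (Perm N) λ f′ → (∀ z → z < N → E (V a z) (V b (to f′ z)) ≡ true) ×
        (∀ z → z < N → fixed z ≡ true → to f′ z ≡ to f z)
  complete-matching {a} {b} al bl fixed small k f good few with search N (λ z → not (E (V a z) (V b (to f z))))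
  ... | inj₂ none = f , (λ z l → lem (none z l)) , λ _ _ _ → refl
    where
    lem : ∀ {x} → not x ≡ false → x ≡ true
    lem {true} _ = refl
  ... | inj₁ (u , u< , bad) = step k few
    where
    x = V a u
    y = V b (to f u)
    x< : x < n
    x< = V-bound al u<
    y< : y < n
    y< = V-bound bl (to< f u<)
    S R : ℕ → Bool
    S s = not (fixed s) ∧ E x (V b (to f s))
    R r = not (fixed (from f r)) ∧ E y (V a (from f r))
    cover : ∀ (p q : ℕ → Bool) → # N q ≤ # N fixed → w * N ≤ 2 * w * # N p + 4 * N →
        w * N ≤ 2 * w * # N (λ i → not (q i) ∧ p i) + 6 * N
    cover p q hq h = linear 1 0 (+-mono-≤ (+-mono-≤ h (*-monoʳ-≤ (2 * w) cov)) (*-monoʳ-≤ 2 small))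
        (e g N (# N p) (# N (λ i → not (q i) ∧ p i)) (# N fixed))
      where
      cov : # N p ≤ # N (λ i → not (q i) ∧ p i) + # N fixed
      cov = ≤-trans (#-cover N {q = q} (λ i _ e → aux i e)) (+-monoʳ-≤ (# N (λ i → not (q i) ∧ p i)) hq)
        where
        aux : ∀ i → p i ≡ true → (not (q i) ∧ p i ≡ true) ⊎ (q i ≡ true)
        aux i e with q i
        ... | true = inj₂ refl
        ... | false = inj₁ e
      e : ∀ g N c s t → 1 * (64 * g * N) + (2 * (64 * g) * c + 4 * N + 2 * (64 * g) * (s + t) + 2 * N) + 0
        ≡ 1 * (2 * (64 * g) * s + 6 * N) + (64 * g * N + 2 * (64 * g) * c + 2 * (64 * g * t))
      e = solve-∀
    hS : w * N ≤ 2 * w * # N S + 6 * N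
    hS = cover (λ s → E x (V b (to f s))) fixed ≤-refl
      (≤-trans (part-degree x< bl) (+-monoˡ-≤ (4 * N) (*-monoʳ-≤ (2 * w) (#-to f (λ l → E x (V b l))))))
    fᵒ : Perm N
    fᵒ = record { to = from f ; from = to f ; to-from = from-to f ; from-to = to-from f ; to< =
        from< f ; from< = to< f }
    hR : w * N ≤ 2 * w * # N R + 6 * N
    hR = cover (λ r → E y (V a (from f r))) (λ r → fixed (from f r)) (#-from f fixed)
      (≤-trans (part-degree y< al) (+-monoˡ-≤ (4 * N) (*-monoʳ-≤ (2 * w) (#-to fᵒ (λ l → E y (V a l))))))
    cr = crossing al bl S R hS hR
    s = proj₁ cr
    r = proj₁ (proj₂ cr)
    s< = proj₁ (proj₂ (proj₂ cr))
    r< = proj₁ (proj₂ (proj₂ (proj₂ cr)))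
    Ss = ∧-elim {not (fixed s)} (proj₁ (proj₂ (proj₂ (proj₂ (proj₂ cr)))))
    t = from f r
    Rr = ∧-elim {not (fixed t)} (proj₁ (proj₂ (proj₂ (proj₂ (proj₂ (proj₂ cr))))))
    u∉fixed : fixed u ≡ false
    u∉fixed = ¬-not λ e → true≢false (good u u< e) (not-true bad)
    fixedup = repair (λ z l → E (V a z) (V b l)) fixed f u s t u< s< (from< f r<) (not-true bad) (proj₂ Ss)
      (trans (cong (λ q → E (V a s) (V b q)) (to-from f r)) (proj₂ (proj₂ (proj₂ (proj₂ (proj₂ (proj₂ cr)))))))
      (trans (E-sym _ _) (proj₂ Rr)) u∉fixed (not-true (proj₁ Ss)) (not-true (proj₁ Rr))
    f₂ = proj₁ fixedup
    keep = proj₁ (proj₂ fixedup)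
    fewer = proj₂ (proj₂ fixedup)
    step : ∀ k → # N (λ z → not (E (V a z) (V b (to f z)))) ≤ k →
      Σ (Perm N) λ f′ → (∀ z → z < N → E (V a z) (V b (to f′ z)) ≡ true) ×
          (∀ z → z < N → fixed z ≡ true → to f′ z ≡ to f z)
    step zero few = ⊥-elim (n≮0 (≤-trans (≤-trans (m≤n+m 1 _) fewer) few))
    step (suc k) few = let done = complete-matching al bl fixed small k f₂ (λ z l e → trans (cong (λ q → E (V a z) (V b q)) (keep z e)) (good z l e))
                                    (≤-pred (≤-trans (≤-reflexive (+-comm 1 _)) (≤-trans fewer few)))
      in proj₁ done , proj₁ (proj₂ done) , λ z l e → trans (proj₂ (proj₂ done) z l e) (keep z e)

#-insert : ∀ N (P : ℕ → Bool) z → z < N → P z ≡ false → ∀ (q q′ : ℕ → Bool) → (∀ x → P x ≡ true → q x ≡ q′ x) →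
  # N (λ x → upd P z true x ∧ q x) ≡ # N (λ x → P x ∧ q′ x) + ⟦ q z ⟧
#-insert N P z z< z-new q q′ same =
    trans (∑-cong N (λ x _ → pt x))
    (trans (∑-+ N _ _) (cong (# N (λ x → P x ∧ q′ x) +_) (∑-point N z (λ x → ⟦ q x ⟧) z<)))
  where
  pt : ∀ x → ⟦ upd P z true x ∧ q x ⟧ ≡ ⟦ P x ∧ q′ x ⟧ + ⟦ eqb z x ⟧ * ⟦ q x ⟧
  pt x with bool-cases (eqb z x)
  ... | inj₁ e rewrite sym (eqb-≡ {z} {x} e) | z-new | eqb-refl z = sym (+-identityʳ _)
  ... | inj₂ e rewrite e with bool-cases (P x)
  ... | inj₁ p rewrite p | same x p = sym (+-identityʳ _)
  ... | inj₂ p rewrite p = refl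

choose-below : ∀ {A : Set} {Q : ℕ → A → Set} n → A → (∀ i → i < n → Σ A (Q i)) → Σ (ℕ → A) λ f → ∀ i → i < n →
    Q i (f i)
choose-below zero a h = (λ _ → a) , λ i ()
choose-below {A} {Q} (suc n) a h with choose-below {Q = Q} n a (λ i l → h i (m<n⇒m<1+n l)) | h n ≤-refl
... | f , hf | b , hb = upd f n b , λ i l → go i (m≤n⇒m<n∨m≡n (≤-pred l))
  where
  go : ∀ i → i < n ⊎ i ≡ n → Q i (upd f n b i)
  go i (inj₁ l) = subst (Q i) (sym (upd-below f b l)) (hf i l)
  go i (inj₂ refl) = subst (Q i) (sym (upd-same f n b)) hb

pos-factor : ∀ {a} B b → 0 < a → a ≤ B * b → 0 < b
pos-factor B zero a>0 h = ⊥-elim (<⇒≱ a>0 (≤-trans h (≤-reflexive (*-zeroʳ B))))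
pos-factor B (suc b) _ _ = s≤s z≤n

≤-double-quotient : ∀ N w .{{_ : NonZero w}} → w ≤ N → N ≤ 2 * w * (N / w)
≤-double-quotient N w w≤N = begin
  N                           ≡⟨ m≡m%n+[m/n]*n N w ⟩
  N % w + N / w * w           ≤⟨ +-monoˡ-≤ _
      (≤-trans (<⇒≤ (m%n<n N w)) (≤-trans (≤-reflexive (sym (+-identityʳ w))) (*-monoˡ-≤ w one))) ⟩
  N / w * w + N / w * w       ≡⟨ e (N / w) w ⟩
  2 * w * (N / w)             ∎
  where
  open ≤-Reasoning
  one : 1 ≤ N / w
  one = ≤-trans (≤-reflexive (sym (n/n≡1 w))) (/-monoˡ-≤ w w≤N)
  e : ∀ q w → q * w + q * w ≡ 2 * w * q
  e = solve-∀

-- Leaf 0 is meant for the parent of a tree vertex placed in the center part, leaf `suc j` for its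
-- child of index `j`.
record Star (n N c D : ℕ) (E : ℕ → ℕ → Bool) (V : ℕ → ℕ → ℕ) (a : ℕ) (L : ℕ → ℕ) : Set where
  field
    perm : ℕ → Perm N
    edge : ∀ i → i < suc D → ∀ z → z < N → E (V a z) (V (L i) (to (perm i) z)) ≡ true
    many : ∀ u v → u < n → v < n → N ≤ c * # N
        (λ z → E u (V a z) ∧ allᵇ (suc D) (λ i → E v (V (L i) (to (perm i) z))))

star-base : ℕ → ℕ → ℕ
star-base g D = (16 * g) ^ suc (suc D)

star-base>0 : ∀ g D → 0 < g → 0 < star-base g D
star-base>0 g D g>0 = ^-pos (16 * g) (suc (suc D)) (pos* {16} (s≤s z≤n) g>0)

module StarExistence {n g M N : ℕ} {E : ℕ → ℕ → Bool} (g>0 : 0 < g) (N>0 : 0 < N) (n>0 : 0 < n)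
    (E-sym : ∀ u v → E u v ≡ E v u)
  (H : Host n g M N E) (D : ℕ) where
  open Host H
  open Stars g>0 N>0 E-sym H
  private
    w = 64 * g
    K = 16 * g
    B = star-base g D
    Req = ℕ × ℕ
    B>0 : 0 < B
    B>0 = star-base>0 g D g>0
    w>0 : 0 < w
    w>0 = pos* {64} (s≤s z≤n) g>0
    instance
      nzw : NonZero w
      nzw = >-nonZero w>0

  module _ (C : ℕ) (open-drive : Drive.J₀ (star-base g D) C (star-base>0 g D g>0) ≤ N / (64 * g))
      (small : (n * n) * (n * n) ≤ C * (N / (64 * g)) ^ 4) (w≤N : 64 * g ≤ N)
    {a : ℕ} (a< : a < M) (L : ℕ → ℕ) (L< : ∀ i → L i < M) where
    private
      module Dr = Drive B C B>0
      J = N / w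
      wJ≤N : w * J ≤ N
      wJ≤N = ≤-trans (≤-reflexive (*-comm w J)) (m/n*n≤m N w)

      State = (ℕ → Perm N) × (ℕ → Bool)

      good : (ℕ → Perm N) → ℕ → Req → Bool
      good F z (u , v) = E u (V a z) ∧ allᵇ (suc D) (λ i → E v (V (L i) (to (F i) z)))

      hit : ℕ → State → Req → ℕ
      hit t (F , P) r = # N (λ z → P z ∧ good F z r)

      Inv : ℕ → State → Set
      Inv t (F , P) = # N P ≡ t × (∀ i → i < suc D → ∀ z → z < N → P z ≡ true →
          E (V a z) (V (L i) (to (F i) z)) ≡ true)

      pairs : List Req
      pairs = cartesianProduct (upTo n) (upTo n)

      pairs-length : length pairs ≡ n * n
      pairs-length = trans (length-cartesianProduct (upTo n) (upTo n))
          (cong₂ _*_ (List.length-upTo n) (List.length-upTo n))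

      pairs-bound : ∀ {u v} → (u , v) ∈ pairs → u < n × v < n
      pairs-bound i with ∈-cartesianProduct⁻ (upTo n) (upTo n) i
      ... | p , q = ∈-upTo⁻ p , ∈-upTo⁻ q

      -- At most `N / (64 g)` of the at least `8 N / (64 g)` candidates are used already; `7/64` is
      -- more than `4/64`.
      thin : ∀ {t} (c u : ℕ → Bool) → t ≤ J → # N u ≤ t → N ≤ 8 * g * # N c → N ≤ K * # N (λ i → c i ∧ not (u i))
      thin {t} c u t≤J hu h = linear 7 (48 * g * # N (λ i → c i ∧ not (u i)))
          (+-mono-≤ (+-mono-≤ (*-monoʳ-≤ 8 h) (*-monoʳ-≤ w cov)) (≤-trans (*-monoʳ-≤ w t≤J) wJ≤N))
        (e g N (# N c) (# N (λ i → c i ∧ not (u i))) t)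
        where
        cov : # N c ≤ # N (λ i → c i ∧ not (u i)) + t
        cov = ≤-trans (#-cover N {q = u} aux) (+-monoʳ-≤ _ hu)
          where
          aux : ∀ i → i < N → c i ≡ true → (c i ∧ not (u i) ≡ true) ⊎ (u i ≡ true)
          aux i _ e with u i
          ... | true = inj₂ refl
          ... | false = inj₁ (∧-intro e refl)
        e : ∀ g N c s t → 7 * N + (8 * (8 * g * c) + 64 * g * (s + t) + N) + 48 * g * s ≡ 7 * (16 * g * s) +
            (8 * N + 64 * g * c + 64 * g * t)
        e = solve-∀

      next : ∀ t s → t < J → Inv t s → (ω : Req → ℕ) → (∀ r → 0 < ω r) → Σ State λ s′ →
          Inv (suc t) s′ × Σ (Req → Bool) λ κ →
        (∀ r → hit (suc t) s′ r ≡ hit t s r + ⟦ κ r ⟧) ×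
        ∑ᴸ pairs (λ r → ω r * fac Dr.q B 1 (κ r)) ≤ Dr.q * ∑ᴸ pairs ω
      next t (F , P) t<J (Pt , edges) ω ω>0 = (F′ , P′) , (Pt′ , edges′) , κ , hits , weight
        where
        -- Richness towards `v` guarantees many common neighbours of `v` and the new center in every
        -- leaf part, so all leaves can be chosen afterwards.
        center : ℕ → Req → Bool
        center z (u , v) = (E u (V a z) ∧ rich v (V a z)) ∧ not (P z)
        step₁ = best-choice N K pairs ω center N>0 λ
            { (u , v) i _ → thin (λ z → E u (V a z) ∧ rich v (V a z)) P (<⇒≤ t<J) (≤-reflexive Pt)
          (many-rich (proj₁ (pairs-bound i)) (proj₂ (pairs-bound i)) a<) }
        z = proj₁ step₁
        z< = proj₁ (proj₂ step₁)
        y : Req → ℕ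
        y r = ω r * ⟦ center z r ⟧
        leaf : ℕ → ℕ → Req → Bool
        leaf i l (u , v) = (E v (V (L i) l) ∧ E (V a z) (V (L i) l)) ∧ not (P (from (F i) l))
        y-center : ∀ r → 0 < y r → center z r ≡ true
        y-center r p with bool-cases (center z r)
        ... | inj₁ e = e
        ... | inj₂ e = ⊥-elim (n≮0 (subst (0 <_) (trans (cong (λ b → ω r * ⟦ b ⟧) e) (*-zeroʳ (ω r))) p))
        step₂ = best-choices N K pairs y leaf N>0
            (λ { i (u , v) m p → thin (λ l → E v (V (L i) l) ∧ E (V a z) (V (L i) l)) (λ l → P (from (F i) l))
            (<⇒≤ t<J)
          (≤-trans (#-from (F i) P) (≤-reflexive Pt))
          (rich-codegree (proj₂ (pairs-bound m)) (V-bound a< z<)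
              (proj₂ (∧-elim {E u (V a z)} (proj₁ (∧-elim (y-center (u , v) p))))) (L< i)) }) (suc D)
        l = proj₁ step₂
        l< = proj₁ (proj₂ step₂)
        y′ : Req → ℕ
        y′ r = y r * ⟦ allᵇ (suc D) (λ i → leaf i (l i) r) ⟧
        heavy : ∑ᴸ pairs ω ≤ B * ∑ᴸ pairs y′
        heavy = ≤-trans (proj₂ (proj₂ step₁))
            (≤-trans (*-monoʳ-≤ K (proj₂ (proj₂ step₂))) (≤-reflexive (sym (*-assoc K _ _))))
        r₀∈ : (0 , 0) ∈ pairs
        r₀∈ = ∈-cartesianProduct⁺ (∈-upTo⁺ n>0) (∈-upTo⁺ n>0)
        total>0 : 0 < ∑ᴸ pairs y′
        total>0 = pos-factor B _ (≤-trans (ω>0 (0 , 0)) (∑ᴸ-pick ω r₀∈)) heavy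
        witness = ∑ᴸ-pos pairs y′ total>0
        r₁ = proj₁ witness
        *-pos₁ : ∀ c {d} → 0 < c * d → 0 < c
        *-pos₁ (suc c) _ = s≤s z≤n
        *-pos₂ : ∀ c {d} → 0 < c * d → 0 < d
        *-pos₂ c {zero} p = ⊥-elim (n≮0 (subst (0 <_) (*-zeroʳ c) p))
        *-pos₂ c {suc d} _ = s≤s z≤n
        z-new : P z ≡ false
        z-new = not-true (proj₂ (∧-elim {E (proj₁ r₁) (V a z) ∧ rich (proj₂ r₁) (V a z)}
            (y-center r₁ (*-pos₁ (y r₁) (proj₂ (proj₂ witness))))))
        leaves : ∀ i → i < suc D → leaf i (l i) r₁ ≡ true
        leaves = allᵇ-elim (suc D) (⟦⟧-pos (*-pos₂ (y r₁) (proj₂ (proj₂ witness))))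
        l-edge : ∀ i → i < suc D → E (V a z) (V (L i) (l i)) ≡ true
        l-edge i il = proj₂ (∧-elim {E (proj₂ r₁) (V (L i) (l i))} (proj₁ (∧-elim (leaves i il))))
        l-new : ∀ i → i < suc D → P (from (F i) (l i)) ≡ false
        l-new i il = not-true (proj₂ (∧-elim {E (proj₂ r₁) (V (L i) (l i)) ∧ E (V a z) (V (L i) (l i))}
            (leaves i il)))
        F′ : ℕ → Perm N
        F′ i = swapᴾ (F i) z (from (F i) (l i)) z< (from< (F i) (l< i))
        P′ : ℕ → Bool
        P′ = upd P z true
        F′-z : ∀ i → to (F′ i) z ≡ l i
        F′-z i = trans (cong (to (F i)) (τ-left z _)) (to-from (F i) (l i))
        F′-old : ∀ i → i < suc D → ∀ x → P x ≡ true → to (F′ i) x ≡ to (F i) x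
        F′-old i il x Px = cong (to (F i))
            (τ-other z _ (λ { refl → true≢false Px z-new }) (λ { refl → true≢false Px (l-new i il) }))
        splitP : ∀ (q q′ : ℕ → Bool) → (∀ x → P x ≡ true → q x ≡ q′ x) →
            # N (λ x → P′ x ∧ q x) ≡ # N (λ x → P x ∧ q′ x) + ⟦ q z ⟧
        splitP q q′ = #-insert N P z z< z-new q q′
        Pt′ : # N P′ ≡ suc t
        Pt′ = trans (trans (#-cong N (λ x _ → sym (∧-true (P′ x)))) (splitP (λ _ → true) (λ _ → true) (λ _ _ → refl)))
          (trans (+-comm _ 1) (cong suc (trans (#-cong N (λ x _ → ∧-true (P x))) Pt)))
          where
          ∧-true : ∀ b → b ∧ true ≡ b
          ∧-true true = refl
          ∧-true false = refl
        edges′ : ∀ i → i < suc D → ∀ x → x < N → P′ x ≡ true → E (V a x) (V (L i) (to (F′ i) x)) ≡ true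
        edges′ i il x x< Px with z ≟ x
        ... | yes refl = trans (cong (λ q → E (V a z) (V (L i) q)) (F′-z i)) (l-edge i il)
        ... | no ¬e = trans (cong (λ q → E (V a x) (V (L i) q)) (F′-old i il x Px′)) (edges i il x x< Px′)
          where
          Px′ = trans (sym (upd-other P true ¬e)) Px
        κ : Req → Bool
        κ r = good F′ z r
        allᵇ-cong : ∀ m {p q : ℕ → Bool} → (∀ i → i < m → p i ≡ q i) → allᵇ m p ≡ allᵇ m q
        allᵇ-cong zero h = refl
        allᵇ-cong (suc m) h = cong₂ _∧_ (allᵇ-cong m (λ i l → h i (m<n⇒m<1+n l))) (h m ≤-refl)
        hits : ∀ r → hit (suc t) (F′ , P′) r ≡ hit t (F , P) r + ⟦ κ r ⟧
        hits r@(u , v) = splitP (λ x → good F′ x r) (λ x → good F x r) (λ x Px → cong (E u (V a x) ∧_)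
          (allᵇ-cong (suc D) (λ i il → cong (λ q → E v (V (L i) q)) (F′-old i il x Px))))
        y′≤κ : ∀ r → y′ r ≤ ω r * ⟦ κ r ⟧
        y′≤κ r@(u , v) = ≤-trans (≤-reflexive (trans (*-assoc (ω r) _ _) (cong (ω r *_) (sym (⟦⟧-∧ (center z r) _)))))
          (*-monoʳ-≤ (ω r) (⟦⟧-mono {center z r ∧ allᵇ (suc D) (λ i → leaf i (l i) r)} λ e → ∧-intro
            (proj₁ (∧-elim {E u (V a z)} (proj₁
                (∧-elim {E u (V a z) ∧ rich v (V a z)} (proj₁ (∧-elim {center z r} e))))))
            (allᵇ-intro (suc D) (λ i il → trans (cong (λ q → E v (V (L i) q)) (F′-z i))
              (proj₁ (∧-elim {E v (V (L i) (l i))}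
                  (proj₁ (∧-elim {E v (V (L i) (l i)) ∧ E (V a z) (V (L i) (l i))}
                  (allᵇ-elim (suc D) (proj₂ (∧-elim {center z r} e)) i il)))))))))
        fac-row : ∀ r → ω r * fac Dr.q B 1 (κ r) + B * (ω r * ⟦ κ r ⟧) ≡ suc Dr.q * ω r
        fac-row r = trans (aux (ω r) (fac Dr.q B 1 (κ r)) B ⟦ κ r ⟧)
            (trans (cong (ω r *_) (fac-def Dr.q B 1 (κ r) B≤q))
            (trans (*-comm (ω r) _) (cong (_* ω r) (+-comm Dr.q 1))))
          where
          aux : ∀ w f b k → w * f + b * (w * k) ≡ w * (f + b * k)
          aux = solve-∀
          B≤q : B ≤ Dr.q
          B≤q = ≤-trans (m≤m*n B B {{>-nonZero B>0}}) (m≤m+n (B * B) _)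
        weight : ∑ᴸ pairs (λ r → ω r * fac Dr.q B 1 (κ r)) ≤ Dr.q * ∑ᴸ pairs ω
        weight = +-cancelʳ-≤ (∑ᴸ pairs ω) _ _ (begin
          ∑ᴸ pairs (λ r → ω r * fac Dr.q B 1 (κ r)) + ∑ᴸ pairs ω
            ≤⟨ +-monoʳ-≤ _ (≤-trans heavy (*-monoʳ-≤ B (∑ᴸ-mono pairs y′≤κ))) ⟩
          ∑ᴸ pairs (λ r → ω r * fac Dr.q B 1 (κ r)) + B * ∑ᴸ pairs (λ r → ω r * ⟦ κ r ⟧)
            ≡⟨ cong (∑ᴸ pairs (λ r → ω r * fac Dr.q B 1 (κ r)) +_) (sym (∑ᴸ-* pairs B _)) ⟩
          ∑ᴸ pairs (λ r → ω r * fac Dr.q B 1 (κ r)) + ∑ᴸ pairs (λ r → B * (ω r * ⟦ κ r ⟧))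
            ≡⟨ sym (∑ᴸ-+ pairs _ _) ⟩
          ∑ᴸ pairs (λ r → ω r * fac Dr.q B 1 (κ r) + B * (ω r * ⟦ κ r ⟧))
            ≡⟨ ∑ᴸ-cong pairs fac-row ⟩
          ∑ᴸ pairs (λ r → suc Dr.q * ω r)
            ≡⟨ ∑ᴸ-* pairs (suc Dr.q) ω ⟩
          suc Dr.q * ∑ᴸ pairs ω
            ≡⟨ +-comm (∑ᴸ pairs ω) _ ⟩
          Dr.q * ∑ᴸ pairs ω + ∑ᴸ pairs ω ∎)
          where open ≤-Reasoning

      abstract
        result : Σ State λ s → Inv J s × (∀ r → r ∈ pairs → 2 * ∑ J (λ _ → 1) ≤ 2 * (B * hit J s r) + J)
        result = Dr.drive J open-drive pairs (subst (λ z → z * z ≤ C * J ^ 4) (sym pairs-length) small)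
            (λ _ _ → 1) (λ _ _ → B>0)
          Inv hit ((λ _ → idᴾ N) , (λ _ → false)) (∑-0 N , λ _ _ _ _ ()) (λ r → ∑-0 N) next
      F = proj₁ (proj₁ result)
      P = proj₂ (proj₁ result)
      P-small : w * # N P ≤ N
      P-small = ≤-trans (≤-reflexive (cong (w *_) (proj₁ (proj₁ (proj₂ result))))) wJ≤N
      P-edges = proj₂ (proj₁ (proj₂ result))
      abstract
        -- The good stars on `P` are frozen, and each of the `D + 1` bijections is repaired
        -- separately on the remaining positions.
        completed : ∀ i → i < suc D → Σ (Perm N) λ f′ → (∀ z → z < N → E (V a z) (V (L i) (to f′ z)) ≡ true) ×
            (∀ z → z < N → P z ≡ true → to f′ z ≡ to (F i) z)
        completed i il = complete-matching a< (L< i) P P-small N (F i) (λ z l e → P-edges i il z l e) (#-≤ N _)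
      abstract
        completed-all : Σ (ℕ → Perm N) λ f → ∀ i → i < suc D →
            (∀ z → z < N → E (V a z) (V (L i) (to (f i) z)) ≡ true) ×
            (∀ z → z < N → P z ≡ true → to (f i) z ≡ to (F i) z)
        completed-all = choose-below (suc D) (idᴾ N) completed
      F″ = proj₁ completed-all
      F″-edge : ∀ i → i < suc D → ∀ z → z < N → E (V a z) (V (L i) (to (F″ i) z)) ≡ true
      F″-edge i il = proj₁ (proj₂ completed-all i il)
      F″-same : ∀ i → i < suc D → ∀ z → z < N → P z ≡ true → to (F″ i) z ≡ to (F i) z
      F″-same i il = proj₂ (proj₂ completed-all i il)

      J-hits : ∀ r → r ∈ pairs → J ≤ 2 * (B * hit J (F , P) r)
      J-hits r i = linear 1 0 (proj₂ (proj₂ result) r i)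
          (trans (e J (B * hit J (F , P) r))
          (cong (λ z → 1 * (2 * (B * hit J (F , P) r)) + 2 * z) (sym (trans (∑-const J 1) (*-identityʳ J)))))
        where
        e : ∀ J h → 1 * J + (2 * h + J) + 0 ≡ 1 * (2 * h) + 2 * J
        e = solve-∀

    star : Star n N (star-constant g D) D E V a L
    star = record
      { perm = F″
      ; edge = F″-edge
      ; many = λ u v u< v< → begin
          N                                                  ≤⟨ ≤-double-quotient N w w≤N ⟩
          2 * w * J                                          ≤⟨
              *-monoʳ-≤ (2 * w) (J-hits (u , v) (∈-cartesianProduct⁺ (∈-upTo⁺ u<) (∈-upTo⁺ v<))) ⟩
          2 * w * (2 * (B * hit J (F , P) (u , v)))          ≡⟨ e w B _ ⟩
          4 * w * B * hit J (F , P) (u , v)                  ≤⟨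
              *-monoʳ-≤ (4 * w * B) (#-mono N (λ z l h → keep u v z l h)) ⟩
          4 * w * B * # N (λ z → good F″ z (u , v))          ∎
      }
      where
      open ≤-Reasoning
      e : ∀ w b h → 2 * w * (2 * (b * h)) ≡ 4 * w * b * h
      e = solve-∀
      keep : ∀ u v z → z < N → P z ∧ good F z (u , v) ≡ true → good F″ z (u , v) ≡ true
      keep u v z l h with ∧-elim {P z} h
      ... | Pz , gz = ∧-intro (proj₁ (∧-elim {E u (V a z)} gz)) (allᵇ-intro (suc D) λ i il →
              trans (cong (λ q → E v (V (L i) q)) (F″-same i il z l Pz))
                  (allᵇ-elim (suc D) (proj₂ (∧-elim {E u (V a z)} gz)) i il))

-- Rooted trees and their decomposition into components.

-- The vertices are 0 , … , m − 1 and 0 is the root; the value of par at 0 is junk.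
record Rooted (m D : ℕ) : Set where
  field
    par : ℕ → ℕ
    par≤ : ∀ i → par (suc i) ≤ i
    idx : ℕ → ℕ
    idx< : ∀ i → suc i < m → idx (suc i) < D
    idx-inj : ∀ i j → suc i < m → suc j < m → par (suc i) ≡ par (suc j) → idx (suc i) ≡ idx (suc j) → i ≡ j

  child : ℕ → ℕ → Bool
  child v zero = false
  child v (suc i) = eqb (par (suc i)) v

  child> : ∀ {v u} → child v u ≡ true → v < u
  child> {v} {suc i} e = s≤s (subst (_≤ i) (eqb-≡ e) (par≤ i))

  module _ {A : Set} (a : A) (f : ℕ → A → A) where
    private
      go : ℕ → ℕ → A
      go k zero = a
      go zero (suc i) = a
      go (suc k) (suc i) = f (suc i) (go k (par (suc i)))

      go-fuel : ∀ k k′ v → v ≤ k → v ≤ k′ → go k v ≡ go k′ v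
      go-fuel k k′ zero _ _ = refl
      go-fuel (suc k) (suc k′) (suc i) (s≤s l) (s≤s l′) =
          cong (f (suc i)) (go-fuel k k′ (par (suc i)) (≤-trans (par≤ i) l) (≤-trans (par≤ i) l′))

    -- Recursion along `par`; a vertex is its own fuel, since parents have smaller numbers.
    rec : ℕ → A
    rec v = go v v

    rec-suc : ∀ i → rec (suc i) ≡ f (suc i) (rec (par (suc i)))
    rec-suc i = cong (f (suc i)) (go-fuel i (par (suc i)) (par (suc i)) (par≤ i) ≤-refl)

  tree-induction : (P : ℕ → Set) → P 0 → (∀ i → P (par (suc i)) → P (suc i)) → ∀ v → P v
  tree-induction P base stp v = go v v ≤-refl
    where
    go : ∀ k v → v ≤ k → P v
    go k zero _ = base
    go (suc k) (suc i) (s≤s l) = stp i (go k (par (suc i)) (≤-trans (par≤ i) l))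

  ∑-children : ∀ {m′} → m ≡ suc m′ → (f : ℕ → ℕ) → ∑ m (λ v → ∑ m (λ u → ⟦ child v u ⟧ * f u)) ≡ ∑ m′
      (λ i → f (suc i))
  ∑-children {m′} refl f = begin
    ∑ m (λ v → ∑ m (λ u → ⟦ child v u ⟧ * f u))          ≡⟨ ∑-swap m m (λ v u → ⟦ child v u ⟧ * f u) ⟩
    ∑ m (λ u → ∑ m (λ v → ⟦ child v u ⟧ * f u))          ≡⟨ ∑-front m′ _ ⟩
    ∑ m (λ v → 0) + ∑ m′ (λ i → ∑ m (λ v → ⟦ eqb (par (suc i)) v ⟧ * f (suc i)))
      ≡⟨ cong₂ _+_ (∑-0 m) (∑-cong m′
          (λ i l → ∑-point m (par (suc i)) (λ _ → f (suc i)) (≤-trans (s≤s (par≤ i)) (m<n⇒m<1+n l)))) ⟩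
    ∑ m′ (λ i → f (suc i))                               ∎
    where open ≡-Reasoning

data St : Set where
  F : ℕ → St
  X Y C : St

isF : St → Bool
isF (F _) = true
isF X = false
isF Y = false
isF C = false

-- The Boolean tells whether the child is the one designated by its parent. Below `Y` and `C` an
-- undesignated child starts over at `X`.
trans-st : ℕ → St → Bool → St
trans-st h (F i) _ = if ltb (suc i) h then F (suc i) else X
trans-st h X true = Y
trans-st h X false = X
trans-st h Y true = C
trans-st h Y false = X
trans-st h C true = F 0
trans-st h C false = X

-- A fixed component consists of h consecutive levels F 0 , … , F (h − 1); below it the vertices are free (X) until
-- a designated path Y – C leads to the root of the next component.  Every vertex of state X , Y or C designates
-- one child index; with weights 1 , D³ , D² , D for the states F i , X , Y , C the uniform choice is stationary.
record Decomposition {m D : ℕ} (T : Rooted m D) (h : ℕ) : Set where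
  open Rooted T
  field
    start : ℕ
    start< : start < h
    st : ℕ → St
    st-root : st 0 ≡ F start
    des : ℕ → ℕ
    st-suc : ∀ i → st (suc i) ≡ trans-st h (st (par (suc i))) (eqb (idx (suc i)) (des (par (suc i))))
    few-free : h * # m (λ v → not (isF (st v))) ≤ m * (D * D * D + D * D + D)

-- Exactly one `d` equals `i`, the other `D − 1` give `g false`; adding `g false` on the left avoids
-- the subtraction.
∑-dichotomy : ∀ D i (g : Bool → ℕ) → i < D → ∑ D (λ d → g (eqb i d)) + g false ≡ g true + D * g false
∑-dichotomy D i g l = +-cancelʳ-≡ (g false) _ _ (begin
  ∑ D (λ d → g (eqb i d)) + g false + g false       ≡⟨
      cong (λ z → z + g false + g false) (∑-cong D (λ d _ → sym (pt₀ (eqb i d)))) ⟩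
  ∑ D (λ d → g′ (eqb i d)) + g false + g false      ≡⟨ lem₁ (∑ D (λ d → g′ (eqb i d))) (g false) ⟩
  ∑ D (λ d → g′ (eqb i d)) + 1 * g false + g false  ≡⟨
      cong (λ z → ∑ D (λ d → g′ (eqb i d)) + z * g false + g false) (sym (#-point D i l)) ⟩
  ∑ D (λ d → g′ (eqb i d)) + # D (eqb i) * g false + g false
    ≡⟨ cong (_+ g false) (trans (cong (∑ D (λ d → g′ (eqb i d)) +_)
        (trans (*-comm (# D (eqb i)) (g false)) (sym (∑-* D (g false) _)))) (sym (∑-+ D _ _))) ⟩
  ∑ D (λ d → g′ (eqb i d) + g false * ⟦ eqb i d ⟧) + g false
    ≡⟨ cong (_+ g false) (∑-cong D (λ d _ → pt (eqb i d))) ⟩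
  ∑ D (λ d → g true * ⟦ eqb i d ⟧ + g false) + g false
    ≡⟨ cong (_+ g false) (trans (∑-+ D _ _)
        (cong₂ _+_ (trans (∑-* D (g true) _) (trans (cong (g true *_) (#-point D i l)) (*-identityʳ (g true))))
        (∑-const D (g false)))) ⟩
  g true + D * g false + g false ∎)
  where
  open ≡-Reasoning
  g′ : Bool → ℕ
  g′ true = g true
  g′ false = g false
  pt₀ : ∀ b → g′ b ≡ g b
  pt₀ true = refl
  pt₀ false = refl
  lem₁ : ∀ a b → a + b + b ≡ a + 1 * b + b
  lem₁ = solve-∀
  pt : ∀ b → g′ b + g false * ⟦ b ⟧ ≡ g true * ⟦ b ⟧ + g false
  pt true = cong₂ _+_ (sym (*-identityʳ (g true))) (*-identityʳ (g false))
  pt false = trans (+-comm _ (g false * 0)) (cong₂ _+_ (trans (*-zeroʳ (g false)) (sym (*-zeroʳ (g true)))) refl)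

module Decompose {m′ D : ℕ} (D>0 : 0 < D) (T : Rooted (suc m′) D) (h′ : ℕ) where
  open Rooted T
  private
    m = suc m′
    h = suc h′
    π = D * D * D + D * D + D

    Cost = St → ℕ → ℕ

    free : St → ℕ
    free s = ⟦ not (isF s) ⟧

    below : Cost → St → ℕ → ℕ
    below e s v = ∑ m (λ u → ⟦ child v u ⟧ * e s u)

    cost : Cost → St → ℕ → ℕ → ℕ
    cost e s v d = free s + ∑ m (λ u → ⟦ child v u ⟧ * e (trans-st h s (eqb (idx u) d)) u)

    cost-cong : ∀ {e e′} v → (∀ s u → v < u → e s u ≡ e′ s u) → ∀ s d → cost e s v d ≡ cost e′ s v d
    cost-cong {e} {e′} v eq s d = cong (free s +_) (∑-cong m (λ u _ → pt u (bool-cases (child v u))))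
      where
      pt : ∀ u → (child v u ≡ true) ⊎ (child v u ≡ false) →
        ⟦ child v u ⟧ * e (trans-st h s (eqb (idx u) d)) u ≡ ⟦ child v u ⟧ * e′ (trans-st h s (eqb (idx u) d)) u
      pt u (inj₁ c) = cong (⟦ child v u ⟧ *_) (eq _ u (child> {v} {u} c))
      pt u (inj₂ c) rewrite c = refl

    Optimal : Cost → (St → ℕ → ℕ) → ℕ → Set
    Optimal e δ v = ∀ s → (e s v ≡ cost e s v (δ s v)) × (D * e s v ≤ ∑ D (cost e s v))

    -- Dynamic programming from the last vertex upwards: `e s v` is the number of free vertices in
    -- the subtree of `v` if `v` has state `s` and each designation is no worse than the average
    -- over all `D` choices. After `t` rounds the last `t` vertices are settled.
    dp : ∀ t → t ≤ m → Σ Cost λ e → Σ (St → ℕ → ℕ) λ δ → ∀ v → v < m → m ≤ v + t → Optimal e δ v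
    dp zero _ = (λ _ _ → 0) , (λ _ _ → 0) , λ v l g → ⊥-elim (<⇒≱ l (≤-trans g (≤-reflexive (+-identityʳ v))))
    dp (suc t) t<m with dp t (<⇒≤ t<m)
    ... | e , δ , opt = e′ , δ′ , opt′
      where
      v₀ = m ∸ suc t
      v₀+ : v₀ + suc t ≡ m
      v₀+ = m∸n+n≡m t<m
      pick : St → ℕ
      pick s = proj₁ (avg-≤ D (cost e s v₀) D>0)
      e′ : Cost
      e′ s = upd (e s) v₀ (cost e s v₀ (pick s))
      δ′ : St → ℕ → ℕ
      δ′ s = upd (δ s) v₀ (pick s)
      above : ∀ {v} → v₀ < v → ∀ s → (e′ s v ≡ e s v) × (δ′ s v ≡ δ s v)
      above l s = upd-other (e s) _ (<⇒≢ l) , upd-other (δ s) _ (<⇒≢ l)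
      costs : ∀ v → v₀ ≤ v → ∀ s d → cost e′ s v d ≡ cost e s v d
      costs v l = cost-cong v (λ s u l′ → proj₁ (above (≤-trans (s≤s l) l′) s))
      opt′ : ∀ v → v < m → m ≤ v + suc t → Optimal e′ δ′ v
      opt′ v l g s with m≤n⇒m<n∨m≡n {v₀} {v} (+-cancelʳ-≤ (suc t) v₀ v (≤-trans (≤-reflexive v₀+) g))
      ... | inj₁ lt = trans (proj₁ (above lt s))
          (trans (proj₁ (opt v l g′ s)) (trans (sym (costs v (<⇒≤ lt) s _))
          (cong (cost e′ s v) (sym (proj₂ (above lt s)))))) ,
        ≤-trans (≤-reflexive (cong (D *_) (proj₁ (above lt s))))
            (≤-trans (proj₂ (opt v l g′ s)) (≤-reflexive (∑-cong D (λ d _ → sym (costs v (<⇒≤ lt) s d)))))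
        where
        g′ : m ≤ v + t
        g′ = ≤-trans (≤-reflexive (sym v₀+)) (≤-trans (≤-reflexive (+-suc v₀ t)) (+-monoˡ-≤ t lt))
      ... | inj₂ refl = trans (upd-same (e s) v₀ _)
          (trans (sym (costs v₀ ≤-refl s _)) (cong (cost e′ s v₀) (sym (upd-same (δ s) v₀ _)))) ,
        ≤-trans (≤-reflexive (cong (D *_) (upd-same (e s) v₀ _)))
            (≤-trans (proj₂ (proj₂ (avg-≤ D (cost e s v₀) D>0)))
            (≤-reflexive (∑-cong D (λ d _ → sym (costs v₀ ≤-refl s d)))))

  module _ (e : Cost) (δ : St → ℕ → ℕ) (opt : ∀ v → v < m → Optimal e δ v) where
    private
      weight : ℕ → ℕ
      weight v = ∑ h (λ i → e (F i) v) + (D * D * D * e X v + (D * D * e Y v + D * e C v))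

      fixed-step : ∀ v → v < m → ∑ h (λ i → e (F i) v) + below e (F 0) v ≡ ∑ h (λ i → below e (F i) v) + below e X v
      fixed-step v l = begin
        ∑ h′ (λ i → e (F i) v) + e (F h′) v + below e (F 0) v
          ≡⟨ cong (_+ below e (F 0) v) (cong₂ _+_
              (∑-cong h′ (λ i il → trans (proj₁ (opt v l (F i)))
              (cong (λ b → ∑ m (λ u → ⟦ child v u ⟧ * e (if b then F (suc i) else X) u)) (≤-leb (s≤s il))))) last) ⟩
        ∑ h′ (λ i → below e (F (suc i)) v) + below e X v + below e (F 0) v
          ≡⟨ lem (∑ h′ (λ i → below e (F (suc i)) v)) (below e X v) (below e (F 0) v) ⟩
        below e (F 0) v + ∑ h′ (λ i → below e (F (suc i)) v) + below e X v
          ≡⟨ cong (_+ below e X v) (sym (∑-front h′ (λ i → below e (F i) v))) ⟩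
        ∑ h (λ i → below e (F i) v) + below e X v ∎
        where
        open ≡-Reasoning
        lem : ∀ a b c → a + b + c ≡ c + a + b
        lem = solve-∀
        stop : ltb (suc h′) h ≡ false
        stop = ¬-not (λ q → <-irrefl refl (leb-≤ q))
        last : e (F h′) v ≡ below e X v
        last = trans (proj₁ (opt v l (F h′)))
            (cong (λ b → ∑ m (λ u → ⟦ child v u ⟧ * e (if b then F (suc h′) else X) u)) stop)

      -- Average of the costs over all designations: a child is designated by one of them and falls
      -- back to `X` under the other `D − 1`.
      free-step : ∀ v → v < m → ∀ s s′ → free s ≡ 1 → trans-st h s true ≡ s′ → trans-st h s false ≡ X →
        D * e s v + below e X v ≤ D + below e s′ v + D * below e X v
      free-step v l s s′ f₁ tt ff = begin
        D * e s v + below e X v                     ≤⟨ +-monoˡ-≤ (below e X v) (proj₂ (opt v l s)) ⟩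
        ∑ D (cost e s v) + below e X v              ≡⟨
            cong (_+ below e X v) (trans (∑-+ D _ _)
            (cong₂ _+_ (trans (∑-const D _) (trans (cong (D *_) f₁) (*-identityʳ D)))
            (∑-swap D m (λ d u → ⟦ child v u ⟧ * e (trans-st h s (eqb (idx u) d)) u)))) ⟩
        D + ∑ m (λ u → ∑ D (λ d → ⟦ child v u ⟧ * e (trans-st h s (eqb (idx u) d)) u)) + below e X v
          ≡⟨ trans (+-assoc D _ _) (cong (D +_)
              (trans (sym (∑-+ m _ _)) (trans (∑-cong m pt)
              (trans (∑-+ m _ _) (cong (below e s′ v +_) (∑-* m D _)))))) ⟩
        D + (below e s′ v + D * below e X v)        ≡⟨ sym (+-assoc D _ _) ⟩
        D + below e s′ v + D * below e X v          ∎
        where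
        open ≤-Reasoning
        pt : ∀ u → u < m → ∑ D (λ d → ⟦ child v u ⟧ * e (trans-st h s (eqb (idx u) d)) u) + ⟦ child v u ⟧ * e X u
          ≡ ⟦ child v u ⟧ * e s′ u + D * (⟦ child v u ⟧ * e X u)
        pt zero ul = trans (+-identityʳ _) (trans (∑-0 D) (sym (*-zeroʳ D)))
        pt (suc i) ul = trans (cong₂ _+_ refl (cong (λ z → c * e z (suc i)) (sym ff)))
          (trans (∑-dichotomy D (idx (suc i)) (λ b → c * e (trans-st h s b) (suc i)) (idx< i ul))
            (cong₂ (λ y z → c * e y (suc i) + D * (c * e z (suc i))) tt ff))
          where c = ⟦ child v (suc i) ⟧

      below-weight : ∀ v → ∑ m (λ u → ⟦ child v u ⟧ * weight u)
        ≡ ∑ h (λ i → below e (F i) v) + (D * D * D * below e X v + (D * D * below e Y v + D * below e C v))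
      below-weight v = begin
        ∑ m (λ u → ⟦ child v u ⟧ * weight u) ≡⟨ ∑-cong m (λ u _ → pt u) ⟩
        ∑ m (λ u → ∑ h (λ i → ⟦ child v u ⟧ * e (F i) u) +
            (D * D * D * (⟦ child v u ⟧ * e X u) + (D * D * (⟦ child v u ⟧ * e Y u) + D * (⟦ child v u ⟧ * e C u))))
          ≡⟨ trans (∑-+ m _ _) (cong₂ _+_ (∑-swap m h (λ u i → ⟦ child v u ⟧ * e (F i) u))
               (trans (∑-+ m _ _) (cong₂ _+_ (∑-* m (D * D * D) _)
                   (trans (∑-+ m _ _) (cong₂ _+_ (∑-* m (D * D) _) (∑-* m D _)))))) ⟩
        ∑ h (λ i → below e (F i) v) + (D * D * D * below e X v + (D * D * below e Y v + D * below e C v)) ∎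
        where
        open ≡-Reasoning
        dist : ∀ c a D x y z → c * (a + (D * D * D * x + (D * D * y + D * z))) ≡ c * a +
            (D * D * D * (c * x) + (D * D * (c * y) + D * (c * z)))
        dist = solve-∀
        pt : ∀ u → ⟦ child v u ⟧ * weight u ≡ ∑ h (λ i → ⟦ child v u ⟧ * e (F i) u) +
            (D * D * D * (⟦ child v u ⟧ * e X u) + (D * D * (⟦ child v u ⟧ * e Y u) + D * (⟦ child v u ⟧ * e C u)))
        pt u = trans (dist ⟦ child v u ⟧ (∑ h (λ i → e (F i) u)) D (e X u) (e Y u) (e C u))
            (cong (_+ (D * D * D * (⟦ child v u ⟧ * e X u) +
            (D * D * (⟦ child v u ⟧ * e Y u) + D * (⟦ child v u ⟧ * e C u)))) (sym (∑-* h ⟦ child v u ⟧ _)))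

      -- Stationarity: passing to the children turns the weighted costs of all states into the same
      -- combination below `v`. For instance `X` receives `1 + (D³ − D²) + (D² − D) + (D − 1) = D³`.
      -- Only the free states pay at `v` itself, `D³ + D² + D` in all.
      weight-step : ∀ v → v < m → weight v ≤ π + ∑ m (λ u → ⟦ child v u ⟧ * weight u)
      weight-step v l = ≤-trans (linear 1 0
          (+-mono-≤ (+-mono-≤ (≤-reflexive (fixed-step v l)) (*-monoʳ-≤ (D * D) (free-step v l X Y refl refl refl)))
          (+-mono-≤ (*-monoʳ-≤ D (free-step v l Y C refl refl refl)) (free-step v l C (F 0) refl refl refl)))
          (lem D (∑ h (λ i → e (F i) v)) (e X v) (e Y v) (e C v) (∑ h (λ i → below e (F i) v)) (below e X v)
              (below e Y v) (below e C v) (below e (F 0) v)))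
          (≤-reflexive (cong (π +_) (sym (below-weight v))))
        where
        lem : ∀ D f x y c bf bx by bc b0 → 1 * (f + (D * D * D * x + (D * D * y + D * c))) +
            (bf + bx + D * D * (D + by + D * bx) + (D * (D + bc + D * bx) + (D + b0 + D * bx))) + 0
          ≡ 1 * (D * D * D + D * D + D + (bf + (D * D * D * bx + (D * D * by + D * bc))))
            + (f + b0 + D * D * (D * x + bx) + (D * (D * y + bx) + (D * c + bx)))
        lem = solve-∀

      -- Summed over all vertices, the weights of all non-roots cancel.
      weight-root : weight 0 ≤ m * π
      weight-root = +-cancelʳ-≤ (∑ m′ (λ i → weight (suc i))) _ _ (begin
        weight 0 + ∑ m′ (λ i → weight (suc i))            ≡⟨ sym (∑-front m′ weight) ⟩
        ∑ m weight                                        ≤⟨ ∑-mono m weight-step ⟩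
        ∑ m (λ v → π + ∑ m (λ u → ⟦ child v u ⟧ * weight u)) ≡⟨
            trans (∑-+ m _ _) (cong₂ _+_ (∑-const m π) (∑-children refl weight)) ⟩
        m * π + ∑ m′ (λ i → weight (suc i))               ∎)
        where open ≤-Reasoning

      -- Averaging over the level of the root is the source of the factor `h` in `few-free`.
      best = avg-≤ h (λ i → e (F i) 0) (s≤s z≤n)

      next-st : ℕ → St → St
      next-st u s = trans-st h s (eqb (idx u) (δ s (par u)))

      st : ℕ → St
      st = rec (F (proj₁ best)) next-st

      st-suc : ∀ i → st (suc i) ≡ next-st (suc i) (st (par (suc i)))
      st-suc = rec-suc (F (proj₁ best)) next-st

      st-child : ∀ v u → child v u ≡ true → st u ≡ trans-st h (st v) (eqb (idx u) (δ (st v) v))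
      st-child v (suc i) c = trans (st-suc i)
          (cong (λ w → trans-st h (st w) (eqb (idx (suc i)) (δ (st w) w))) (eqb-≡ c))

      along : ∀ v → v < m → e (st v) v ≡ free (st v) + ∑ m (λ u → ⟦ child v u ⟧ * e (st u) u)
      along v l = trans (proj₁ (opt v l (st v)))
          (cong (free (st v) +_) (∑-cong m (λ u _ → pt u (bool-cases (child v u)))))
        where
        pt : ∀ u → (child v u ≡ true) ⊎ (child v u ≡ false) →
          ⟦ child v u ⟧ * e (trans-st h (st v) (eqb (idx u) (δ (st v) v))) u ≡ ⟦ child v u ⟧ * e (st u) u
        pt u (inj₁ c) = cong (λ s → ⟦ child v u ⟧ * e s u) (sym (st-child v u c))
        pt u (inj₂ c) rewrite c = refl

      free-count : # m (λ v → not (isF (st v))) ≡ e (st 0) 0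
      free-count = +-cancelʳ-≡ (∑ m′ (λ i → e (st (suc i)) (suc i))) _ _ (begin
        # m (λ v → not (isF (st v))) + ∑ m′ (λ i → e (st (suc i)) (suc i))
          ≡⟨ cong (# m (λ v → not (isF (st v))) +_) (sym (∑-children refl (λ u → e (st u) u))) ⟩
        # m (λ v → not (isF (st v))) + ∑ m (λ v → ∑ m (λ u → ⟦ child v u ⟧ * e (st u) u))
          ≡⟨ sym (∑-+ m _ _) ⟩
        ∑ m (λ v → free (st v) + ∑ m (λ u → ⟦ child v u ⟧ * e (st u) u))
          ≡⟨ ∑-cong m (λ v l → sym (along v l)) ⟩
        ∑ m (λ v → e (st v) v)
          ≡⟨ ∑-front m′ _ ⟩
        e (st 0) 0 + ∑ m′ (λ i → e (st (suc i)) (suc i)) ∎)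
        where open ≡-Reasoning

    build : Decomposition T h
    build = record
      { start = proj₁ best
      ; start< = proj₁ (proj₂ best)
      ; st = st
      ; st-root = refl
      ; des = λ v → δ (st v) v
      ; st-suc = st-suc
      ; few-free = ≤-trans (≤-reflexive (cong (h *_) free-count))
          (≤-trans (proj₂ (proj₂ best)) (≤-trans (m≤m+n _ _) weight-root))
      }

  decompose : Decomposition T h
  decompose = build (proj₁ (dp m ≤-refl)) (proj₁ (proj₂ (dp m ≤-refl)))
      (λ v l → proj₂ (proj₂ (dp m ≤-refl)) v l (m≤n+m m v))

-- Labels and ranks of the vertices in fixed components.

enc : ℕ → ℕ → (ℕ → ℕ) → ℕ
enc B zero d = 0
enc B (suc k) d = enc B k (d ∘ suc) * B + d 0

enc< : ∀ B k d → (∀ i → i < k → d i < B) → enc B k d < B ^ k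
enc< B zero d h = s≤s z≤n
enc< B (suc k) d h = ≤-trans (div-bound (enc< B k (d ∘ suc) (λ i l → h (suc i) (s≤s l))) (h 0 (s≤s z≤n)))
    (≤-reflexive (*-comm (B ^ k) B))

enc-inj : ∀ B k d d′ → (∀ i → i < k → d i < B) → (∀ i → i < k → d′ i < B) → enc B k d ≡ enc B k d′ → ∀ i →
    i < k → d i ≡ d′ i
enc-inj B (suc k) d d′ h h′ e i l with div-unique B (enc B k (d ∘ suc)) (enc B k (d′ ∘ suc)) (d 0) (d′ 0)
    (h 0 (s≤s z≤n)) (h′ 0 (s≤s z≤n)) e
enc-inj B (suc k) d d′ h h′ e zero l | _ , e₀ = e₀
enc-inj B (suc k) d d′ h h′ e (suc i) (s≤s l) | es , _ =
  enc-inj B k (d ∘ suc) (d′ ∘ suc) (λ i l → h (suc i) (s≤s l)) (λ i l → h′ (suc i) (s≤s l)) es i l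

∑-unique : ∀ n (p : ℕ → Bool) (f : ℕ → ℕ) u → u < n → p u ≡ true → (∀ v → v < n → p v ≡ true → v ≡ u) →
    ∑ n (λ v → ⟦ p v ⟧ * f v) ≡ f u
∑-unique n p f u l pu un = trans (∑-cong n pt) (∑-point n u f l)
  where
  pt : ∀ v → v < n → ⟦ p v ⟧ * f v ≡ ⟦ eqb u v ⟧ * f v
  pt v vl with bool-cases (p v)
  ... | inj₁ e rewrite e | un v vl e | eqb-refl u = refl
  ... | inj₂ e rewrite e | eqb-≢ {u} {v} (λ { refl → true≢false pu e }) = refl

#-nth : ∀ n p r → r < # n p → Σ ℕ λ u → u < n × p u ≡ true × # u p ≡ r
#-nth (suc n) p r h with r <? # n p
... | yes l with #-nth n p r l
... | u , ul , pu , e = u , m<n⇒m<1+n ul , pu , e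
#-nth (suc n) p r h | no ¬l with bool-cases (p n)
... | inj₁ e = n , ≤-refl , e ,
    ≤-antisym (≮⇒≥ ¬l) (≤-pred (≤-trans h (≤-reflexive (trans (cong (λ z → # n p + ⟦ z ⟧) e) (+-comm _ 1)))))
... | inj₂ e = ⊥-elim (¬l (≤-trans h (≤-reflexive (trans (cong (λ z → # n p + ⟦ z ⟧) e) (+-identityʳ _)))))

trans-F0 : ∀ h s b → trans-st h s b ≡ F 0 → (s ≡ C) × (b ≡ true)
trans-F0 h (F i) b e with ltb (suc i) h
trans-F0 h (F i) b () | true
trans-F0 h (F i) b () | false
trans-F0 h X true ()
trans-F0 h X false ()
trans-F0 h Y true ()
trans-F0 h Y false ()
trans-F0 h C true e = refl , refl

trans-F-suc : ∀ h s b j → trans-st h s b ≡ F (suc j) → (s ≡ F j) × (suc j < h)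
trans-F-suc h (F i) b j e with ltb (suc i) h in lt
trans-F-suc h (F i) b .i refl | true = refl , leb-≤ lt
trans-F-suc h X true j ()
trans-F-suc h X false j ()
trans-F-suc h Y true j ()
trans-F-suc h Y false j ()
trans-F-suc h C true j ()
trans-F-suc h C false j ()

trans-C : ∀ h s b → trans-st h s b ≡ C → (s ≡ Y) × (b ≡ true)
trans-C h (F i) b e with ltb (suc i) h
trans-C h (F i) b () | true
trans-C h (F i) b () | false
trans-C h X true ()
trans-C h X false ()
trans-C h Y true e = refl , refl
trans-C h C true ()
trans-C h C false ()

trans-F : ∀ h b j → suc j < h → trans-st h (F j) b ≡ F (suc j)
trans-F h b j l rewrite ≤-leb l = refl

isF0 : St → Bool
isF0 (F zero) = true
isF0 _ = false

isF0-≡ : ∀ {s} → isF0 s ≡ true → s ≡ F 0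
isF0-≡ {F zero} _ = refl

level : St → ℕ
level (F i) = i
level _ = 0

shape-bound : ℕ → ℕ → ℕ
shape-bound D zero = 1
shape-bound D (suc k) = suc (shape-bound D k) ^ D

-- Labels below `K` are shapes of component roots, `K` belongs to vertex 0, and the child of index
-- `j` of a vertex labelled `ℓ` in the same component has the label `suc K + (ℓ * D + j)`.
label-bound : ℕ → ℕ → ℕ → ℕ
label-bound D K zero = suc K
label-bound D K (suc i) = suc K + (label-bound D K i * D + D)

label-count : ℕ → ℕ → ℕ
label-count D h′ = ∑ (suc h′) (label-bound D (shape-bound D h′))

-- Two vertices of fixed components get the same label if they sit at the same address in components of the same shape.
-- Together with the rank of its component among those of the same shape, the label determines a vertex.
module Labels {m′ D : ℕ} (T : Rooted (suc m′) D) (h′ : ℕ) (dec : Decomposition T (suc h′)) where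
  open Rooted T
  open Decomposition dec
  m = suc m′
  h = suc h′
  K = shape-bound D h′

  fixed : ℕ → Bool
  fixed v = isF (st v)

  data Kind (v : ℕ) : Set where
    top : v ≡ 0 → Kind v
    root : ∀ i → v ≡ suc i → st v ≡ F 0 → Kind v
    inner : ∀ i j → v ≡ suc i → st v ≡ F (suc j) → st (par v) ≡ F j → suc j < h → Kind v

  kind : ∀ v → fixed v ≡ true → Kind v
  kind zero _ = top refl
  kind (suc i) e = go (st (suc i)) refl e
    where
    go : ∀ s → st (suc i) ≡ s → isF s ≡ true → Kind (suc i)
    go (F zero) e _ = root i refl e
    go (F (suc j)) e _ with trans-F-suc h (st (par (suc i))) _ j (trans (sym (st-suc i)) e)
    ... | p , q = inner i j refl e p q

  fixed-F : ∀ {v j} → st v ≡ F j → fixed v ≡ true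
  fixed-F e = cong isF e

  -- The sum has at most one term; the value 0 stands for a missing child, hence the `suc`.
  digit : (ℕ → ℕ) → ℕ → ℕ → ℕ
  digit f v j = ∑ m (λ u → ⟦ child v u ∧ eqb (idx u) j ⟧ * suc (f u))

  -- A code for the subtree with indexed edges, truncated at depth `k`. For a component root, depth
  -- `h′` covers exactly its component.
  shape : ℕ → ℕ → ℕ
  shape zero v = 0
  shape (suc k) v = enc (suc (shape-bound D k)) D (digit (shape k) v)

  sibling : ∀ {v j u u′} → u < m → u′ < m → child v u ∧ eqb (idx u) j ≡ true →
      child v u′ ∧ eqb (idx u′) j ≡ true → u′ ≡ u
  sibling {v} {j} {suc i} {suc i′} l l′ e e′ with ∧-elim {child v (suc i)} e | ∧-elim {child v (suc i′)} e′
  ... | c , x | c′ , x′ = cong suc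
      (idx-inj i′ i l′ l (trans (eqb-≡ c′) (sym (eqb-≡ c))) (trans (eqb-≡ x′) (sym (eqb-≡ x))))
  sibling {v} {j} {zero} _ _ () _
  sibling {v} {j} {suc i} {zero} _ _ _ ()

  digit-child : ∀ f v j u → u < m → child v u ∧ eqb (idx u) j ≡ true → digit f v j ≡ suc (f u)
  digit-child f v j u l e = ∑-unique m (λ u → child v u ∧ eqb (idx u) j) (λ u → suc (f u)) u l e
      (λ u′ l′ e′ → sibling {v} {j} l l′ e e′)

  digit-cases : ∀ f v j → (digit f v j ≡ 0) ⊎ (Σ ℕ λ u → u < m × child v u ∧ eqb (idx u) j ≡ true)
  digit-cases f v j with search m (λ u → child v u ∧ eqb (idx u) j)
  ... | inj₁ w = inj₂ w
  ... | inj₂ none = inj₁ (trans (∑-cong m (λ u l → cong (λ b → ⟦ b ⟧ * suc (f u)) (none u l))) (∑-0 m))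

  shape< : ∀ k v → shape k v < shape-bound D k
  digit< : ∀ k v j → digit (shape k) v j < suc (shape-bound D k)
  shape< zero v = s≤s z≤n
  shape< (suc k) v = enc< _ D _ (λ j _ → digit< k v j)
  digit< k v j with digit-cases (shape k) v j
  ... | inj₁ e rewrite e = s≤s z≤n
  ... | inj₂ (u , l , e) rewrite digit-child (shape k) v j u l e = s≤s (shape< k u)

  shape-digit : ∀ k v v′ → shape (suc k) v ≡ shape (suc k) v′ → ∀ j → j < D →
      digit (shape k) v j ≡ digit (shape k) v′ j
  shape-digit k v v′ e = enc-inj _ D _ _ (λ j _ → digit< k v j) (λ j _ → digit< k v′ j) e

  -- Vertex 0 is excluded even if `start` is 0: its component may be cut off at the top and carries
  -- labels of its own, built on `K`.
  rootᵇ : ℕ → Bool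
  rootᵇ zero = false
  rootᵇ (suc i) = isF0 (st (suc i))

  same-shape : ℕ → ℕ → Bool
  same-shape v u = rootᵇ u ∧ eqb (shape h′ u) (shape h′ v)

  lab-step : ℕ → ℕ → ℕ
  lab-step u a = if isF0 (st u) then shape h′ u else suc K + (a * D + idx u)

  rk-step : ℕ → ℕ → ℕ
  rk-step u r = if isF0 (st u) then # u (same-shape u) else r

  abstract
    lab : ℕ → ℕ
    lab = rec K lab-step

    rk : ℕ → ℕ
    rk = rec 0 rk-step

    lab-top : lab 0 ≡ K
    lab-top = refl

    rk-top : rk 0 ≡ 0
    rk-top = refl

    lab-root : ∀ {i} → st (suc i) ≡ F 0 → lab (suc i) ≡ shape h′ (suc i)
    lab-root {i} e = trans (rec-suc K lab-step i)
        (cong (λ s → if isF0 s then shape h′ (suc i) else suc K + (lab (par (suc i)) * D + idx (suc i))) e)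

    rk-root : ∀ {i} → st (suc i) ≡ F 0 → rk (suc i) ≡ # (suc i) (same-shape (suc i))
    rk-root {i} e = trans (rec-suc 0 rk-step i)
        (cong (λ s → if isF0 s then # (suc i) (same-shape (suc i)) else rk (par (suc i))) e)

    lab-inner : ∀ {i j} → st (suc i) ≡ F (suc j) → lab (suc i) ≡ suc K + (lab (par (suc i)) * D + idx (suc i))
    lab-inner {i} e = trans (rec-suc K lab-step i)
        (cong (λ s → if isF0 s then shape h′ (suc i) else suc K + (lab (par (suc i)) * D + idx (suc i))) e)

    rk-inner : ∀ {i j} → st (suc i) ≡ F (suc j) → rk (suc i) ≡ rk (par (suc i))
    rk-inner {i} e = trans (rec-suc 0 rk-step i)
        (cong (λ s → if isF0 s then # (suc i) (same-shape (suc i)) else rk (par (suc i))) e)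

  lab-root< : ∀ {i} → st (suc i) ≡ F 0 → lab (suc i) < K
  lab-root< e = ≤-trans (≤-reflexive (cong suc (lab-root e))) (shape< h′ _)

  lab-inner> : ∀ {i j} → st (suc i) ≡ F (suc j) → K < lab (suc i)
  lab-inner> e = ≤-trans (m≤m+n (suc K) _) (≤-reflexive (sym (lab-inner e)))

  par< : ∀ {i} → suc i < m → par (suc i) < m
  par< {i} l = ≤-trans (s≤s (par≤ i)) (<⇒≤ l)

  level< : ∀ v → fixed v ≡ true → level (st v) < h
  level< v e with kind v e
  ... | top refl rewrite st-root = start<
  ... | root i refl e′ rewrite e′ = s≤s z≤n
  ... | inner i j refl e′ _ l rewrite e′ = l

  label-bound> : ∀ i → K < label-bound D K i
  label-bound> zero = ≤-refl
  label-bound> (suc i) = m≤m+n (suc K) _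

  lab<bound : ∀ v → v < m → fixed v ≡ true → lab v < label-bound D K (level (st v))
  lab<bound = tree-induction P (λ _ _ → subst (_< label-bound D K (level (st 0))) (sym lab-top)
      (label-bound> (level (st 0)))) stp
    where
    P : ℕ → Set
    P v = v < m → fixed v ≡ true → lab v < label-bound D K (level (st v))
    stp : ∀ i → P (par (suc i)) → P (suc i)
    stp i ih l fx with kind (suc i) fx
    ... | root i refl e rewrite e = <-trans (lab-root< e) ≤-refl
    ... | inner i j refl e e′ _ rewrite e | lab-inner e = s≤s (+-monoʳ-< K
          (+-mono-≤-< (*-monoˡ-≤ D (<⇒≤ (subst (λ s → lab (par (suc i)) < label-bound D K (level s)) e′
              (ih (par< l) (fixed-F e′))))) (idx< i l)))

  lab< : ∀ v → v < m → fixed v ≡ true → lab v < label-count D h′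
  lab< v l e = ≤-trans (lab<bound v l e) (∑-pick (suc h′) (label-bound D K) (level (st v)) (level< v e))

  SameType : ℕ → ℕ → Set
  SameType v v′ = (st v ≡ st v′) × (shape (h′ ∸ level (st v)) v ≡ shape (h′ ∸ level (st v)) v′)

  remaining : ∀ j → suc j < h → h′ ∸ j ≡ suc (h′ ∸ suc j)
  remaining j (s≤s l) = +-∸-assoc 1 {h′} {suc j} l

  child-self : ∀ i → child (par (suc i)) (suc i) ∧ eqb (idx (suc i)) (idx (suc i)) ≡ true
  child-self i = ∧-intro (eqb-refl (par (suc i))) (eqb-refl (idx (suc i)))

  inner-lab-eq : ∀ {i i′ j j′} → suc i < m → suc i′ < m → st (suc i) ≡ F (suc j) → st (suc i′) ≡ F (suc j′) →
      lab (suc i) ≡ lab (suc i′) →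
    (lab (par (suc i)) ≡ lab (par (suc i′))) × (idx (suc i) ≡ idx (suc i′))
  inner-lab-eq l l′ e e′ eq = div-unique D _ _ _ _ (idx< _ l) (idx< _ l′)
    (+-cancelˡ-≡ (suc K) _ _ (trans (sym (lab-inner e)) (trans eq (lab-inner e′))))

  type-shape : ∀ {v v′ j} → st v ≡ F j → suc j < h → SameType v v′ →
      shape (suc (h′ ∸ suc j)) v ≡ shape (suc (h′ ∸ suc j)) v′
  type-shape {v} {v′} {j} e l (_ , s) = subst (λ k → shape k v ≡ shape k v′)
      (trans (cong (λ s → h′ ∸ level s) e) (remaining j l)) s

  -- Induction down the components. The label of an inner vertex determines its index and the label
  -- of its parent, and parents of equal shape have children of equal shape at equal indices.
  same-label : ∀ v v′ → v < m → v′ < m → fixed v ≡ true → fixed v′ ≡ true → lab v ≡ lab v′ → SameType v v′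
  same-label = tree-induction P base stp
    where
    P : ℕ → Set
    P v = ∀ v′ → v < m → v′ < m → fixed v ≡ true → fixed v′ ≡ true → lab v ≡ lab v′ → SameType v v′
    base : P 0
    base v′ _ l _ fx e with kind v′ fx
    ... | top refl = refl , refl
    ... | root i refl e′ = ⊥-elim (<-irrefl (trans (sym e) lab-top) (lab-root< e′))
    ... | inner i j refl e′ _ _ = ⊥-elim (<-irrefl (trans (sym lab-top) e) (lab-inner> e′))
    stp : ∀ i → P (par (suc i)) → P (suc i)
    stp i ih v′ l l′ fx fx′ eq with kind (suc i) fx | kind v′ fx′
    ... | root _ refl e | top refl = ⊥-elim (<-irrefl (trans eq lab-top) (lab-root< e))
    ... | root _ refl e | root i′ refl e′ = trans e (sym e′) ,
          subst (λ s → shape (h′ ∸ level s) (suc i) ≡ shape (h′ ∸ level s) (suc i′)) (sym e)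
              (trans (sym (lab-root e)) (trans eq (lab-root e′)))
    ... | root _ refl e | inner i′ j refl e′ _ _ =
        ⊥-elim (<-asym (lab-root< e) (subst (K <_) (sym eq) (lab-inner> e′)))
    ... | inner _ j refl e _ _ | top refl = ⊥-elim (<-irrefl (sym (trans eq lab-top)) (lab-inner> e))
    ... | inner _ j refl e _ _ | root i′ refl e′ = ⊥-elim (<-asym (lab-root< e′) (subst (K <_) eq (lab-inner> e)))
    ... | inner _ j refl e ep lj | inner i′ j′ refl e′ ep′ _ = trans e (trans (cong (F ∘ suc) jj) (sym e′)) ,
          subst (λ s → shape (h′ ∸ level s) (suc i) ≡ shape (h′ ∸ level s) (suc i′)) (sym e) (suc-injective (begin
            suc (shape k (suc i))                            ≡⟨
                sym (digit-child (shape k) (par (suc i)) _ (suc i) l (child-self i)) ⟩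
            digit (shape k) (par (suc i)) (idx (suc i))      ≡⟨ shape-digit k _ _ (type-shape ep lj ty) _ (idx< i l) ⟩
            digit (shape k) (par (suc i′)) (idx (suc i))     ≡⟨ cong (digit (shape k) (par (suc i′))) (proj₂ eqs) ⟩
            digit (shape k) (par (suc i′)) (idx (suc i′))    ≡⟨ digit-child (shape k) (par (suc i′)) _ (suc i′)
                l′ (child-self i′) ⟩
            suc (shape k (suc i′))                           ∎))
      where
      open ≡-Reasoning
      k = h′ ∸ suc j
      eqs = inner-lab-eq l l′ e e′ eq
      ty = ih (par (suc i′)) (par< l) (par< l′) (fixed-F ep) (fixed-F ep′) (proj₁ eqs)
      F-inj : ∀ {a b} → F a ≡ F b → a ≡ b
      F-inj refl = refl
      jj : j ≡ j′
      jj = F-inj (trans (sym ep) (trans (proj₁ ty) ep′))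

  same-child : ∀ {i j v′} → suc i < m → st (suc i) ≡ F (suc j) → st (par (suc i)) ≡ F j → suc j < h → v′ < m →
      fixed v′ ≡ true →
    lab (par (suc i)) ≡ lab v′ → Σ ℕ λ i′ → suc i′ < m × par (suc i′) ≡ v′ × st (suc i′) ≡ F (suc j) × idx
        (suc i′) ≡ idx (suc i) × lab (suc i′) ≡ lab (suc i)
  same-child {i} {j} {v′} l e ep lj l′ fx eq with digit-cases (shape (h′ ∸ suc j)) v′ (idx (suc i))
  ... | inj₁ z = ⊥-elim (0≢1+n (trans (sym z)
      (trans (sym (shape-digit k _ _ (type-shape {par (suc i)} {v′} ep lj ty) _ (idx< i l)))
      (digit-child (shape k) (par (suc i)) _ (suc i) l (child-self i)))))
    where
    k = h′ ∸ suc j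
    ty = same-label (par (suc i)) v′ (par< l) l′ (fixed-F ep) fx eq
  ... | inj₂ (suc i′ , l″ , c) = i′ , l″ , pr , st′ , ix ,
      trans (lab-inner st′) (trans (cong₂ (λ a b → suc K + (a * D + b)) (trans (cong lab pr) (sym eq)) ix)
      (sym (lab-inner e)))
    where
    pr = eqb-≡ (proj₁ (∧-elim {child v′ (suc i′)} c))
    ix = eqb-≡ (proj₂ (∧-elim {child v′ (suc i′)} c))
    ty = same-label (par (suc i)) v′ (par< l) l′ (fixed-F ep) fx eq
    b = eqb (idx (suc i′)) (des (par (suc i′)))
    st′ : st (suc i′) ≡ F (suc j)
    st′ = trans (st-suc i′) (trans (cong (λ s → trans-st h s b)
        (trans (cong st pr) (trans (sym (proj₁ ty)) ep))) (trans-F h b j lj))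

  rk-mono : ∀ {i i′} → i < i′ → st (suc i) ≡ F 0 → st (suc i′) ≡ F 0 → shape h′ (suc i) ≡ shape h′ (suc i′) →
      rk (suc i) < rk (suc i′)
  rk-mono {i} {i′} l e e′ s = begin-strict
    rk (suc i)                                          ≡⟨ rk-root e ⟩
    # (suc i) (same-shape (suc i))                      ≡⟨
        #-cong (suc i) (λ u _ → cong (λ z → rootᵇ u ∧ eqb (shape h′ u) z) s) ⟩
    # (suc i) (same-shape (suc i′))                     <⟨ ≤-reflexive
        (trans (+-comm 1 _) (cong (# (suc i) (same-shape (suc i′)) +_) (sym (⟦⟧-true here′)))) ⟩
    # (suc (suc i)) (same-shape (suc i′))               ≤⟨ ∑-mono-≤ _ (s≤s l) ⟩
    # (suc i′) (same-shape (suc i′))                    ≡⟨ sym (rk-root e′) ⟩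
    rk (suc i′)                                         ∎
    where
    open ≤-Reasoning
    here′ : same-shape (suc i′) (suc i) ≡ true
    here′ = ∧-intro (cong isF0 e) (≡-eqb s)

  label-rank : ∀ v v′ → v < m → v′ < m → fixed v ≡ true → fixed v′ ≡ true → lab v ≡ lab v′ → rk v ≡ rk v′ → v ≡ v′
  label-rank = tree-induction P base stp
    where
    P : ℕ → Set
    P v = ∀ v′ → v < m → v′ < m → fixed v ≡ true → fixed v′ ≡ true → lab v ≡ lab v′ → rk v ≡ rk v′ → v ≡ v′
    base : P 0
    base v′ _ l _ fx e _ with kind v′ fx
    ... | top refl = refl
    ... | root i refl e′ = ⊥-elim (<-irrefl (trans (sym e) lab-top) (lab-root< e′))
    ... | inner i j refl e′ _ _ = ⊥-elim (<-irrefl (trans (sym lab-top) e) (lab-inner> e′))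
    stp : ∀ i → P (par (suc i)) → P (suc i)
    stp i ih v′ l l′ fx fx′ eq eqr with kind (suc i) fx | kind v′ fx′
    ... | root _ refl e | top refl = ⊥-elim (<-irrefl (trans eq lab-top) (lab-root< e))
    ... | root _ refl e | root i′ refl e′ = cong suc (order (<-cmp i i′))
      where
      s = trans (sym (lab-root e)) (trans eq (lab-root e′))
      order : Tri (i < i′) (i ≡ i′) (i′ < i) → i ≡ i′
      order (tri< a _ _) = ⊥-elim (<-irrefl eqr (rk-mono a e e′ s))
      order (tri≈ _ b _) = b
      order (tri> _ _ c) = ⊥-elim (<-irrefl (sym eqr) (rk-mono c e′ e (sym s)))
    ... | root _ refl e | inner i′ j refl e′ _ _ =
        ⊥-elim (<-asym (lab-root< e) (subst (K <_) (sym eq) (lab-inner> e′)))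
    ... | inner _ j refl e _ _ | top refl = ⊥-elim (<-irrefl (sym (trans eq lab-top)) (lab-inner> e))
    ... | inner _ j refl e _ _ | root i′ refl e′ = ⊥-elim (<-asym (lab-root< e′) (subst (K <_) eq (lab-inner> e)))
    ... | inner _ j refl e ep lj | inner i′ j′ refl e′ ep′ _ = cong suc (idx-inj i i′ l l′
          (ih (par (suc i′)) (par< l) (par< l′) (fixed-F ep) (fixed-F ep′) (proj₁ eqs)
              (trans (sym (rk-inner e)) (trans eqr (rk-inner e′)))) (proj₂ eqs))
      where
      eqs = inner-lab-eq l l′ e e′ eq

  lower-rank-root : ∀ {i r} → suc i < m → st (suc i) ≡ F 0 → r ≤ rk (suc i) →
    Σ ℕ λ i′ → suc i′ < m × st (suc i′) ≡ F 0 × lab (suc i′) ≡ lab (suc i) × rk (suc i′) ≡ r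
  lower-rank-root {i} {r} l e r≤ with m≤n⇒m<n∨m≡n r≤
  ... | inj₂ refl = i , l , e , refl , refl
  ... | inj₁ r< with #-nth (suc i) (same-shape (suc i)) r (≤-trans r< (≤-reflexive (rk-root e)))
  ... | suc i′ , l′ , p , c = i′ , <-trans l′ l , e′ , trans (lab-root e′) (trans s (sym (lab-root e))) ,
        trans (rk-root e′) (trans (#-cong (suc i′) (λ u _ → cong (λ z → rootᵇ u ∧ eqb (shape h′ u) z) s)) c)
    where
    e′ = isF0-≡ (proj₁ (∧-elim {rootᵇ (suc i′)} p))
    s = eqb-≡ (proj₂ (∧-elim {rootᵇ (suc i′)} p))

  -- The ranks occurring with a given label form an initial segment: a component root of lower rank
  -- has the same shape, so its component has a vertex at the same address.
  lower-rank : ∀ v → v < m → fixed v ≡ true → ∀ r → r ≤ rk v → Σ ℕ λ v′ →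
      v′ < m × fixed v′ ≡ true × lab v′ ≡ lab v × rk v′ ≡ r
  lower-rank = tree-induction P base stp
    where
    P : ℕ → Set
    P v = v < m → fixed v ≡ true → ∀ r → r ≤ rk v → Σ ℕ λ v′ → v′ < m × fixed v′ ≡ true × lab v′ ≡ lab v × rk v′ ≡ r
    base : P 0
    base l fx r r≤ = 0 , l , fx , refl , trans rk-top (sym (n≤0⇒n≡0 (≤-trans r≤ (≤-reflexive rk-top))))
    stp : ∀ i → P (par (suc i)) → P (suc i)
    stp i ih l fx r r≤ with kind (suc i) fx
    ... | root _ refl e with lower-rank-root l e r≤
    ... | i′ , l′ , e′ , le , re = suc i′ , l′ , fixed-F e′ , le , re
    stp i ih l fx r r≤ | inner _ j refl e ep lj with ih (par< l) (fixed-F ep) r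
        (≤-trans r≤ (≤-reflexive (rk-inner e)))
    ... | p′ , pl , pf , ple , pre with same-child l e ep lj pl pf (sym ple)
    ... | i′ , l′ , pr , st′ , ix , le = suc i′ , l′ , fixed-F st′ , le ,
        trans (rk-inner st′) (trans (cong rk pr) pre)

-- Centers: the fixed vertices at odd levels.

isOdd : ℕ → Bool
isOdd zero = false
isOdd (suc i) = not (isOdd i)

module Centers {m′ D : ℕ} (T : Rooted (suc m′) D) (h′ : ℕ) (dec : Decomposition T (suc h′)) where
  open Rooted T
  open Decomposition dec
  open Labels T h′ dec

  odd : ℕ → Bool
  odd v = isOdd (level (st v))

  -- Parity makes the centers independent. As the last level `h′` is even, every center has all its
  -- children inside its component, and a center other than vertex 0 also has its parent there.
  center : ℕ → Bool
  center v = fixed v ∧ odd v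

  private
    free : ℕ → Bool
    free v = not (fixed v)
    even-inner : ℕ → Bool
    even-inner u = rootless u ∧ (fixed u ∧ not (odd u))
      where
      rootless : ℕ → Bool
      rootless zero = false
      rootless (suc i) = not (isF0 (st (suc i)))

  children≤D : ∀ v → # m (child v) ≤ D
  children≤D v = ≤-trans (#-inj m D idx (λ { (suc i) l c → idx< i l , refl }) inj)
      (≤-reflexive (#-all D {λ _ → true} (λ _ _ → refl)))
    where
    inj : ∀ i j → i < m → j < m → child v i ≡ true → child v j ≡ true → idx i ≡ idx j → i ≡ j
    inj (suc i) (suc j) l l′ c c′ e = cong suc (idx-inj i j l l′ (trans (eqb-≡ c) (sym (eqb-≡ c′))) e)

  -- The parent of a component root is a free vertex of state `C`, which designates only one child.
  roots≤free : # m rootᵇ ≤ # m free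
  roots≤free = #-inj m m par (λ { (suc i) l c → par< l ,
      not-false (cong isF (proj₁ (trans-F0 h (st (par (suc i))) _ (trans (sym (st-suc i)) (isF0-≡ c))))) }) inj
    where
    inj : ∀ i j → i < m → j < m → rootᵇ i ≡ true → rootᵇ j ≡ true → par i ≡ par j → i ≡ j
    inj (suc i) (suc j) l l′ c c′ e =
        cong suc (idx-inj i j l l′ e (trans (at i c) (trans (cong des e) (sym (at j c′)))))
      where
      at : ∀ i → rootᵇ (suc i) ≡ true → idx (suc i) ≡ des (par (suc i))
      at i c = eqb-≡ (proj₂ (trans-F0 h (st (par (suc i))) _ (trans (sym (st-suc i)) (isF0-≡ c))))

  even-inner≤ : # m even-inner ≤ D * # m center
  even-inner≤ = begin
    # m even-inner                                              ≤⟨ ∑-mono m step ⟩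
    ∑ m (λ u → ∑ m (λ v → ⟦ center v ∧ child v u ⟧))            ≡⟨ ∑-swap m m (λ u v → ⟦ center v ∧ child v u ⟧) ⟩
    ∑ m (λ v → # m (λ u → center v ∧ child v u))                ≤⟨ ∑-mono m (λ v _ → row v) ⟩
    ∑ m (λ v → D * ⟦ center v ⟧)                                ≡⟨ ∑-* m D _ ⟩
    D * # m center                                              ∎
    where
    open ≤-Reasoning
    row : ∀ v → # m (λ u → center v ∧ child v u) ≤ D * ⟦ center v ⟧
    row v with center v
    ... | true = ≤-trans (children≤D v) (≤-reflexive (sym (*-identityʳ D)))
    ... | false = ≤-trans (≤-reflexive (∑-0 m)) z≤n
    step : ∀ u → u < m → ⟦ even-inner u ⟧ ≤ ∑ m (λ v → ⟦ center v ∧ child v u ⟧)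
    step zero _ = z≤n
    step (suc i) l with bool-cases (even-inner (suc i))
    ... | inj₂ e = ≤-trans (≤-reflexive (cong ⟦_⟧ e)) z≤n
    ... | inj₁ e = ≤-trans (⟦⟧≤1 _)
        (≤-trans (≤-reflexive (sym (⟦⟧-true (∧-intro par-center (eqb-refl (par (suc i)))))))
                     (∑-pick m (λ v → ⟦ center v ∧ child v (suc i) ⟧) (par (suc i)) (par< l)))
      where
      e₁ = ∧-elim {not (isF0 (st (suc i)))} e
      e₂ = ∧-elim {fixed (suc i)} (proj₂ e₁)
      par-center : center (par (suc i)) ≡ true
      par-center with kind (suc i) (proj₁ e₂)
      ... | root _ refl e′ = true≢false (cong isF0 e′) (not-true (proj₁ e₁))
      ... | inner _ j refl e′ ep _ = ∧-intro (fixed-F ep)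
          (lem (subst (λ s → not (isOdd (level s)) ≡ true) e′ (proj₂ e₂)))
        where
        lem : not (not (isOdd j)) ≡ true → isOdd (level (st (par (suc i)))) ≡ true
        lem h rewrite ep with isOdd j
        ... | true = refl

  -- A fixed vertex at an even level is a component root, or vertex 0, or one of the at most `D`
  -- children of a center.
  many-centers : m ≤ suc D * # m center + 2 * # m free + 1
  many-centers = begin
    m                                                           ≡⟨ sym (#-not m fixed) ⟩
    # m fixed + # m free                                        ≤⟨ +-monoˡ-≤ (# m free) split ⟩
    # m center + (# m even-inner + (# m rootᵇ + 1)) + # m free  ≤⟨
        +-monoˡ-≤ (# m free) (+-monoʳ-≤ (# m center) (+-mono-≤ even-inner≤ (+-monoˡ-≤ 1 roots≤free))) ⟩
    # m center + (D * # m center + (# m free + 1)) + # m free   ≡⟨ e D (# m center) (# m free) ⟩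
    suc D * # m center + 2 * # m free + 1                       ∎
    where
    open ≤-Reasoning
    e : ∀ D z f → z + (D * z + (f + 1)) + f ≡ suc D * z + 2 * f + 1
    e = solve-∀
    pt : ∀ v → v < m → ⟦ fixed v ⟧ ≤ ⟦ center v ⟧ + (⟦ even-inner v ⟧ + (⟦ rootᵇ v ⟧ + ⟦ eqb 0 v ⟧))
    pt zero l = ≤-trans (⟦⟧≤1 _) (≤-trans (≤-reflexive (sym (⟦⟧-true (eqb-refl 0))))
        (≤-trans (m≤n+m _ 0) (m≤n+m _ ⟦ center 0 ⟧)))
    pt (suc i) l with st (suc i)
    ... | F zero = m≤m+n 1 _
    ... | F (suc j) with isOdd (suc j)
    ... | true = s≤s z≤n
    ... | false = s≤s z≤n
    pt (suc i) l | X = z≤n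
    pt (suc i) l | Y = z≤n
    pt (suc i) l | C = z≤n
    split : # m fixed ≤ # m center + (# m even-inner + (# m rootᵇ + 1))
    split = ≤-trans (∑-mono m pt) (≤-reflexive
        (trans (∑-+ m _ _) (cong (# m center +_) (trans (∑-+ m _ _) (cong (# m even-inner +_)
      (trans (∑-+ m _ _) (cong (# m rootᵇ +_) (#-point m 0 (s≤s z≤n)))))))))

-- Embedding the components and the free vertices.

div-mod-+ : ∀ N b q .{{_ : NonZero N}} → q < N → ((b * N + q) / N ≡ b) × ((b * N + q) % N ≡ q)
div-mod-+ N b q l with div-unique N ((b * N + q) / N) b ((b * N + q) % N) q (m%n<n (b * N + q) N) l
    (trans (+-comm ((b * N + q) / N * N) _) (sym (m≡m%n+[m/n]*n (b * N + q) N)))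
... | p , r = p , r

m*[n/m]≤n : ∀ N x .{{_ : NonZero N}} → N * (x / N) ≤ x
m*[n/m]≤n N x = ≤-trans (≤-reflexive (*-comm N (x / N))) (m/n*n≤m x N)

quot : ℕ → ℕ → ℕ
quot zero x = 0
quot (suc d) x = x / suc d

quot-div : ∀ D ℓ j → j < D → quot D (ℓ * D + j) ≡ ℓ
quot-div (suc d) ℓ j l = proj₁ (div-mod-+ (suc d) ℓ j l)

module Placement {m′ D : ℕ} (T : Rooted (suc m′) D) (h′ : ℕ) (dec : Decomposition T (suc h′))
    (h′-even : isOdd h′ ≡ false)
  {n c M N′ : ℕ} {E : ℕ → ℕ → Bool} (E-sym : ∀ u v → E u v ≡ E v u) (V : ℕ → ℕ → ℕ)
  (V-bound : ∀ {j i} → j < M → i < suc (suc N′) → V j i < n)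
  (V-inj : ∀ {j i j′ i′} → j < M → i < suc (suc N′) → j′ < M → i′ < suc (suc N′) → V j i ≡ V j′ i′ →
      (j ≡ j′) × (i ≡ i′))
  (stars : ∀ {a} → a < M → (L : ℕ → ℕ) → (∀ i → L i < M) → Star n (suc (suc N′)) c D E V a L)
  (s : ℕ) (room : suc m′ + (s + label-count D h′) * suc (suc N′) ≤ M * suc (suc N′)) where
  open Rooted T
  open Decomposition dec
  open Labels T h′ dec
  open Centers T h′ dec
  N = suc (suc N′)
  private
    L₀ = label-count D h′

  class : ℕ → ℕ
  class ℓ = # m (λ v → fixed v ∧ eqb (lab v) ℓ)

  -- Each label gets a run of consecutive parts after the first `s`, which are kept for the free
  -- vertices. The `+ 1` for rounding up sums to the `label-count D h′` parts set aside in the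
  -- hypothesis `room`.
  offset : ℕ → ℕ
  offset ℓ = s + ∑ ℓ (λ i → class i / N + 1)

  classes : ∑ L₀ class ≤ m
  classes = ≤-trans (≤-reflexive (∑-swap L₀ m (λ ℓ v → ⟦ fixed v ∧ eqb (lab v) ℓ ⟧)))
    (≤-trans (∑-mono m (λ v _ → #-unique L₀ _ λ a b _ _ x y → trans (sym (eqb-≡ (proj₂ (∧-elim {fixed v} x))))
        (eqb-≡ (proj₂ (∧-elim {fixed v} y)))))
      (≤-reflexive (trans (∑-const m 1) (*-identityʳ m))))

  offset-room : offset L₀ ≤ M
  offset-room = *-cancelʳ-≤ (offset L₀) M N
      (linear 1 0 (+-mono-≤ room (≤-trans (≤-trans (≤-reflexive (sym (∑-* L₀ N _)))
      (∑-mono L₀ (λ i _ → m*[n/m]≤n N (class i)))) classes))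
    (trans (cong (λ z → 1 * ((s + z) * N) + (M * N + m) + 0)
        (trans (∑-+ L₀ _ _) (cong (∑ L₀ (λ i → class i / N) +_) (trans (∑-const L₀ 1) (*-identityʳ L₀)))))
      (e s (∑ L₀ (λ i → class i / N)) L₀ N M m)))
    where
    e : ∀ s q l N M m → 1 * ((s + (q + l)) * N) + (M * N + m) + 0 ≡ 1 * (M * N) + (m + (s + l) * N + N * q)
    e = solve-∀

  blk : ℕ → ℕ
  blk v = rk v / N

  part : ℕ → ℕ
  part v = offset (lab v) + blk v

  rank<class : ∀ v → v < m → fixed v ≡ true → rk v < class (lab v)
  rank<class v l fx = ≤-trans (≤-reflexive (sym (#-all (suc (rk v)) {λ _ → true} (λ _ _ → refl))))
    (#-key (suc (rk v)) m rk λ r rl _ → let w = lower-rank v l fx r (≤-pred rl) in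
      proj₁ w , proj₁ (proj₂ w) , ∧-intro (proj₁ (proj₂ (proj₂ w))) (≡-eqb (proj₁ (proj₂ (proj₂ (proj₂ w))))) ,
          proj₂ (proj₂ (proj₂ (proj₂ w))))

  blk< : ∀ v → v < m → fixed v ≡ true → blk v < class (lab v) / N + 1
  blk< v l fx = ≤-trans (s≤s (/-monoˡ-≤ N (<⇒≤ (rank<class v l fx)))) (≤-reflexive (+-comm 1 _))

  offset-next : ∀ {ℓ ℓ′ b} → ℓ < ℓ′ → b < class ℓ / N + 1 → offset ℓ + b < offset ℓ′
  offset-next {ℓ} {ℓ′} {b} l bl =
      ≤-trans (+-monoʳ-< (offset ℓ) bl)
      (≤-trans (≤-reflexive (+-assoc s _ _)) (+-monoʳ-≤ s (∑-mono-≤ (λ i → class i / N + 1) l)))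

  part< : ∀ v → v < m → fixed v ≡ true → part v < M
  part< v l fx = ≤-trans (offset-next (lab< v l fx) (blk< v l fx)) offset-room

  s≤part : ∀ v → s ≤ part v
  s≤part v = ≤-trans (m≤m+n s _) (m≤m+n _ _)

  part-inj : ∀ v v′ → v < m → v′ < m → fixed v ≡ true → fixed v′ ≡ true → part v ≡ part v′ →
      (lab v ≡ lab v′) × (blk v ≡ blk v′)
  part-inj v v′ l l′ fx fx′ e = go (<-cmp (lab v) (lab v′))
    where
    go : Tri (lab v < lab v′) (lab v ≡ lab v′) (lab v′ < lab v) → (lab v ≡ lab v′) × (blk v ≡ blk v′)
    go (tri< a _ _) = ⊥-elim (<-irrefl e (≤-trans (offset-next a (blk< v l fx)) (m≤m+n _ _)))
    go (tri> _ _ a) = ⊥-elim (<-irrefl (sym e) (≤-trans (offset-next a (blk< v′ l′ fx′)) (m≤m+n _ _)))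
    go (tri≈ _ a _) = a , +-cancelˡ-≡ (offset (lab v)) _ _ (trans e (cong (λ z → offset z + blk v′) (sym a)))

  fixed-top : fixed 0 ≡ true
  fixed-top = cong isF st-root

  M>0 : 0 < M
  M>0 = ≤-trans (s≤s z≤n) (part< 0 (s≤s z≤n) fixed-top)

  -- Stars are requested for every label and block, also for those that do not occur; on parts that
  -- occur this is the identity.
  clamp : ℕ → ℕ
  clamp x = if ltb x M then x else 0

  clamp< : ∀ x → clamp x < M
  clamp< x with bool-cases (ltb x M)
  ... | inj₁ e rewrite e = leb-≤ e
  ... | inj₂ e rewrite e = M>0

  clamp-id : ∀ {x} → x < M → clamp x ≡ x
  clamp-id l rewrite ≤-leb l = refl

  child-label : ℕ → ℕ → ℕ
  child-label ℓ j = suc K + (ℓ * D + j)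

  parent-label : ℕ → ℕ
  parent-label ℓ = quot D (ℓ ∸ suc K)

  parent-child : ∀ ℓ j → j < D → parent-label (child-label ℓ j) ≡ ℓ
  parent-child ℓ j l = trans (cong (quot D) (m+n∸m≡n (suc K) _)) (quot-div D ℓ j l)

  -- All vertices of a component share its rank, hence the block number: parent and children of a
  -- vertex in block `b` lie in block `b` of their own labels.
  leaf : ℕ → ℕ → ℕ → ℕ
  leaf ℓ b zero = clamp (offset (parent-label ℓ) + b)
  leaf ℓ b (suc j) = clamp (offset (child-label ℓ j) + b)

  leaf< : ∀ ℓ b i → leaf ℓ b i < M
  leaf< ℓ b zero = clamp< _
  leaf< ℓ b (suc j) = clamp< _

  star-at : ∀ ℓ b → Star n N c D E V (clamp (offset ℓ + b)) (leaf ℓ b)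
  star-at ℓ b = stars (clamp< _) (leaf ℓ b) (leaf< ℓ b)

  perm-at : ℕ → ℕ → ℕ → Perm N
  perm-at ℓ b = Star.perm (star-at ℓ b)

  -- Position of a child (label ℓ, index j, at an odd level iff o) of a vertex with label ℓp at position x of block b.
  move move⁻ : (ℓ ℓp j b : ℕ) (o : Bool) → ℕ → ℕ
  move ℓ ℓp j b true x = from (perm-at ℓ b 0) x
  move ℓ ℓp j b false x = to (perm-at ℓp b (suc j)) x
  move⁻ ℓ ℓp j b true x = to (perm-at ℓ b 0) x
  move⁻ ℓ ℓp j b false x = from (perm-at ℓp b (suc j)) x

  move-move⁻ : ∀ ℓ ℓp j b o x → move ℓ ℓp j b o (move⁻ ℓ ℓp j b o x) ≡ x
  move-move⁻ ℓ ℓp j b true x = from-to (perm-at ℓ b 0) x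
  move-move⁻ ℓ ℓp j b false x = to-from (perm-at ℓp b (suc j)) x

  move-inj : ∀ ℓ ℓp j b o {x y} → move ℓ ℓp j b o x ≡ move ℓ ℓp j b o y → x ≡ y
  move-inj ℓ ℓp j b true e = from-inj (perm-at ℓ b 0) e
  move-inj ℓ ℓp j b false e = to-inj (perm-at ℓp b (suc j)) e

  move< : ∀ ℓ ℓp j b o {x} → x < N → move ℓ ℓp j b o x < N
  move< ℓ ℓp j b true l = from< (perm-at ℓ b 0) l
  move< ℓ ℓp j b false l = to< (perm-at ℓp b (suc j)) l

  move⁻< : ∀ ℓ ℓp j b o {x} → x < N → move⁻ ℓ ℓp j b o x < N
  move⁻< ℓ ℓp j b true l = to< (perm-at ℓ b 0) l
  move⁻< ℓ ℓp j b false l = from< (perm-at ℓp b (suc j)) l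

  pos-step : ℕ → ℕ → ℕ
  pos-step u x = if isF0 (st u) then rk u % N else move (lab u) (lab (par u)) (idx u) (blk u) (odd u) x

  abstract
    pos : ℕ → ℕ
    pos = rec 0 pos-step

    pos-top : pos 0 ≡ 0
    pos-top = refl

    pos-root : ∀ {i} → st (suc i) ≡ F 0 → pos (suc i) ≡ rk (suc i) % N
    pos-root {i} e = trans (rec-suc 0 pos-step i)
        (cong (λ s → if isF0 s then rk (suc i) % N else move (lab (suc i)) (lab (par (suc i))) (idx (suc i))
        (blk (suc i)) (odd (suc i)) (pos (par (suc i)))) e)

    pos-inner : ∀ {i j} → st (suc i) ≡ F (suc j) → pos (suc i) ≡ move (lab (suc i)) (lab (par (suc i)))
        (idx (suc i)) (blk (suc i)) (isOdd (suc j)) (pos (par (suc i)))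
    pos-inner {i} e = trans (rec-suc 0 pos-step i) (trans
      (cong (λ s → if isF0 s then rk (suc i) % N else move (lab (suc i)) (lab (par (suc i))) (idx (suc i))
          (blk (suc i)) (odd (suc i)) (pos (par (suc i)))) e)
      (cong (λ s → move (lab (suc i)) (lab (par (suc i))) (idx (suc i)) (blk (suc i)) (isOdd (level s))
          (pos (par (suc i)))) e))

  pos< : ∀ v → v < m → fixed v ≡ true → pos v < N
  pos< = tree-induction P (λ _ _ → subst (_< N) (sym pos-top) (s≤s z≤n)) stp
    where
    P : ℕ → Set
    P v = v < m → fixed v ≡ true → pos v < N
    stp : ∀ i → P (par (suc i)) → P (suc i)
    stp i ih l fx with kind (suc i) fx
    ... | root _ refl e = subst (_< N) (sym (pos-root e)) (m%n<n (rk (suc i)) N)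
    ... | inner _ j refl e ep _ = subst (_< N) (sym (pos-inner e))
        (move< _ (lab (par (suc i))) _ _ (isOdd (suc j)) (ih (par< l) (fixed-F ep)))

  image : ℕ → ℕ
  image v = V (part v) (pos v)

  image< : ∀ v → v < m → fixed v ≡ true → image v < n
  image< v l fx = V-bound (part< v l fx) (pos< v l fx)

  child-part : ∀ {i j} → suc i < m → st (suc i) ≡ F (suc j) → st (par (suc i)) ≡ F j →
    clamp (offset (child-label (lab (par (suc i))) (idx (suc i))) + blk (par (suc i))) ≡ part (suc i)
  child-part {i} l e ep = trans (cong₂ (λ a b → clamp (offset a + b / N)) (sym (lab-inner e))
      (sym (rk-inner e))) (clamp-id (part< (suc i) l (fixed-F e)))

  parent-part : ∀ {i j} → suc i < m → st (suc i) ≡ F (suc j) → st (par (suc i)) ≡ F j →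
    clamp (offset (parent-label (lab (suc i))) + blk (suc i)) ≡ part (par (suc i))
  parent-part {i} l e ep = trans (cong₂ (λ a b → clamp (offset a + b / N))
      (trans (cong parent-label (lab-inner e)) (parent-child (lab (par (suc i))) (idx (suc i)) (idx< i l)))
      (rk-inner e))
    (clamp-id (part< (par (suc i)) (par< l) (fixed-F ep)))

  own-part : ∀ v → v < m → fixed v ≡ true → clamp (offset (lab v) + blk v) ≡ part v
  own-part v l fx = clamp-id (part< v l fx)

  leaf-child : ∀ {i j} → suc i < m → st (suc i) ≡ F (suc j) → st (par (suc i)) ≡ F j → isOdd j ≡ true →
    let p = par (suc i) in image (suc i) ≡ V (leaf (lab p) (blk p) (suc (idx (suc i)))) (to (perm-at (lab p) (blk p) (suc (idx (suc i)))) (pos p))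
  leaf-child {i} {j} l e ep o = cong₂ V (sym (child-part l e ep)) (trans (pos-inner e)
    (trans (cong (λ b → move (lab (suc i)) (lab (par (suc i))) (idx (suc i)) (blk (suc i)) (not b)
        (pos (par (suc i)))) o)
      (cong (λ b → to (perm-at (lab (par (suc i))) (b / N) (suc (idx (suc i)))) (pos (par (suc i)))) (rk-inner e))))

  leaf-parent : ∀ {i j} → suc i < m → st (suc i) ≡ F (suc j) → st (par (suc i)) ≡ F j → isOdd (suc j) ≡ true →
    let v = suc i in image (par v) ≡ V (leaf (lab v) (blk v) 0) (to (perm-at (lab v) (blk v) 0) (pos v))
  leaf-parent {i} {j} l e ep o = cong₂ V (sym (parent-part l e ep))
      (sym (trans (cong (to (perm-at (lab (suc i)) (blk (suc i)) 0))
    (trans (pos-inner e) (cong (λ b → move (lab (suc i)) (lab (par (suc i))) (idx (suc i)) (blk (suc i)) b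
        (pos (par (suc i)))) o)))
      (to-from (perm-at (lab (suc i)) (blk (suc i)) 0) _)))

  star-image : ∀ v → v < m → fixed v ≡ true → image v ≡ V (clamp (offset (lab v) + blk v)) (pos v)
  star-image v l fx = cong (λ a → V a (pos v)) (sym (own-part v l fx))

  image-edge : ∀ i → suc i < m → fixed (suc i) ≡ true → fixed (par (suc i)) ≡ true →
      E (image (par (suc i))) (image (suc i)) ≡ true
  image-edge i l fx fp with kind (suc i) fx
  ... | root _ refl e = true≢false fp (cong isF (proj₁ (trans-F0 h (st (par (suc i))) _ (trans (sym (st-suc i)) e))))
  ... | inner _ j refl e ep _ with bool-cases (isOdd j)
  ... | inj₁ o = trans (cong₂ E (star-image (par (suc i)) (par< l) fp) (leaf-child l e ep o))
        (Star.edge (star-at (lab (par (suc i))) (blk (par (suc i)))) (suc (idx (suc i))) (s≤s (idx< i l))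
            (pos (par (suc i))) (pos< _ (par< l) fp))
  ... | inj₂ o = trans (E-sym _ _) (trans (cong₂ E (star-image (suc i) l fx) (leaf-parent l e ep (not-false o)))
        (Star.edge (star-at (lab (suc i)) (blk (suc i))) 0 (s≤s z≤n) (pos (suc i)) (pos< _ l fx)))

  rank-split : ∀ {v v′} → blk v ≡ blk v′ → rk v % N ≡ rk v′ % N → rk v ≡ rk v′
  rank-split {v} {v′} e e′ = trans (m≡m%n+[m/n]*n (rk v) N)
      (trans (cong₂ (λ a b → a + b * N) e′ e) (sym (m≡m%n+[m/n]*n (rk v′) N)))

  -- A move depends only on label, index, block and parity, and it is injective; equal positions
  -- therefore lift to the component roots, where the position is the rank modulo `N`.
  same-pos : ∀ v v′ → v < m → v′ < m → fixed v ≡ true → fixed v′ ≡ true → lab v ≡ lab v′ → blk v ≡ blk v′ →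
      pos v ≡ pos v′ → rk v % N ≡ rk v′ % N
  same-pos = tree-induction P base stp
    where
    P : ℕ → Set
    P v = ∀ v′ → v < m → v′ < m → fixed v ≡ true → fixed v′ ≡ true → lab v ≡ lab v′ → blk v ≡ blk v′ →
        pos v ≡ pos v′ → rk v % N ≡ rk v′ % N
    base : P 0
    base v′ _ l _ fx e _ _ with kind v′ fx
    ... | top refl = refl
    ... | root i refl e′ = ⊥-elim (<-irrefl (trans (sym e) lab-top) (lab-root< e′))
    ... | inner i j refl e′ _ _ = ⊥-elim (<-irrefl (trans (sym lab-top) e) (lab-inner> e′))
    stp : ∀ i → P (par (suc i)) → P (suc i)
    stp i ih v′ l l′ fx fx′ eq eb epos with kind (suc i) fx | kind v′ fx′
    ... | root _ refl e | top refl = ⊥-elim (<-irrefl (trans eq lab-top) (lab-root< e))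
    ... | root _ refl e | root i′ refl e′ = trans (sym (pos-root e)) (trans epos (pos-root e′))
    ... | root _ refl e | inner i′ j refl e′ _ _ =
        ⊥-elim (<-asym (lab-root< e) (subst (K <_) (sym eq) (lab-inner> e′)))
    ... | inner _ j refl e _ _ | top refl = ⊥-elim (<-irrefl (sym (trans eq lab-top)) (lab-inner> e))
    ... | inner _ j refl e _ _ | root i′ refl e′ = ⊥-elim (<-asym (lab-root< e′) (subst (K <_) eq (lab-inner> e)))
    ... | inner _ j refl e ep _ | inner i′ j′ refl e′ ep′ _ = trans (cong (_% N) (rk-inner e)) (trans
          (ih (par (suc i′)) (par< l) (par< l′) (fixed-F ep) (fixed-F ep′) (proj₁ eqs)
              (trans (cong (_/ N) (sym (rk-inner e))) (trans eb (cong (_/ N) (rk-inner e′)))) pp)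
          (cong (_% N) (sym (rk-inner e′))))
      where
      eqs = inner-lab-eq l l′ e e′ eq
      stt = proj₁ (same-label (suc i) (suc i′) l l′ fx fx′ eq)
      F-inj : ∀ {a b} → F a ≡ F b → a ≡ b
      F-inj refl = refl
      jj : suc j ≡ suc j′
      jj = F-inj (trans (sym e) (trans stt e′))
      pp : pos (par (suc i)) ≡ pos (par (suc i′))
      pp = move-inj (lab (suc i)) (lab (par (suc i))) (idx (suc i)) (blk (suc i)) (isOdd (suc j))
        (trans (sym (pos-inner e)) (trans epos (trans (pos-inner e′)
          (trans (cong₂ (λ a b → move a b (idx (suc i′)) (blk (suc i′)) (isOdd (suc j′)) (pos (par (suc i′))))
              (sym eq) (sym (proj₁ eqs)))
          (trans (cong₂ (λ a b → move (lab (suc i)) (lab (par (suc i))) a b (isOdd (suc j′))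
              (pos (par (suc i′)))) (sym (proj₂ eqs)) (sym eb))
            (cong (λ a → move (lab (suc i)) (lab (par (suc i))) (idx (suc i)) (blk (suc i)) (isOdd a)
                (pos (par (suc i′)))) (sym jj)))))))

  image-inj : ∀ v v′ → v < m → v′ < m → fixed v ≡ true → fixed v′ ≡ true → image v ≡ image v′ → v ≡ v′
  image-inj v v′ l l′ fx fx′ e = label-rank v v′ l l′ fx fx′ (proj₁ lb)
      (rank-split {v} {v′} (proj₂ lb) (same-pos v v′ l l′ fx fx′ (proj₁ lb) (proj₂ lb) (proj₂ pq)))
    where
    pq = V-inj (part< v l fx) (pos< v l fx) (part< v′ l′ fx′) (pos< v′ l′ fx′) e
    lb = part-inj v v′ l l′ fx fx′ (proj₁ pq)

  -- Ranks are initial segments, so the block of v is full once its last rank occurs.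
  full-block : ∀ v → v < m → fixed v ≡ true → suc (rk v % N) ≡ N → ∀ q → q < N →
    Σ ℕ λ v′ → v′ < m × fixed v′ ≡ true × lab v′ ≡ lab v × blk v′ ≡ blk v × pos v′ ≡ q
  full-block = tree-induction P base stp
    where
    P : ℕ → Set
    P v = v < m → fixed v ≡ true → suc (rk v % N) ≡ N → ∀ q → q < N → Σ ℕ λ v′ →
        v′ < m × fixed v′ ≡ true × lab v′ ≡ lab v × blk v′ ≡ blk v × pos v′ ≡ q
    base : P 0
    -- Vertex 0 has rank 0, which is not the last of a block because `N ≥ 2`.
    base _ _ e = ⊥-elim (0≢1+n (suc-injective (trans (cong (λ r → suc (r % N)) (sym rk-top)) e)))
    stp : ∀ i → P (par (suc i)) → P (suc i)
    stp i ih l fx last q q< with kind (suc i) fx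
    ... | root _ refl e = suc (proj₁ w) , proj₁ (proj₂ w) , fixed-F (proj₁ (proj₂ (proj₂ w))) ,
        proj₁ (proj₂ (proj₂ (proj₂ w))) ,
          trans (cong (_/ N) rr) (proj₁ dm) , trans (pos-root (proj₁ (proj₂ (proj₂ w))))
              (trans (cong (_% N) rr) (proj₂ dm))
      where
      dm = div-mod-+ N (blk (suc i)) q q<
      w = lower-rank-root {i} {blk (suc i) * N + q} l e
          (≤-trans (+-monoʳ-≤ _ (≤-pred (≤-trans q< (≤-reflexive (sym last)))))
            (≤-reflexive (trans (+-comm _ (rk (suc i) % N)) (sym (m≡m%n+[m/n]*n (rk (suc i)) N)))))
      rr = proj₂ (proj₂ (proj₂ (proj₂ w)))
    ... | inner _ j refl e ep lj = suc i′ , l′ , fixed-F st′ , le , be ,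
          trans (pos-inner st′) (trans (cong₂
              (λ a b → move a b (idx (suc i′)) (blk (suc i′)) (isOdd (suc j)) (pos (par (suc i′)))) le
              (trans (cong lab pr) (proj₁ (proj₂ (proj₂ w)))))
            (trans (cong₂ (λ a b → move (lab (suc i)) (lab (par (suc i))) a b (isOdd (suc j))
                (pos (par (suc i′)))) ix be)
              (trans (cong (move (lab (suc i)) (lab (par (suc i))) (idx (suc i)) (blk (suc i)) (isOdd (suc j)))
                  (trans (cong pos pr) (proj₂ (proj₂ (proj₂ (proj₂ w))))))
                (move-move⁻ (lab (suc i)) (lab (par (suc i))) (idx (suc i)) (blk (suc i)) (isOdd (suc j)) q))))
      where
      W = ih (par< l) (fixed-F ep) (trans (cong (λ r → suc (r % N)) (sym (rk-inner e))) last)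
            (move⁻ (lab (suc i)) (lab (par (suc i))) (idx (suc i)) (blk (suc i)) (isOdd (suc j)) q)
            (move⁻< (lab (suc i)) (lab (par (suc i))) (idx (suc i)) (blk (suc i)) (isOdd (suc j)) q<)
      p′ = proj₁ W
      w = proj₂ W
      ch = same-child l e ep lj (proj₁ w) (proj₁ (proj₂ w)) (sym (proj₁ (proj₂ (proj₂ w))))
      i′ = proj₁ ch
      l′ = proj₁ (proj₂ ch)
      pr = proj₁ (proj₂ (proj₂ ch))
      st′ = proj₁ (proj₂ (proj₂ (proj₂ ch)))
      ix = proj₁ (proj₂ (proj₂ (proj₂ (proj₂ ch))))
      le = proj₂ (proj₂ (proj₂ (proj₂ (proj₂ ch))))
      be : blk (suc i′) ≡ blk (suc i)
      be = trans (cong (_/ N) (trans (rk-inner st′) (cong rk pr)))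
          (trans (proj₁ (proj₂ (proj₂ (proj₂ w)))) (cong (_/ N) (sym (rk-inner e))))

  good-at : ℕ → ℕ → ℕ → ℕ → ℕ → Bool
  good-at ℓ b u w q = E u (V (clamp (offset ℓ + b)) q) ∧ allᵇ (suc D)
      (λ i → E w (V (leaf ℓ b i) (to (perm-at ℓ b i) q)))

  -- Such a `v` can give up its image to a new leaf attached at `u` and move to the vertex `w` of
  -- the host.
  absorber : ℕ → ℕ → ℕ → Bool
  absorber u w v = center v ∧ good-at (lab v) (blk v) u w (pos v)

  -- One representative for each full block of centers.
  last : ℕ → Bool
  last v = center v ∧ eqb (suc (rk v % N)) N

  same-block : ℕ → ℕ → Bool
  same-block v z = eqb (lab z) (lab v) ∧ eqb (blk z) (blk v)

  center-type : ∀ {v v′} → v < m → v′ < m → center v ≡ true → fixed v′ ≡ true → lab v′ ≡ lab v → center v′ ≡ true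
  center-type {v} {v′} l l′ c fx e with ∧-elim {fixed v} c
  ... | f , o = ∧-intro fx (trans (cong (isOdd ∘ level) (proj₁ (same-label v′ v l′ l fx f e))) o)

  block-hits : ∀ {u w} → u < n → w < n → ∀ v → v < m → last v ≡ true →
      N ≤ c * # m (λ z → absorber u w z ∧ same-block v z)
  block-hits {u} {w} u< w< v l e with ∧-elim {center v} e
  ... | cv , lst = ≤-trans (Star.many (star-at (lab v) (blk v)) u w u< w<)
      (*-monoʳ-≤ c (#-key N m {good-at (lab v) (blk v) u w} pos λ q q< g →
        let z = full-block v l (proj₁ (∧-elim {fixed v} cv)) (eqb-≡ lst) q q<
            zl = proj₁ (proj₂ z)
            fz = proj₁ (proj₂ (proj₂ z))
            le = proj₁ (proj₂ (proj₂ (proj₂ z)))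
            be = proj₁ (proj₂ (proj₂ (proj₂ (proj₂ z))))
            qe = proj₂ (proj₂ (proj₂ (proj₂ (proj₂ z))))
        in proj₁ z , zl , ∧-intro (∧-intro (center-type l zl cv fz le)
             (trans (cong₂ (λ a b → good-at a b u w (pos (proj₁ z))) le be)
                 (trans (cong (good-at (lab v) (blk v) u w) qe) g)))
             (∧-intro (≡-eqb le) (≡-eqb be)) , qe))

  -- By `many`, each full block contains at least `N / c` absorbers, and label and block number keep
  -- the contributions of different representatives apart.
  hits : ∀ {u w} → u < n → w < n → N * # m last ≤ c * # m (absorber u w)
  hits {u} {w} u< w< = begin
    N * # m last                                                          ≡⟨ sym (∑-* m N _) ⟩
    ∑ m (λ v → N * ⟦ last v ⟧)                                            ≤⟨ ∑-mono m row ⟩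
    ∑ m (λ v → c * # m (λ z → last v ∧ (absorber u w z ∧ same-block v z))) ≡⟨
        trans (∑-* m c _) (cong (c *_) (∑-swap m m (λ v z → ⟦ last v ∧ (absorber u w z ∧ same-block v z) ⟧))) ⟩
    c * ∑ m (λ z → # m (λ v → last v ∧ (absorber u w z ∧ same-block v z))) ≤⟨ *-monoʳ-≤ c (∑-mono m (λ z _ → col z)) ⟩
    c * # m (absorber u w)                                                ∎
    where
    open ≤-Reasoning
    row : ∀ v → v < m → N * ⟦ last v ⟧ ≤ c * # m (λ z → last v ∧ (absorber u w z ∧ same-block v z))
    row v l with last v in e
    ... | true = ≤-trans (≤-reflexive (*-identityʳ N)) (block-hits u< w< v l e)
    ... | false = ≤-trans (≤-reflexive (*-zeroʳ N)) z≤n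
    col : ∀ z → # m (λ v → last v ∧ (absorber u w z ∧ same-block v z)) ≤ ⟦ absorber u w z ⟧
    col z with absorber u w z
    ... | false = ≤-reflexive (#-none m λ v _ → lem (last v))
      where
      lem : ∀ b → b ∧ false ≡ false
      lem true = refl
      lem false = refl
    ... | true = #-unique m _ λ v v′ l l′ e e′ →
          let lv = ∧-elim {last v} e ; lv′ = ∧-elim {last v′} e′
              cv = ∧-elim {center v} (proj₁ lv) ; cv′ = ∧-elim {center v′} (proj₁ lv′)
              sv = ∧-elim {eqb (lab z) (lab v)} (proj₂ lv) ; sv′ = ∧-elim {eqb (lab z) (lab v′)} (proj₂ lv′)
          in label-rank v v′ l l′ (proj₁ (∧-elim {fixed v} (proj₁ cv))) (proj₁ (∧-elim {fixed v′} (proj₁ cv′)))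
               (trans (sym (eqb-≡ (proj₁ sv))) (eqb-≡ (proj₁ sv′)))
               (rank-split {v} {v′} (trans (sym (eqb-≡ (proj₂ sv))) (eqb-≡ (proj₂ sv′)))
                 (suc-injective (trans (eqb-≡ (proj₂ cv)) (sym (eqb-≡ (proj₂ cv′))))))

  private
    cz : ℕ → ℕ
    cz ℓ = # m (λ v → center v ∧ eqb (lab v) ℓ)

  -- If all centers of label `ℓ` had rank below `r`, there would be at most `r` of them, as rank is
  -- injective on a label; from a center of rank at least `r` one descends by `lower-rank`.
  rank-exists : ∀ ℓ r → r < cz ℓ → Σ ℕ λ v → v < m × center v ≡ true × lab v ≡ ℓ × rk v ≡ r
  rank-exists ℓ r r< with search m (λ v → (center v ∧ eqb (lab v) ℓ) ∧ leb r (rk v))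
  ... | inj₁ (v , l , e) =
        let e₁ = ∧-elim {center v ∧ eqb (lab v) ℓ} e ; e₂ = ∧-elim {center v} (proj₁ e₁)
            w = lower-rank v l (proj₁ (∧-elim {fixed v} (proj₁ e₂))) r (leb-≤ (proj₂ e₁))
        in proj₁ w , proj₁ (proj₂ w) , center-type l (proj₁ (proj₂ w)) (proj₁ e₂) (proj₁ (proj₂ (proj₂ w)))
            (proj₁ (proj₂ (proj₂ (proj₂ w)))) ,
           trans (proj₁ (proj₂ (proj₂ (proj₂ w)))) (eqb-≡ (proj₂ e₂)) , proj₂ (proj₂ (proj₂ (proj₂ w)))
  ... | inj₂ none = ⊥-elim (<⇒≱ r< (≤-trans (#-inj m r {p = λ _ → true} rk
        (λ v l e → ≰⇒> (λ q → true≢false (∧-intro e (≤-leb q)) (none v l)) , refl)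
        (λ v v′ l l′ e e′ → label-rank v v′ l l′ (proj₁ (∧-elim {fixed v} (proj₁ (∧-elim {center v} e))))
            (proj₁ (∧-elim {fixed v′} (proj₁ (∧-elim {center v′} e′))))
            (trans (eqb-≡ (proj₂ (∧-elim {center v} e))) (sym (eqb-≡ (proj₂ (∧-elim {center v′} e′)))))))
        (#-≤ r _)))

  -- Each label has at most one incomplete block of centers.
  many-last : # m center ≤ N * # m last + L₀ * N
  many-last = begin
    # m center                                                    ≤⟨ ∑-mono m row ⟩
    ∑ m (λ v → # L₀ (λ ℓ → center v ∧ eqb (lab v) ℓ))             ≡⟨
        ∑-swap m L₀ (λ v ℓ → ⟦ center v ∧ eqb (lab v) ℓ ⟧) ⟩
    ∑ L₀ cz                                                       ≤⟨ ∑-mono L₀ (λ ℓ _ → per-label ℓ) ⟩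
    ∑ L₀ (λ ℓ → N * # m (λ v → last v ∧ eqb (lab v) ℓ) + N)       ≡⟨
        trans (∑-+ L₀ _ _) (cong₂ _+_ (trans (∑-* L₀ N _)
        (cong (N *_) (∑-swap L₀ m (λ ℓ v → ⟦ last v ∧ eqb (lab v) ℓ ⟧)))) (∑-const L₀ N)) ⟩
    N * ∑ m (λ v → # L₀ (λ ℓ → last v ∧ eqb (lab v) ℓ)) + L₀ * N  ≤⟨
        +-monoˡ-≤ (L₀ * N) (*-monoʳ-≤ N (∑-mono m (λ v _ → col v))) ⟩
    N * # m last + L₀ * N                                         ∎
    where
    open ≤-Reasoning
    row : ∀ v → v < m → ⟦ center v ⟧ ≤ # L₀ (λ ℓ → center v ∧ eqb (lab v) ℓ)
    row v l with bool-cases (center v)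
    ... | inj₂ e = ≤-trans (≤-reflexive (cong ⟦_⟧ e)) z≤n
    ... | inj₁ e = ≤-trans (⟦⟧≤1 _) (≤-trans (≤-reflexive (sym (⟦⟧-true (∧-intro e (eqb-refl (lab v))))))
                     (∑-pick L₀ (λ ℓ → ⟦ center v ∧ eqb (lab v) ℓ ⟧) (lab v) (lab< v l (proj₁ (∧-elim {fixed v} e)))))
    col : ∀ v → # L₀ (λ ℓ → last v ∧ eqb (lab v) ℓ) ≤ ⟦ last v ⟧
    col v with last v
    ... | true = #-unique L₀ _ λ a b _ _ x y → trans (sym (eqb-≡ x)) (eqb-≡ y)
    ... | false = ≤-reflexive (∑-0 L₀)
    per-label : ∀ ℓ → cz ℓ ≤ N * # m (λ v → last v ∧ eqb (lab v) ℓ) + N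
    per-label ℓ = begin
      cz ℓ                          ≡⟨ m≡m%n+[m/n]*n (cz ℓ) N ⟩
      cz ℓ % N + cz ℓ / N * N       ≤⟨ +-monoˡ-≤ (cz ℓ / N * N) (<⇒≤ (m%n<n (cz ℓ) N)) ⟩
      N + cz ℓ / N * N              ≡⟨ trans (+-comm N _) (cong (_+ N) (*-comm (cz ℓ / N) N)) ⟩
      N * (cz ℓ / N) + N            ≤⟨ +-monoˡ-≤ N (*-monoʳ-≤ N count-last) ⟩
      N * # m (λ v → last v ∧ eqb (lab v) ℓ) + N ∎
      where
      count-last : cz ℓ / N ≤ # m (λ v → last v ∧ eqb (lab v) ℓ)
      count-last = ≤-trans (≤-reflexive (sym (#-all (cz ℓ / N) {λ _ → true} (λ _ _ → refl))))
          (#-key (cz ℓ / N) m blk λ b b< _ →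
        let w = rank-exists ℓ (b * N + suc N′) (≤-trans (div-bound {cz ℓ / N} {N} b< ≤-refl) (m/n*n≤m (cz ℓ) N))
            dm = div-mod-+ N b (suc N′) ≤-refl
            rr = proj₂ (proj₂ (proj₂ (proj₂ w)))
        in proj₁ w , proj₁ (proj₂ w) , ∧-intro
            (∧-intro (proj₁ (proj₂ (proj₂ w))) (≡-eqb (cong suc (trans (cong (_% N) rr) (proj₂ dm)))))
             (≡-eqb (proj₁ (proj₂ (proj₂ (proj₂ w))))) , trans (cong (_/ N) rr) (proj₁ dm))

  absorber-center : ∀ {u w v} → v < m → absorber u w v ≡ true → E u (image v) ≡ true
  absorber-center {u} {w} {v} l e with ∧-elim {center v} e
  ... | cv , g = trans (cong (E u) (star-image v l (proj₁ (∧-elim {fixed v} cv))))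
      (proj₁ (∧-elim {E u (V (clamp (offset (lab v) + blk v)) (pos v))} g))

  private
    star-leaf : ∀ {u w v} → absorber u w v ≡ true → ∀ i → i < suc D →
        E w (V (leaf (lab v) (blk v) i) (to (perm-at (lab v) (blk v) i) (pos v))) ≡ true
    star-leaf {u} {w} {v} e = allᵇ-elim (suc D)
        (proj₂ (∧-elim {E u (V (clamp (offset (lab v) + blk v)) (pos v))} (proj₂ (∧-elim {center v} e))))

    odd-below : ∀ j → j < h → isOdd j ≡ true → suc j < h
    odd-below j l o with m≤n⇒m<n∨m≡n (≤-pred l)
    ... | inj₁ lt = s≤s lt
    ... | inj₂ refl = true≢false o h′-even

    fixed-level : ∀ {v} → fixed v ≡ true → Σ ℕ λ j → st v ≡ F j
    fixed-level {v} fx with st v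
    ... | F j = j , refl

  absorber-child : ∀ {u w} i → suc i < m → absorber u w (par (suc i)) ≡ true →
      (fixed (suc i) ≡ true) × (E w (image (suc i)) ≡ true)
  absorber-child {u} {w} i l e with ∧-elim {center (par (suc i))} e
  ... | cv , _ with ∧-elim {fixed (par (suc i))} cv
  ... | fv , ov with fixed-level {par (suc i)} fv
  ... | j , ep = fixed-F stc , trans (cong (E w) (leaf-child l stc ep oj))
      (star-leaf e (suc (idx (suc i))) (s≤s (idx< i l)))
    where
    oj : isOdd j ≡ true
    oj = trans (cong (isOdd ∘ level) (sym ep)) ov
    b = eqb (idx (suc i)) (des (par (suc i)))
    stc : st (suc i) ≡ F (suc j)
    stc = trans (st-suc i) (trans (cong (λ s → trans-st h s b) ep)
        (trans-F h b j (odd-below j (subst (λ s → level s < h) ep (level< (par (suc i)) fv)) oj)))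

  absorber-parent : ∀ {u w} i → suc i < m → absorber u w (suc i) ≡ true →
      (fixed (par (suc i)) ≡ true) × (E w (image (par (suc i))) ≡ true)
  absorber-parent {u} {w} i l e with ∧-elim {center (suc i)} e
  ... | cv , _ with ∧-elim {fixed (suc i)} cv
  ... | fv , ov with kind (suc i) fv
  ... | root _ refl e′ = true≢false ov (cong (isOdd ∘ level) e′)
  ... | inner _ j refl e′ ep _ = fixed-F ep ,
      trans (cong (E w) (leaf-parent l e′ ep (trans (cong (isOdd ∘ level) (sym e′)) ov))) (star-leaf e 0 (s≤s z≤n))

  -- The free vertices are embedded one by one into the first s parts.  A vertex whose grandchild is the root g of a fixed
  -- component is made rich towards image g, so that the vertex between them finds a common neighbour later.
  module Free (g : ℕ) (rich : ℕ → ℕ → Bool)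
    (many-rich : ∀ {u v j} → u < n → v < n → j < M → N ≤ 8 * g * # N (λ i → E u (V j i) ∧ rich v (V j i)))
    (rich-codegree : ∀ {v x j} → v < n → x < n → rich v x ≡ true → j < M →
        N ≤ 8 * g * # N (λ i → E v (V j i) ∧ E x (V j i)))
    (few : 8 * g * # m (λ v → not (isF (st v))) < s * N) where

    Slot = ℕ × ℕ

    place : (ℕ → Slot) → ℕ → ℕ
    place q i = if fixed i then image i else V (proj₁ (q i)) (proj₂ (q i))

    place-fixed : ∀ q {i} → fixed i ≡ true → place q i ≡ image i
    place-fixed q e rewrite e = refl

    place-free : ∀ q {i} → fixed i ≡ false → place q i ≡ V (proj₁ (q i)) (proj₂ (q i))
    place-free q e rewrite e = refl

    record Good (q : ℕ → Slot) (i : ℕ) : Set where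
      field
        part<s : proj₁ (q i) < s
        slot<N : proj₂ (q i) < N
        to-parent : E (place q (par i)) (place q i) ≡ true
        to-root : ∀ g → g < m → rootᵇ g ≡ true → par g ≡ i → E (image g) (place q i) ≡ true
        to-grandroot : ∀ g → g < m → rootᵇ g ≡ true → par (par g) ≡ i → rich (image g) (place q i) ≡ true
    open Good

    Partial : ℕ → (ℕ → Slot) → Set
    Partial t q = (∀ i → i < t → fixed i ≡ false → Good q i) ×
      (∀ i j → i < t → j < t → fixed i ≡ false → fixed j ≡ false → q i ≡ q j → i ≡ j)

    s≤M : s ≤ M
    s≤M = ≤-trans (m≤m+n s _) offset-room

    place< : ∀ {t q} → t ≤ m → Partial t q → ∀ i → i < t → place q i < n
    place< {t} {q} t≤ P i l with bool-cases (fixed i)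
    ... | inj₁ e = subst (_< n) (sym (place-fixed q e)) (image< i (≤-trans l t≤) e)
    ... | inj₂ e = subst (_< n) (sym (place-free q e))
        (V-bound (≤-trans (part<s (proj₁ P i l e)) s≤M) (slot<N (proj₁ P i l e)))

    root-fixed : ∀ {g} → rootᵇ g ≡ true → fixed g ≡ true
    root-fixed {suc i} e = cong isF (isF0-≡ e)

    root-parent : ∀ {g} → rootᵇ g ≡ true → (st (par g) ≡ C) × (idx g ≡ des (par g))
    root-parent {suc i} e with trans-F0 h (st (par (suc i))) _ (trans (sym (st-suc i)) (isF0-≡ e))
    ... | p , q = p , eqb-≡ q

    C-parent : ∀ {v} → st v ≡ C → (st (par v) ≡ Y) × (idx v ≡ des (par v)) × (Σ ℕ λ i → v ≡ suc i)
    C-parent {zero} e with trans (sym st-root) e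
    ... | ()
    C-parent {suc i} e with trans-C h (st (par (suc i))) _ (trans (sym (st-suc i)) e)
    ... | p , q = p , eqb-≡ q , i , refl

    root-unique : ∀ {g g′} → g < m → g′ < m → rootᵇ g ≡ true → rootᵇ g′ ≡ true → par g ≡ par g′ → g ≡ g′
    root-unique {suc i} {suc i′} l l′ e e′ p = cong suc (idx-inj i i′ l l′ p
      (trans (proj₂ (root-parent {suc i} e)) (trans (cong des p) (sym (proj₂ (root-parent {suc i′} e′))))))

    C-unique : ∀ {c c′} → c < m → c′ < m → st c ≡ C → st c′ ≡ C → par c ≡ par c′ → c ≡ c′
    C-unique l l′ e e′ p with C-parent e | C-parent e′
    ... | _ , x , i , refl | _ , x′ , i′ , refl =
        cong suc (idx-inj i i′ l l′ p (trans x (trans (cong des p) (sym x′))))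

    par<m : ∀ {g} → g < m → rootᵇ g ≡ true → par g < m
    par<m {suc i} l _ = par< l

    grandroot-unique : ∀ {g g′} → g < m → g′ < m → rootᵇ g ≡ true → rootᵇ g′ ≡ true →
        par (par g) ≡ par (par g′) → g ≡ g′
    grandroot-unique {g} {g′} l l′ e e′ p = root-unique l l′ e e′
      (C-unique (par<m l e) (par<m l′ e′) (proj₁ (root-parent {g} e)) (proj₁ (root-parent {g′} e′)) p)

    used : ℕ → (ℕ → Slot) → ℕ → ℕ
    used t q j = # t (λ i → not (fixed i) ∧ eqb (proj₁ (q i)) j)

    roomy-part : ∀ t q → t ≤ m → Σ ℕ λ j → j < s × 8 * g * used t q j < N
    roomy-part t q t≤ with search s (λ j → ltb (8 * g * used t q j) N)
    ... | inj₁ (j , l , e) = j , l , leb-≤ e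
    ... | inj₂ none = ⊥-elim (<⇒≱ few (begin
      s * N                                       ≡⟨ sym (∑-const s N) ⟩
      ∑ s (λ _ → N)                               ≤⟨
          ∑-mono s (λ j l → ≮⇒≥ (λ lt → true≢false (≤-leb lt) (none j l))) ⟩
      ∑ s (λ j → 8 * g * used t q j)              ≡⟨
          trans (∑-* s (8 * g) _) (cong (8 * g *_) (∑-swap s t (λ j i → ⟦ not (fixed i) ∧ eqb (proj₁ (q i)) j ⟧))) ⟩
      8 * g * ∑ t (λ i → # s (λ j → not (fixed i) ∧ eqb (proj₁ (q i)) j)) ≤⟨
          *-monoʳ-≤ (8 * g) (∑-mono t (λ i _ → col i)) ⟩
      8 * g * # t (λ i → not (fixed i))           ≤⟨ *-monoʳ-≤ (8 * g) (∑-mono-≤ _ t≤) ⟩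
      8 * g * # m (λ i → not (fixed i))           ∎))
      where
      open ≤-Reasoning
      col : ∀ i → # s (λ j → not (fixed i) ∧ eqb (proj₁ (q i)) j) ≤ ⟦ not (fixed i) ⟧
      col i with not (fixed i)
      ... | true = #-unique s _ λ a b _ _ x y → trans (sym (eqb-≡ x)) (eqb-≡ y)
      ... | false = ≤-reflexive (∑-0 s)

    free-slot : ∀ t q j → 8 * g * used t q j < N → (cand : ℕ → Bool) → N ≤ 8 * g * # N cand →
      Σ ℕ λ x → x < N × cand x ≡ true × (∀ i → i < t → fixed i ≡ false → q i ≢ (j , x))
    free-slot t q j few-used cand many = x , proj₁ (proj₂ more) , proj₁ (proj₂ (proj₂ more)) , fresh
      where
      takes : ℕ → ℕ → Bool
      takes x i = (not (fixed i) ∧ eqb (proj₁ (q i)) j) ∧ eqb (proj₂ (q i)) x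
      taken : ℕ → Bool
      taken x = not (allᵇ t (λ i → not (takes x i)))
      allᵇ-false : ∀ n {p} → allᵇ n p ≡ false → Σ ℕ λ i → i < n × p i ≡ false
      allᵇ-false (suc n) {p} e with bool-cases (p n)
      ... | inj₂ e′ = n , ≤-refl , e′
      ... | inj₁ e′ with allᵇ-false n {p} (trans (sym (trans (cong (allᵇ n p ∧_) e′) (lem (allᵇ n p)))) e)
        where
        lem : ∀ b → b ∧ true ≡ b
        lem true = refl
        lem false = refl
      ... | i , l , r = i , m<n⇒m<1+n l , r
      not-not : ∀ {b} → not b ≡ false → b ≡ true
      not-not {true} _ = refl
      taken≤ : # N taken ≤ used t q j
      taken≤ = #-key N t (proj₂ ∘ q) λ x _ e → let w = allᵇ-false t (not-true e) ; tk = not-not (proj₂ (proj₂ w)) in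
        proj₁ w , proj₁ (proj₂ w) , proj₁ (∧-elim {not (fixed (proj₁ w)) ∧ eqb (proj₁ (q (proj₁ w))) j} tk) ,
        eqb-≡ (proj₂ (∧-elim {not (fixed (proj₁ w)) ∧ eqb (proj₁ (q (proj₁ w))) j} tk))
      more = #-more N {cand} {taken} (*-cancelˡ-< (8 * g) _ _
          (≤-trans (s≤s (*-monoʳ-≤ (8 * g) taken≤)) (≤-trans few-used many)))
      x = proj₁ more
      fresh : ∀ i → i < t → fixed i ≡ false → q i ≢ (j , x)
      fresh i l fi e = true≢false
        (∧-intro (∧-intro (not-false fi) (≡-eqb (cong proj₁ e))) (≡-eqb (cong proj₂ e)))
        (not-true (allᵇ-elim t (not-not (proj₂ (proj₂ (proj₂ more)))) i l))

    extend : ∀ t q → Partial t q → fixed t ≡ false → ∀ j x → j < s → x < N →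
        (∀ i → i < t → fixed i ≡ false → q i ≢ (j , x)) → par t < t →
      E (place q (par t)) (V j x) ≡ true →
      (∀ g → g < m → rootᵇ g ≡ true → par g ≡ t → E (image g) (V j x) ≡ true) →
      (∀ g → g < m → rootᵇ g ≡ true → par (par g) ≡ t → rich (image g) (V j x) ≡ true) →
          Partial (suc t) (upd q t (j , x))
    extend t q (good , inj) ft j x j< x< fresh p<t e₁ e₂ e₃ = good′ , inj′
      where
      q′ = upd q t (j , x)
      old : ∀ i → i < t → place q′ i ≡ place q i
      old i l = cong (λ z → if fixed i then image i else V (proj₁ z) (proj₂ z)) (upd-below q (j , x) l)
      new : place q′ t ≡ V j x
      new = trans (place-free q′ ft) (cong (λ z → V (proj₁ z) (proj₂ z)) (upd-same q t (j , x)))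
      good′ : ∀ i → i < suc t → fixed i ≡ false → Good q′ i
      good′ zero l fi = true≢false fixed-top fi
      good′ i@(suc i′) l fi with m≤n⇒m<n∨m≡n (≤-pred l)
      ... | inj₁ l′ = record
        { part<s = subst (λ z → proj₁ z < s) (sym (upd-below q (j , x) l′)) (part<s (good i l′ fi))
        ; slot<N = subst (λ z → proj₂ z < N) (sym (upd-below q (j , x) l′)) (slot<N (good i l′ fi))
        ; to-parent = trans (cong₂ E (old (par i) (≤-trans (s≤s (par≤ i′)) (<⇒≤ l′))) (old i l′))
            (to-parent (good i l′ fi))
        ; to-root = λ g gl gr p → trans (cong (E (image g)) (old i l′)) (to-root (good i l′ fi) g gl gr p)
        ; to-grandroot = λ g gl gr p → trans (cong (rich (image g)) (old i l′))
            (to-grandroot (good i l′ fi) g gl gr p)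
        }
      ... | inj₂ refl = record
        { part<s = subst (λ z → proj₁ z < s) (sym (upd-same q t (j , x))) j<
        ; slot<N = subst (λ z → proj₂ z < N) (sym (upd-same q t (j , x))) x<
        ; to-parent = trans (cong₂ E (old (par t) p<t) new) e₁
        ; to-root = λ g gl gr p → trans (cong (E (image g)) new) (e₂ g gl gr p)
        ; to-grandroot = λ g gl gr p → trans (cong (rich (image g)) new) (e₃ g gl gr p)
        }
      inj′ : ∀ a b → a < suc t → b < suc t → fixed a ≡ false → fixed b ≡ false → q′ a ≡ q′ b → a ≡ b
      inj′ a b la lb fa fb e with m≤n⇒m<n∨m≡n (≤-pred la) | m≤n⇒m<n∨m≡n (≤-pred lb)
      ... | inj₁ la′ | inj₁ lb′ = inj a b la′ lb′ fa fb
          (trans (sym (upd-below q (j , x) la′)) (trans e (upd-below q (j , x) lb′)))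
      ... | inj₁ la′ | inj₂ refl = ⊥-elim
          (fresh a la′ fa (trans (sym (upd-below q (j , x) la′)) (trans e (upd-same q t (j , x)))))
      ... | inj₂ refl | inj₁ lb′ = ⊥-elim
          (fresh b lb′ fb (trans (sym (upd-below q (j , x) lb′)) (trans (sym e) (upd-same q t (j , x)))))
      ... | inj₂ refl | inj₂ refl = refl

    place-next : ∀ t q → suc t < m → Partial (suc t) q → fixed (suc t) ≡ false → Σ (ℕ → Slot) (Partial (suc (suc t)))
    place-next t q t<m P ft = by-root (search m (λ g → rootᵇ g ∧ eqb (par g) v))
        (search m (λ g → rootᵇ g ∧ eqb (par (par g)) v))
      where
      v = suc t
      u = place q (par v)
      p<v : par v < v
      p<v = s≤s (par≤ t)
      u< : u < n
      u< = place< {v} {q} (<⇒≤ t<m) P (par v) p<v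
      roomy = roomy-part v q (<⇒≤ t<m)
      j = proj₁ roomy
      j< = proj₁ (proj₂ roomy)
      j<M : j < M
      j<M = ≤-trans j< s≤M
      pick : (cand : ℕ → Bool) → N ≤ 8 * g * # N cand → Σ ℕ λ x →
          x < N × cand x ≡ true × (∀ i → i < v → fixed i ≡ false → q i ≢ (j , x))
      pick = free-slot v q j (proj₂ (proj₂ roomy))
      by-root : (Σ ℕ λ g → g < m × rootᵇ g ∧ eqb (par g) v ≡ true) ⊎ (∀ g → g < m → rootᵇ g ∧ eqb (par g) v ≡ false) →
        (Σ ℕ λ g → g < m × rootᵇ g ∧ eqb (par (par g)) v ≡ true) ⊎
            (∀ g → g < m → rootᵇ g ∧ eqb (par (par g)) v ≡ false) →
        Σ (ℕ → Slot) (Partial (suc v))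
      -- State `C`: the parent, of state `Y`, was placed rich towards `image r`, so its image and
      -- `image r` have many common neighbours.
      by-root (inj₁ (r , rl , e)) _ = _ , extend v q P ft j x j< (proj₁ (proj₂ w)) (proj₂ (proj₂ (proj₂ w))) p<v
          (proj₂ (∧-elim {E (image r) (V j x)} (proj₁ (proj₂ (proj₂ w)))))
          (λ g gl gr p → subst (λ z → E (image z) (V j x) ≡ true) (root-unique rl gl rr gr (trans rp (sym p)))
              (proj₁ (∧-elim {E (image r) (V j x)} (proj₁ (proj₂ (proj₂ w))))))
          (λ g gl gr p → ⊥-elim (C≢Y (trans (sym st-v)
              (trans (cong st (sym p)) (proj₁ (C-parent (proj₁ (root-parent {g} gr))))))))
        where
        rr = proj₁ (∧-elim {rootᵇ r} e)
        rp = eqb-≡ (proj₂ (∧-elim {rootᵇ r} e))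
        C≢Y : C ≢ Y
        C≢Y ()
        st-v : st v ≡ C
        st-v = trans (cong st (sym rp)) (proj₁ (root-parent {r} rr))
        rich-u : rich (image r) u ≡ true
        rich-u = to-grandroot (proj₁ P (par v) p<v (cong isF (proj₁ (C-parent st-v)))) r rl rr (cong par rp)
        w = pick (λ x → E (image r) (V j x) ∧ E u (V j x))
            (rich-codegree (image< r rl (root-fixed {r} rr)) u< rich-u j<M)
        x = proj₁ w
      -- A grandparent of a component root: richness towards `image r` prepares the placement of the
      -- vertex in between.
      by-root (inj₂ none) (inj₁ (r , rl , e)) = _ , extend v q P ft j x j< (proj₁ (proj₂ w))
          (proj₂ (proj₂ (proj₂ w))) p<v
          (proj₁ (∧-elim {E u (V j x)} (proj₁ (proj₂ (proj₂ w)))))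
          (λ g gl gr p → true≢false (∧-intro gr (≡-eqb p)) (none g gl))
          (λ g gl gr p → subst (λ z → rich (image z) (V j x) ≡ true)
              (grandroot-unique rl gl rr gr (trans rp (sym p)))
              (proj₂ (∧-elim {E u (V j x)} (proj₁ (proj₂ (proj₂ w))))))
        where
        rr = proj₁ (∧-elim {rootᵇ r} e)
        rp = eqb-≡ (proj₂ (∧-elim {rootᵇ r} e))
        w = pick (λ x → E u (V j x) ∧ rich (image r) (V j x)) (many-rich u< (image< r rl (root-fixed {r} rr)) j<M)
        x = proj₁ w
      by-root (inj₂ none) (inj₂ none′) = _ , extend v q P ft j x j< (proj₁ (proj₂ w)) (proj₂ (proj₂ (proj₂ w))) p<v
          (proj₁ (∧-elim {E u (V j x)} (proj₁ (proj₂ (proj₂ w)))))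
          (λ g gl gr p → true≢false (∧-intro gr (≡-eqb p)) (none g gl))
          (λ g gl gr p → true≢false (∧-intro gr (≡-eqb p)) (none′ g gl))
        where
        -- Only adjacency to `u` is wanted here; the instance with both vertices equal to `u` merely
        -- supplies enough neighbours.
        w = pick (λ x → E u (V j x) ∧ rich u (V j x)) (many-rich u< u< j<M)
        x = proj₁ w

    place-all : ∀ t → suc t ≤ m → Σ (ℕ → Slot) (Partial (suc t))
    place-all zero _ = (λ _ → 0 , 0) , (λ { zero _ f → true≢false fixed-top f ; (suc i) (s≤s ()) _ }) ,
      λ { zero zero _ _ _ _ _ → refl ; zero (suc j) _ (s≤s ()) _ _ _ ; (suc i) _ (s≤s ()) _ _ _ _ }
    place-all (suc t) l with place-all t (<⇒≤ l) | bool-cases (fixed (suc t))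
    ... | q , P | inj₂ f = place-next t q l P f
    ... | q , P | inj₁ f = q , (λ i il fi → proj₁ P i (strict i il fi) fi) ,
      λ i j il jl fi fj → proj₂ P i j (strict i il fi) (strict j jl fj) fi fj
      where
      strict : ∀ i → i < suc (suc t) → fixed i ≡ false → i < suc t
      strict i il fi with m≤n⇒m<n∨m≡n (≤-pred il)
      ... | inj₁ l = l
      ... | inj₂ refl = true≢false f fi

    record Embedding : Set where
      field
        φ : ℕ → ℕ
        φ< : ∀ i → i < m → φ i < n
        φ-edge : ∀ i → suc i < m → E (φ (par (suc i))) (φ (suc i)) ≡ true
        φ-inj : ∀ i j → i < m → j < m → φ i ≡ φ j → i ≡ j
        φ-fixed : ∀ i → fixed i ≡ true → φ i ≡ image i

    embedding : Embedding
    embedding = record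
      { φ = place q
      ; φ< = place< {m} {q} ≤-refl P
      ; φ-edge = edge
      ; φ-inj = inj
      ; φ-fixed = λ i e → place-fixed q e
      }
      where
      q = proj₁ (place-all m′ ≤-refl)
      P : Partial m q
      P = proj₂ (place-all m′ ≤-refl)
      edge : ∀ i → suc i < m → E (place q (par (suc i))) (place q (suc i)) ≡ true
      edge i l with bool-cases (fixed (suc i))
      ... | inj₂ f = to-parent (proj₁ P (suc i) l f)
      ... | inj₁ f with bool-cases (fixed (par (suc i)))
      ... | inj₁ f′ = trans (cong₂ E (place-fixed q f′) (place-fixed q f)) (image-edge i l f f′)
      ... | inj₂ f′ with kind (suc i) f
      ... | root _ refl e = trans (E-sym _ _) (trans (cong (λ z → E z (place q (par (suc i)))) (place-fixed q f))
            (to-root (proj₁ P (par (suc i)) (par< l) f′) (suc i) l (cong isF0 e) refl))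
      ... | inner _ j refl e ep _ = true≢false (fixed-F ep) f′
      mixed : ∀ i j → i < m → j < m → fixed i ≡ true → fixed j ≡ false → place q i ≢ place q j
      mixed i j il jl fi fj e = <⇒≱ (part<s (proj₁ P j jl fj))
          (subst (s ≤_) (proj₁ (V-inj (part< i il fi) (pos< i il fi)
        (≤-trans (part<s (proj₁ P j jl fj)) s≤M) (slot<N (proj₁ P j jl fj))
            (trans (sym (place-fixed q fi)) (trans e (place-free q fj))))) (s≤part i))
      inj : ∀ i j → i < m → j < m → place q i ≡ place q j → i ≡ j
      inj i j il jl e with bool-cases (fixed i) | bool-cases (fixed j)
      ... | inj₁ fi | inj₁ fj = image-inj i j il jl fi fj
          (trans (sym (place-fixed q fi)) (trans e (place-fixed q fj)))
      ... | inj₁ fi | inj₂ fj = ⊥-elim (mixed i j il jl fi fj e)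
      ... | inj₂ fi | inj₁ fj = ⊥-elim (mixed j i jl il fj fi (sym e))
      ... | inj₂ fi | inj₂ fj = proj₂ P i j il jl fi fj (cong₂ _,_ (proj₁ pq) (proj₂ pq))
        where
        pq = V-inj (≤-trans (part<s (proj₁ P i il fi)) s≤M) (slot<N (proj₁ P i il fi))
            (≤-trans (part<s (proj₁ P j jl fj)) s≤M) (slot<N (proj₁ P j jl fj))
          (trans (sym (place-free q fi)) (trans e (place-free q fj)))

-- Absorbing the missing vertices.

-- A new leaf is attached at w by moving some center z with φ z adjacent to w to an unused vertex x adjacent to all
-- images of neighbours of z, and using the old φ z for the leaf.  This spoils at most two of the other centers.
module Absorption {n : ℕ} (E : ℕ → ℕ → Bool) (E-sym : ∀ u v → E u v ≡ E v u) (E-irrefl : ∀ v → E v v ≡ false)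
  (par : ℕ → ℕ) (par≤ : ∀ i → par (suc i) ≤ i)
  (m₀ : ℕ) (A : ℕ → Bool) (independent : ∀ i → suc i < m₀ → A (suc i) ≡ true → A (par (suc i)) ≡ true → ⊥) where

  nbr : ℕ → ℕ → Bool
  nbr z zero = leb 1 z ∧ eqb (par z) 0
  nbr z (suc i) = eqb (par (suc i)) z ∨ (leb 1 z ∧ eqb (par z) (suc i))

  nbr-parent : ∀ i → nbr (suc i) (par (suc i)) ≡ true
  nbr-parent i with par (suc i) in e
  ... | zero = ∧-intro (≤-leb (s≤s z≤n)) (≡-eqb e)
  ... | suc k rewrite ≤-leb {1} {suc i} (s≤s z≤n) | ≡-eqb e with eqb (par (suc k)) (suc i)
  ... | true = refl
  ... | false = refl

  nbr-child : ∀ i → nbr (par (suc i)) (suc i) ≡ true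
  nbr-child i rewrite eqb-refl (par (suc i)) = refl

  nbr-cases : ∀ z y → nbr z y ≡ true → (Σ ℕ λ i → y ≡ suc i × par y ≡ z) ⊎ (Σ ℕ λ i → z ≡ suc i × par z ≡ y)
  nbr-cases (suc i) zero e = inj₂ (i , refl , eqb-≡ (proj₂ (∧-elim {leb 1 (suc i)} e)))
  nbr-cases zero zero e with leb-≤ (proj₁ (∧-elim {leb 1 0} e))
  ... | ()
  nbr-cases z (suc y) e with eqb (par (suc y)) z in c
  ... | true = inj₁ (y , refl , eqb-≡ c)
  nbr-cases zero (suc y) e | false with leb-≤ (proj₁ (∧-elim {leb 1 0} e))
  ... | ()
  nbr-cases (suc i) (suc y) e | false = inj₂ (i , refl , eqb-≡ (proj₂ (∧-elim {leb 1 (suc i)} e)))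

  record Embeds (t : ℕ) (φ : ℕ → ℕ) : Set where
    field
      bound : ∀ i → i < t → φ i < n
      edge : ∀ i → suc i < t → E (φ (par (suc i))) (φ (suc i)) ≡ true
      inj : ∀ i j → i < t → j < t → φ i ≡ φ j → i ≡ j
  open Embeds

  ok : (ℕ → ℕ) → ℕ → ℕ → ℕ → ℕ → Bool
  ok φ t w x z = (A z ∧ E w (φ z)) ∧ allᵇ t (λ y → not (nbr z y) ∨ E x (φ y))

  ok-nbr : ∀ {φ t w x z} → ok φ t w x z ≡ true → ∀ y → y < t → nbr z y ≡ true → E x (φ y) ≡ true
  ok-nbr {φ} {t} {w} {x} {z} e y l b =
      aux (subst (λ c → not c ∨ E x (φ y) ≡ true) b (allᵇ-elim t (proj₂ (∧-elim {A z ∧ E w (φ z)} e)) y l))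
    where
    aux : ∀ {b} → false ∨ b ≡ true → b ≡ true
    aux h = h

  ok-intro : ∀ {φ t w x} z → A z ≡ true → E w (φ z) ≡ true →
      (∀ i → suc i < t → par (suc i) ≡ z → E x (φ (suc i)) ≡ true) →
    (∀ i → z ≡ suc i → E x (φ (par (suc i))) ≡ true) → ok φ t w x z ≡ true
  ok-intro {φ} {t} {w} {x} z a e below above = ∧-intro (∧-intro a e) (allᵇ-intro t λ y yl → by y yl (nbr z y) refl)
    where
    by : ∀ y → y < t → ∀ b → nbr z y ≡ b → not b ∨ E x (φ y) ≡ true
    by y yl false _ = refl
    by y yl true b with nbr-cases z y b
    ... | inj₁ (i , refl , p) = below i yl p
    ... | inj₂ (i , refl , refl) = above i refl

  unused : ∀ {t φ} → t < n → Embeds t φ → Σ ℕ λ x → x < n × (∀ i → i < t → φ i ≢ x)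
  unused {t} {φ} t<n emb with search n (λ x → allᵇ t (λ i → not (eqb (φ i) x)))
  ... | inj₁ (x , l , e) = x , l , λ i il q → true≢false (≡-eqb q) (not-true (allᵇ-elim t e i il))
  ... | inj₂ none = ⊥-elim (<⇒≱ t<n (≤-trans (≤-reflexive (sym (#-all n {λ _ → true} (λ _ _ → refl))))
      (≤-trans (#-key n t {λ _ → true} {λ _ → true} φ λ x l _ → hit x (none x l)) (#-≤ t _))))
    where
    hit : ∀ x → allᵇ t (λ i → not (eqb (φ i) x)) ≡ false → Σ ℕ λ i → i < t × true ≡ true × φ i ≡ x
    hit x e with search t (λ i → eqb (φ i) x)
    ... | inj₁ (i , il , q) = i , il , refl , eqb-≡ q
    ... | inj₂ miss = true≢false (allᵇ-intro t (λ i il → not-false (miss i il))) e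

  module _ {t : ℕ} {φ : ℕ → ℕ} (m₀≤t : m₀ ≤ suc t) (emb : Embeds (suc t) φ) (x : ℕ) (x<n : x < n)
      (x-new : ∀ i → i < suc t → φ i ≢ x)
    (z : ℕ) (z<m₀ : z < m₀) (z-ok : ok φ (suc t) (φ (par (suc t))) x z ≡ true) where
    private
      v = suc t
      φ′ : ℕ → ℕ
      φ′ = upd (upd φ z x) v (φ z)
      z<v : z < v
      z<v = ≤-trans z<m₀ m₀≤t
      Az : A z ≡ true
      Az = proj₁ (∧-elim {A z} (proj₁ (∧-elim {A z ∧ E (φ (par v)) (φ z)} z-ok)))
      Ez : E (φ (par v)) (φ z) ≡ true
      Ez = proj₂ (∧-elim {A z} (proj₁ (∧-elim {A z ∧ E (φ (par v)) (φ z)} z-ok)))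
      at-v : φ′ v ≡ φ z
      at-v = upd-same (upd φ z x) v (φ z)
      at-z : φ′ z ≡ x
      at-z = trans (upd-below (upd φ z x) (φ z) z<v) (upd-same φ z x)
      at : ∀ i → i < v → i ≢ z → φ′ i ≡ φ i
      at i l ne = trans (upd-below (upd φ z x) (φ z) l) (upd-other φ x (≢-sym ne))
      par-v≢z : par v ≢ z
      par-v≢z e = true≢false (subst (λ y → E (φ y) (φ z) ≡ true) e Ez) (E-irrefl (φ z))

    swap-in : Embeds (suc v) φ′
    swap-in = record { bound = bound′ ; edge = edge′ ; inj = inj′ }
      where
      bound′ : ∀ i → i < suc v → φ′ i < n
      bound′ i l with m≤n⇒m<n∨m≡n (≤-pred l)
      ... | inj₂ refl = subst (_< n) (sym at-v) (bound emb z z<v)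
      ... | inj₁ l′ with i ≟ z
      ... | yes refl = subst (_< n) (sym at-z) x<n
      ... | no ne = subst (_< n) (sym (at i l′ ne)) (bound emb i l′)
      edge′ : ∀ i → suc i < suc v → E (φ′ (par (suc i))) (φ′ (suc i)) ≡ true
      edge′ i l with m≤n⇒m<n∨m≡n (≤-pred l)
      ... | inj₂ refl = trans (cong₂ E (at (par v) (s≤s (par≤ t)) par-v≢z) at-v) Ez
      ... | inj₁ l′ with suc i ≟ z
      ... | yes refl = trans (cong₂ E (at (par z) p< (<⇒≢ (s≤s (par≤ i)))) at-z)
                          (trans (E-sym _ x) (ok-nbr {φ} {v} {φ (par v)} {x} {z} z-ok (par z) p< (nbr-parent i)))
        where
        p< : par z < v
        p< = ≤-trans (s≤s (par≤ i)) (<⇒≤ l′)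
      ... | no ne with par (suc i) ≟ z
      ... | yes pz = trans (cong₂ E (trans (cong φ′ pz) at-z) (at (suc i) l′ ne))
                       (ok-nbr {φ} {v} {φ (par v)} {x} {z} z-ok (suc i) l′
                           (subst (λ y → nbr y (suc i) ≡ true) pz (nbr-child i)))
      ... | no pne = trans (cong₂ E (at (par (suc i)) (≤-trans (s≤s (par≤ i)) (<⇒≤ l′)) pne) (at (suc i) l′ ne))
          (edge emb i l′)
      old-inj : ∀ i j → i < v → j < v → φ′ i ≡ φ′ j → i ≡ j
      old-inj i j il jl e with i ≟ z | j ≟ z
      ... | yes refl | yes refl = refl
      ... | yes refl | no b = ⊥-elim (x-new j jl (trans (sym (at j jl b)) (trans (sym e) at-z)))
      ... | no a | yes refl = ⊥-elim (x-new i il (trans (sym (at i il a)) (trans e at-z)))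
      ... | no a | no b = inj emb i j il jl (trans (sym (at i il a)) (trans e (at j jl b)))
      new-inj : ∀ i → i < v → φ′ i ≢ φ z
      new-inj i il e with i ≟ z
      ... | yes refl = x-new z z<v (sym (trans (sym at-z) e))
      ... | no a = a (inj emb i z il z<v (trans (sym (at i il a)) e))
      inj′ : ∀ i j → i < suc v → j < suc v → φ′ i ≡ φ′ j → i ≡ j
      inj′ i j il jl e with m≤n⇒m<n∨m≡n (≤-pred il) | m≤n⇒m<n∨m≡n (≤-pred jl)
      ... | inj₁ a | inj₁ b = old-inj i j a b e
      ... | inj₁ a | inj₂ refl = ⊥-elim (new-inj i a (trans e at-v))
      ... | inj₂ refl | inj₁ b = ⊥-elim (new-inj j b (trans (sym e) at-v))
      ... | inj₂ refl | inj₂ refl = refl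

    -- The image of `z′` is unchanged as `z′ ≢ z`. So are the images of its neighbours, since `z` is
    -- not among them by independence; and `v` is no new neighbour as `z′` is not its parent.
    still-ok : ∀ w x′ z′ → z′ < m₀ → ok φ v w x′ z′ ≡ true → z′ ≢ z → z′ ≢ par v → ok φ′ (suc v) w x′ z′ ≡ true
    still-ok w x′ z′ l e ne np = ∧-intro
        (∧-intro (proj₁ e₁) (trans (cong (E w) (at z′ (≤-trans l m₀≤t) ne)) (proj₂ e₁)))
        (allᵇ-intro (suc v) λ y yl → go y yl (nbr z′ y) refl)
      where
      e₁ = ∧-elim {A z′} (proj₁ (∧-elim {A z′ ∧ E w (φ z′)} e))
      ⊥-true : ∀ {A : Set} → ⊥ → A
      ⊥-true ()
      adjacent-centers : ∀ y → nbr z′ y ≡ true → y ≢ z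
      adjacent-centers y b refl with nbr-cases z′ y b
      ... | inj₁ (i , refl , p) = independent i z<m₀ Az (trans (cong A p) (proj₁ e₁))
      ... | inj₂ (i , refl , p) = independent i l (proj₁ e₁) (trans (cong A p) Az)
      not-v : nbr z′ v ≡ true → ⊥
      not-v b with nbr-cases z′ v b
      ... | inj₁ (i , _ , p) = np (sym p)
      ... | inj₂ (i , refl , p) = <-irrefl refl
          (≤-trans (≤-trans (s≤s (≤-reflexive (sym p))) (s≤s (par≤ i))) (≤-trans (<⇒≤ l) m₀≤t))
      go : ∀ y → y < suc v → ∀ b → nbr z′ y ≡ b → not b ∨ E x′ (φ′ y) ≡ true
      go y yl false _ = refl
      go y yl true b with m≤n⇒m<n∨m≡n (≤-pred yl)
      ... | inj₂ refl = ⊥-true (not-v b)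
      ... | inj₁ yl′ = trans (cong (E x′) (at y yl′ (adjacent-centers y b))) (ok-nbr {φ} {v} {w} {x′} {z′} e y yl′ b)

    few-spoiled : ∀ w x′ → # m₀ (ok φ v w x′) ≤ # m₀ (ok φ′ (suc v) w x′) + 2
    few-spoiled w x′ = ≤-trans (#-cover m₀ {q = λ i → eqb z i ∨ eqb (par v) i} cov)
        (+-monoʳ-≤ (# m₀ (ok φ′ (suc v) w x′))
        (≤-trans (#-cover m₀ {p = eqb z} {q = eqb (par v)} λ i _ → ∨-cases (eqb z i) (eqb (par v) i))
            (+-mono-≤ (one z) (one (par v)))))
      where
      ∨-cases : ∀ a b → a ∨ b ≡ true → (a ≡ true) ⊎ (b ≡ true)
      ∨-cases true b e = inj₁ refl
      ∨-cases false b e = inj₂ e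
      one : ∀ a → # m₀ (eqb a) ≤ 1
      one a = #-unique m₀ (eqb a) λ i j _ _ e e′ → trans (sym (eqb-≡ e)) (eqb-≡ e′)
      cov : ∀ i → i < m₀ → ok φ v w x′ i ≡ true → (ok φ′ (suc v) w x′ i ≡ true) ⊎ (eqb z i ∨ eqb (par v) i ≡ true)
      cov i l e with z ≟ i
      ... | yes p = inj₂ (lem (≡-eqb p))
        where
        lem : ∀ {a b} → a ≡ true → a ∨ b ≡ true
        lem refl = refl
      ... | no p with par v ≟ i
      ... | yes q = inj₂ (lem (eqb z i) (≡-eqb q))
        where
        lem : ∀ a {b} → b ≡ true → a ∨ b ≡ true
        lem true _ = refl
        lem false e = e
      ... | no q = inj₁ (still-ok w x′ i l e (≢-sym p) (≢-sym q))

  absorb-one : ∀ {t φ} → m₀ ≤ suc t → suc t < n → Embeds (suc t) φ →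
      (∀ w x → w < n → x < n → 0 < # m₀ (ok φ (suc t) w x)) →
    Σ (ℕ → ℕ) λ φ′ → Embeds (suc (suc t)) φ′ × (∀ w x → # m₀ (ok φ (suc t) w x) ≤ # m₀ (ok φ′ (suc (suc t)) w x) + 2)
  absorb-one {t} {φ} m₀≤ t<n emb many with unused t<n emb
  ... | x , x< , x-new with #-pos m₀ _ (many (φ (par (suc t))) x (bound emb (par (suc t)) (s≤s (par≤ t))) x<)
  ... | z , z< , z-ok = _ , swap-in m₀≤ emb x x< x-new z z< z-ok , few-spoiled m₀≤ emb x x< x-new z z< z-ok

  absorb : ∀ k {t φ} → m₀ ≤ suc t → suc t + k ≡ n → Embeds (suc t) φ →
      (∀ w x → w < n → x < n → 2 * k < # m₀ (ok φ (suc t) w x)) → Σ (ℕ → ℕ) (Embeds n)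
  absorb zero {t} {φ} _ e emb _ = φ , subst (λ s → Embeds s φ) (trans (sym (+-identityʳ (suc t))) e) emb
  absorb (suc k) {t} {φ} m₀≤ e emb many with absorb-one m₀≤
      (≤-trans (≤-trans (m≤m+n _ k) (≤-reflexive (sym (+-suc (suc t) k)))) (≤-reflexive e)) emb
      (λ w x w< x< → ≤-trans (s≤s z≤n) (many w x w< x<))
  ... | φ′ , emb′ , few = absorb k (≤-trans m₀≤ (n≤1+n _)) (trans (sym (+-suc (suc t) k)) e) emb′
      λ w x w< x< → +-cancelʳ-≤ 2 _ _ (≤-trans (≤-reflexive (lem k)) (≤-trans (many w x w< x<) (few w x)))
      where
      lem : ∀ k → suc (2 * k) + 2 ≡ suc (2 * suc k)
      lem = solve-∀

-- Passage from `Fin n` to natural numbers.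

ext : ∀ {A : Set} → A → ∀ {n} → (Fin n → A) → ℕ → A
ext d {zero} f i = d
ext d {suc n} f zero = f Fin.zero
ext d {suc n} f (suc i) = ext d (f ∘ Fin.suc) i

ext-toℕ : ∀ {A : Set} (d : A) {n} (f : Fin n → A) x → ext d f (toℕ x) ≡ f x
ext-toℕ d f Fin.zero = refl
ext-toℕ d f (Fin.suc x) = ext-toℕ d (f ∘ Fin.suc) x

ext-out : ∀ {A : Set} (d : A) {n} (f : Fin n → A) {i} → n ≤ i → ext d f i ≡ d
ext-out d {zero} f _ = refl
ext-out d {suc n} f (s≤s l) = ext-out d (f ∘ Fin.suc) l

ext-map : ∀ {A B : Set} (h : A → B) (d : A) {n} (f : Fin n → A) i → ext (h d) (h ∘ f) i ≡ h (ext d f i)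
ext-map h d {zero} f i = refl
ext-map h d {suc n} f zero = refl
ext-map h d {suc n} f (suc i) = ext-map h d (f ∘ Fin.suc) i

in-range : ∀ n i → (Σ (Fin n) λ x → toℕ x ≡ i) ⊎ (n ≤ i)
in-range n i with i <? n
... | yes l = inj₁ (fromℕ< l , Fin.toℕ-fromℕ< l)
... | no l = inj₂ (≮⇒≥ l)

sum-ext : ∀ n (f : Fin n → ℕ) → sumᴸ (map f (Data.List.allFin n)) ≡ ∑ n (ext 0 f)
sum-ext n f = trans (cong sumᴸ (List.map-tabulate id f)) (go n f)
  where
  go : ∀ n (f : Fin n → ℕ) → sumᴸ (Data.List.tabulate f) ≡ ∑ n (ext 0 f)
  go zero f = refl
  go (suc n) f = trans (cong (f Fin.zero +_) (go n (f ∘ Fin.suc))) (sym (∑-front n (ext 0 f)))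

count-ext : ∀ {n} (p : Fin n → Bool) → count p ≡ # n (ext false p)
count-ext {n} p = trans (cong sumᴸ (List.map-cong (λ v → if-⟦⟧ (p v)) (Data.List.allFin n)))
  (trans (sum-ext n (⟦_⟧ ∘ p)) (∑-cong n (λ i _ → ext-map ⟦_⟧ false p i)))
  where
  if-⟦⟧ : ∀ b → (if b then 1 else 0) ≡ ⟦ b ⟧
  if-⟦⟧ true = refl
  if-⟦⟧ false = refl

adjᴺ : ∀ {n} → Graph n → ℕ → ℕ → Bool
adjᴺ G i j = ext false (λ u → ext false (adj G u) j) i

adjᴺ-toℕ : ∀ {n} (G : Graph n) u v → adjᴺ G (toℕ u) (toℕ v) ≡ adj G u v
adjᴺ-toℕ G u v = trans (ext-toℕ false (λ u → ext false (adj G u) (toℕ v)) u) (ext-toℕ false (adj G u) v)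

adjᴺ-row : ∀ {n} (G : Graph n) u j → adjᴺ G (toℕ u) j ≡ ext false (adj G u) j
adjᴺ-row G u j = ext-toℕ false (λ u → ext false (adj G u) j) u

adjᴺ-sym : ∀ {n} (G : Graph n) i j → adjᴺ G i j ≡ adjᴺ G j i
adjᴺ-sym {n} G i j with in-range n i | in-range n j
... | inj₁ (x , refl) | inj₁ (y , refl) = trans (adjᴺ-toℕ G x y) (trans (Graph.sym G x y) (sym (adjᴺ-toℕ G y x)))
... | inj₁ (x , refl) | inj₂ l =
    trans (adjᴺ-row G x j) (trans (ext-out false (adj G x) l)
    (sym (ext-out false (λ u → ext false (adj G u) (toℕ x)) l)))
... | inj₂ l | inj₁ (y , refl) = trans (ext-out false (λ u → ext false (adj G u) (toℕ y)) l)
    (sym (trans (adjᴺ-row G y i) (ext-out false (adj G y) l)))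
... | inj₂ l | inj₂ l′ = trans (ext-out false (λ u → ext false (adj G u) j) l)
    (sym (ext-out false (λ u → ext false (adj G u) i) l′))

adjᴺ-irrefl : ∀ {n} (G : Graph n) i → adjᴺ G i i ≡ false
adjᴺ-irrefl {n} G i with in-range n i
... | inj₁ (x , refl) = trans (adjᴺ-toℕ G x x) (Graph.irrefl G x)
... | inj₂ l = ext-out false (λ u → ext false (adj G u) i) l

-- Numbering the vertices of a tree so that parents come first.

lastOf : ∀ {A : Set} → A → List A → A
lastOf v [] = v
lastOf v (x ∷ xs) = lastOf x xs

lookup-last : ∀ {A : Set} (v : A) vs → Data.List.lookup (v ∷ vs) (Fin.fromℕ (length vs)) ≡ lastOf v vs
lookup-last v [] = refl
lookup-last v (x ∷ xs) = lookup-last x xs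

lastOf-map : ∀ {A B : Set} (f : A → B) v vs → lastOf (f v) (map f vs) ≡ f (lastOf v vs)
lastOf-map f v [] = refl
lastOf-map f v (x ∷ xs) = lastOf-map f x xs

lastOf-snoc : ∀ {A : Set} (v : A) vs y → lastOf v (vs ++ y ∷ []) ≡ y
lastOf-snoc v [] y = refl
lastOf-snoc v (x ∷ xs) y = lastOf-snoc x xs y

path-snoc : ∀ {n} (G : Graph n) v vs y → Path G (v ∷ vs) → lastOf v vs ~[ G ] y → Path G (v ∷ vs ++ y ∷ [])
path-snoc G v [] y _ e = e , _
path-snoc G v (x ∷ xs) y (a , p) e = a , path-snoc G x xs y p e

module Ordering {n′ : ℕ} (T : Graph (suc n′)) (connected : Connected T) (acyclic : Acyclic T) where
  private
    n = suc n′

  record Visit (k : ℕ) : Set where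
    field
      ord : ℕ → Fin n
      parent : ℕ → ℕ
      parent≤ : ∀ i → parent (suc i) ≤ i
      ord-inj : ∀ i j → i < k → j < k → ord i ≡ ord j → i ≡ j
      ord-edge : ∀ i → suc i < k → ord (parent (suc i)) ~[ T ] ord (suc i)
  open Visit

  visited : ∀ {k} (V : Visit k) x → (Σ ℕ λ i → i < k × ord V i ≡ x) ⊎ (∀ i → i < k → ord V i ≢ x)
  visited {k} V x with search k (λ i → eqb (toℕ (ord V i)) (toℕ x))
  ... | inj₁ (i , l , e) = inj₁ (i , l , Fin.toℕ-injective (eqb-≡ e))
  ... | inj₂ none = inj₂ λ i l e → true≢false (≡-eqb (cong toℕ e)) (none i l)

  unvisited : ∀ {k} (V : Visit k) → k < n → Σ (Fin n) λ x → ∀ i → i < k → ord V i ≢ x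
  unvisited {k} V k<n with search n (λ x → allᵇ k (λ i → not (eqb (toℕ (ord V i)) x)))
  ... | inj₁ (x , l , e) = fromℕ< l , λ i il q → true≢false (≡-eqb (trans (cong toℕ q) (Fin.toℕ-fromℕ< l)))
      (not-true (allᵇ-elim k e i il))
  ... | inj₂ none = ⊥-elim (<⇒≱ k<n (≤-trans (≤-reflexive (sym (#-all n {λ _ → true} (λ _ _ → refl))))
      (≤-trans (#-key n k {λ _ → true} {λ _ → true} (toℕ ∘ ord V) λ x l _ → hit x (none x l)) (#-≤ k _))))
    where
    hit : ∀ x → allᵇ k (λ i → not (eqb (toℕ (ord V i)) x)) ≡ false → Σ ℕ λ i → i < k × true ≡ true × toℕ (ord V i) ≡ x
    hit x e with search k (λ i → eqb (toℕ (ord V i)) x)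
    ... | inj₁ (i , il , q) = i , il , refl , eqb-≡ q
    ... | inj₂ miss = true≢false (allᵇ-intro k (λ i il → not-false (miss i il))) e

  exit : ∀ {k} (V : Visit k) {a b} → Walk T a b → (Σ ℕ λ i → i < k × ord V i ≡ a) → (∀ i → i < k → ord V i ≢ b) →
    Σ ℕ λ i → Σ (Fin n) λ c → i < k × ord V i ~[ T ] c × (∀ j → j < k → ord V j ≢ c)
  exit V (Walk.here _) (i , l , e) new = ⊥-elim (new i l e)
  exit V (Walk.step {v = c} e w) (i , l , refl) new with visited V c
  ... | inj₁ old = exit V w old new
  ... | inj₂ fresh = i , c , l , e , fresh

  visit : ∀ k → suc k ≤ n → Visit (suc k)
  visit zero _ = record
    { ord = λ _ → Fin.zero ; parent = λ _ → 0 ; parent≤ = λ _ → z≤n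
    ; ord-inj = λ { zero zero _ _ _ → refl ; (suc i) _ (s≤s ()) _ _ ; zero (suc j) _ (s≤s ()) _ }
    ; ord-edge = λ { i (s≤s ()) } }
  visit (suc k) l = grow (visit k (<⇒≤ l))
    where
    grow : Visit (suc k) → Visit (suc (suc k))
    grow V = record
      { ord = upd (ord V) (suc k) c
      ; parent = upd (parent V) (suc k) i
      ; parent≤ = par≤′
      ; ord-inj = inj′
      ; ord-edge = edge′
      }
      where
      target = unvisited V l
      ex = exit V (connected (ord V 0) (proj₁ target)) (0 , s≤s z≤n , refl) (proj₂ target)
      i = proj₁ ex
      c = proj₁ (proj₂ ex)
      i< = proj₁ (proj₂ (proj₂ ex))
      ic = proj₁ (proj₂ (proj₂ (proj₂ ex)))
      fresh = proj₂ (proj₂ (proj₂ (proj₂ ex)))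
      par≤′ : ∀ j → upd (parent V) (suc k) i (suc j) ≤ j
      par≤′ j with bool-cases (eqb (suc k) (suc j))
      ... | inj₁ e rewrite e = ≤-trans (≤-pred i<) (≤-reflexive (suc-injective (eqb-≡ {suc k} {suc j} e)))
      ... | inj₂ e rewrite e = parent≤ V j
      inj′ : ∀ a b → a < suc (suc k) → b < suc (suc k) → upd (ord V) (suc k) c a ≡ upd (ord V) (suc k) c b → a ≡ b
      inj′ a b la lb e with m≤n⇒m<n∨m≡n (≤-pred la) | m≤n⇒m<n∨m≡n (≤-pred lb)
      ... | inj₁ la′ | inj₁ lb′ = ord-inj V a b la′ lb′
          (trans (sym (upd-below (ord V) c la′)) (trans e (upd-below (ord V) c lb′)))
      ... | inj₁ la′ | inj₂ refl = ⊥-elim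
          (fresh a la′ (trans (sym (upd-below (ord V) c la′)) (trans e (upd-same (ord V) (suc k) c))))
      ... | inj₂ refl | inj₁ lb′ = ⊥-elim
          (fresh b lb′ (trans (sym (upd-below (ord V) c lb′)) (trans (sym e) (upd-same (ord V) (suc k) c))))
      ... | inj₂ refl | inj₂ refl = refl
      edge′ : ∀ j → suc j < suc (suc k) → upd (ord V) (suc k) c (upd (parent V) (suc k) i (suc j)) ~[ T ] upd
          (ord V) (suc k) c (suc j)
      edge′ j lj with m≤n⇒m<n∨m≡n (≤-pred lj)
      ... | inj₂ refl = trans (cong₂ (adj T)
          (trans (cong (upd (ord V) (suc k) c) (upd-same (parent V) (suc k) i)) (upd-below (ord V) c i<))
          (upd-same (ord V) (suc k) c)) ic
      ... | inj₁ lj′ = trans (cong₂ (adj T) (trans (cong (upd (ord V) (suc k) c) (upd-below (parent V) i lj′))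
              (upd-below (ord V) c (≤-trans (s≤s (parent≤ V j)) (<⇒≤ lj′)))) (upd-below (ord V) c lj′))
                  (ord-edge V j lj′)

  private
    V = visit n′ ≤-refl

  o : ℕ → Fin n
  o = ord V

  p : ℕ → ℕ
  p = parent V

  record TreePath (k a b : ℕ) : Set where
    field
      rest : List ℕ
      chain : Path T (o a ∷ map o rest)
      unique : Unique (a ∷ rest)
      small : All (_< k) (a ∷ rest)
      ends : lastOf a rest ≡ b
  open TreePath

  -- Induction on the bound: an end point that is the newest vertex is reached through its parent,
  -- and it cannot repeat because the rest of the path stays below it.
  tree-path : ∀ k → k ≤ n → ∀ a b → a < k → b < k → TreePath k a b
  tree-path (suc k) k<n a b la lb with m≤n⇒m<n∨m≡n (≤-pred la) | m≤n⇒m<n∨m≡n (≤-pred lb)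
  ... | inj₁ la′ | inj₁ lb′ = let t = tree-path k (<⇒≤ k<n) a b la′ lb′ in record
        { rest = rest t ; chain = chain t ; unique = unique t ; small = All.map m<n⇒m<1+n (small t) ; ends = ends t }
  ... | inj₂ refl | inj₂ refl = record
      { rest = [] ; chain = _ ; unique = [] ∷ [] ; small = ≤-refl ∷ [] ; ends = refl }
  tree-path (suc k) k<n (suc a) b la lb | inj₂ refl | inj₁ lb′ = let t = tree-path k (<⇒≤ k<n) (p k) b (s≤s (parent≤ V a)) lb′ in record
        { rest = p k ∷ rest t
        ; chain = trans (Graph.sym T (o k) (o (p k))) (ord-edge V a k<n) , chain t
        ; unique = All.map (≢-sym ∘ <⇒≢) (small t) ∷ unique t
        ; small = ≤-refl ∷ All.map m<n⇒m<1+n (small t)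
        ; ends = ends t }
  tree-path (suc k) k<n a (suc b) la lb | inj₁ la′ | inj₂ refl = let t = tree-path k (<⇒≤ k<n) a (p k) la′ (s≤s (parent≤ V b)) in record
        { rest = rest t ++ k ∷ []
        ; chain = subst (λ xs → Path T (o a ∷ xs)) (sym (List.map-++ o (rest t) (k ∷ [])))
            (path-snoc T (o a) (map o (rest t)) (o k) (chain t)
                (subst (λ x → x ~[ T ] o k) (sym (trans (lastOf-map o a (rest t)) (cong o (ends t))))
                (ord-edge V b k<n)))
        ; unique = snoc-unique (a ∷ rest t) (unique t) (small t)
        ; small = All.++⁺ (All.map m<n⇒m<1+n (small t)) (≤-refl ∷ [])
        ; ends = lastOf-snoc a (rest t) k }
    where
    snoc-unique : ∀ {k} xs → Unique xs → All (_< k) xs → Unique (xs ++ k ∷ [])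
    snoc-unique [] _ _ = [] ∷ []
    snoc-unique (x ∷ xs) (d ∷ u) (l ∷ ls) = All.++⁺ d (<⇒≢ l ∷ []) ∷ snoc-unique xs u ls

  unique-map : ∀ xs → All (_< n) xs → Unique xs → Unique (map o xs)
  unique-map [] _ _ = []
  unique-map (x ∷ xs) (l ∷ ls) (d ∷ u) = apart xs ls d ∷ unique-map xs ls u
    where
    apart : ∀ ys → All (_< n) ys → All (x ≢_) ys → All (o x ≢_) (map o ys)
    apart [] _ _ = []
    apart (y ∷ ys) (l′ ∷ ls′) (ne ∷ nes) = (λ e → ne (ord-inj V x y l l′ e)) ∷ apart ys ls′ nes

  -- A second earlier neighbour `i` would close a cycle: the path from the parent of `suc j` to `i`
  -- among earlier vertices, together with `suc j`.
  only-parent : ∀ i j → i < suc j → suc j < n → o i ~[ T ] o (suc j) → i ≡ p (suc j)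
  only-parent i j l jn e with p (suc j) ≟ i
  ... | yes q = sym q
  ... | no ne = ⊥-elim (acyclic (o v ∷ o (p v) ∷ map o (rest t))
      (long (rest t) (ends t) , uniq , (trans (Graph.sym T (o v) (o (p v))) (ord-edge V j jn) , chain t) , closing))
    where
    v = suc j
    t = tree-path v (<⇒≤ jn) (p v) i (s≤s (parent≤ V j)) l
    long : ∀ r → lastOf (p v) r ≡ i → 3 ≤ length (o v ∷ o (p v) ∷ map o r)
    long [] q = ⊥-elim (ne q)
    long (x ∷ r) q = s≤s (s≤s (s≤s z≤n))
    uniq : Unique (o v ∷ o (p v) ∷ map o (rest t))
    uniq = unique-map (v ∷ p v ∷ rest t) (jn ∷ All.map (λ q → <-trans q jn) (small t))
        (All.map (≢-sym ∘ <⇒≢) (small t) ∷ unique t)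
    closing : Data.List.lookup (o v ∷ o (p v) ∷ map o (rest t)) (Fin.fromℕ (length (o (p v) ∷ map o (rest t))))
        ~[ T ] o v
    closing = subst (λ x → x ~[ T ] o v)
        (sym (trans (lookup-last (o v) (o (p v) ∷ map o (rest t)))
        (trans (lastOf-map o (p v) (rest t)) (cong o (ends t))))) e

  num : Fin n → ℕ
  num x with visited V x
  ... | inj₁ (i , _) = i
  ... | inj₂ _ = 0

  num-spec : ∀ x → num x < n × o (num x) ≡ x
  num-spec x with visited V x
  ... | inj₁ (i , l , e) = l , e
  ... | inj₂ new = ⊥-elim (<-irrefl refl
      (≤-trans (s≤s all-used) (≤-reflexive
      (trans (cong (_+ # n used) (sym (#-point n (toℕ x) (Fin.toℕ<n x)))) (#-not n (eqb (toℕ x)))))))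
    where
    used : ℕ → Bool
    used y = not (eqb (toℕ x) y)
    all-used : n ≤ # n used
    all-used = ≤-trans (≤-reflexive (sym (#-all n {λ _ → true} (λ _ _ → refl))))
      (#-inj n n {λ _ → true} {used} (toℕ ∘ o)
          (λ i l _ → Fin.toℕ<n (o i) , not-false (eqb-≢ (λ e → new i l (Fin.toℕ-injective (sym e)))))
        (λ i j l l′ _ _ e → ord-inj V i j l l′ (Fin.toℕ-injective e)))

  num-inj : ∀ {x y} → num x ≡ num y → x ≡ y
  num-inj {x} {y} e = trans (sym (proj₂ (num-spec x))) (trans (cong o e) (proj₂ (num-spec y)))

  num-edge : ∀ x y → x ~[ T ] y → Σ ℕ λ i → suc i < n ×
    ((num x ≡ p (suc i) × num y ≡ suc i) ⊎ (num y ≡ p (suc i) × num x ≡ suc i))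
  num-edge x y e = go (num x) (num y) refl refl (<-cmp (num x) (num y))
    where
    e′ : o (num x) ~[ T ] o (num y)
    e′ = subst₂ (λ a b → a ~[ T ] b) (sym (proj₂ (num-spec x))) (sym (proj₂ (num-spec y))) e
    go : ∀ a b → num x ≡ a → num y ≡ b → Tri (num x < num y) (num x ≡ num y) (num y < num x) →
      Σ ℕ λ i → suc i < n × ((num x ≡ p (suc i) × num y ≡ suc i) ⊎ (num y ≡ p (suc i) × num x ≡ suc i))
    go a b ea eb (tri≈ _ q _) = true≢false (subst (λ z → adj T x z ≡ true) (sym (num-inj q)) e) (Graph.irrefl T x)
    go a zero ea eb (tri< l _ _) = ⊥-elim (n≮0 (subst (num x <_) eb l))
    go a (suc b) ea eb (tri< l _ _) = b , subst (_< n) eb (proj₁ (num-spec y)) ,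
      inj₁ (only-parent (num x) b (subst (num x <_) eb l) (subst (_< n) eb (proj₁ (num-spec y)))
          (subst (λ z → o (num x) ~[ T ] o z) eb e′) , eb)
    go zero b ea eb (tri> _ _ l) = ⊥-elim (n≮0 (subst (num y <_) ea l))
    go (suc a) b ea eb (tri> _ _ l) = a , subst (_< n) ea (proj₁ (num-spec x)) ,
      inj₂ (only-parent (num y) a (subst (num y <_) ea l) (subst (_< n) ea (proj₁ (num-spec x)))
        (subst (λ z → o (num y) ~[ T ] o z) ea (trans (Graph.sym T _ _) e′)) , ea)

  sib : ℕ → ℕ → Bool
  sib v zero = false
  sib v (suc i) = eqb (p (suc i)) v

  index : ℕ → ℕ
  index u = # u (sib (p u))

  rooted : ∀ {D} → MaxDegreeAtMost T D → Rooted n D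
  rooted {D} Δ = record
    { par = p ; par≤ = parent≤ V ; idx = index
    ; idx< = λ i l → ≤-trans (≤-trans
        (≤-reflexive (trans (+-comm 1 _)
        (cong (# (suc i) (sib (p (suc i))) +_) (sym (⟦⟧-true (eqb-refl (p (suc i))))))))
        (∑-mono-≤ (λ u → ⟦ sib (p (suc i)) u ⟧) l))
            (≤-trans (children (p (suc i)))
            (≤-trans (≤-reflexive (sym (count-ext (adj T (o (p (suc i))))))) (Δ (o (p (suc i))))))
    ; idx-inj = λ i j li lj pe ie → order i j pe ie (<-cmp i j)
    }
    where
    children : ∀ v → # n (sib v) ≤ # n (ext false (adj T (o v)))
    children v = #-inj n n (toℕ ∘ o) (λ { (suc i) l e → Fin.toℕ<n (o (suc i)) ,
        trans (ext-toℕ false (adj T (o v)) (o (suc i)))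
            (subst (λ z → o z ~[ T ] o (suc i)) (eqb-≡ e) (ord-edge V i l)) })
      (λ i j li lj _ _ e → ord-inj V i j li lj (Fin.toℕ-injective e))
    index-mono : ∀ i j → p (suc i) ≡ p (suc j) → i < j → index (suc i) < index (suc j)
    index-mono i j pe l = ≤-trans (≤-reflexive
        (trans (+-comm 1 _) (cong₂ _+_ (cong (λ v → # (suc i) (sib v)) pe) (sym (⟦⟧-true (≡-eqb pe))))))
      (∑-mono-≤ (λ u → ⟦ sib (p (suc j)) u ⟧) (s≤s l))
    order : ∀ i j → p (suc i) ≡ p (suc j) → index (suc i) ≡ index (suc j) → Tri (i < j) (i ≡ j) (j < i) → i ≡ j
    order i j pe ie (tri< l _ _) = ⊥-elim (<-irrefl ie (index-mono i j pe l))
    order i j pe ie (tri≈ _ q _) = q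
    order i j pe ie (tri> _ _ l) = ⊥-elim (<-irrefl (sym ie) (index-mono j i (sym pe) l))

-- Assembling the embedding and choosing the constants.

restrict : ∀ {m n D} → m ≤ n → Rooted n D → Rooted m D
restrict m≤n T = record
  { par = par ; par≤ = par≤ ; idx = idx
  ; idx< = λ i l → idx< i (≤-trans l m≤n)
  ; idx-inj = λ i j li lj → idx-inj i j (≤-trans li m≤n) (≤-trans lj m≤n) }
  where open Rooted T

-- Z centers, Λ full blocks of centers, f free vertices, x absorbers; each of the k missing vertices spoils two absorbers.
enough-absorbers : ∀ D c s L M N m k Z Λ f x → 0 < c → 0 < N → M ≤ N → suc k ≤ (s + L) * N + M →
  3 * s + (D + 2) * L + suc D * c * (2 * s + 2 * L + 3) ≤ M → m + (s + L) * N ≡ M * N →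
  m ≤ suc D * Z + 2 * f + 1 → f < s * N → Z ≤ N * Λ + L * N → N * Λ ≤ c * x → 2 * k < x
enough-absorbers D c s L M N m k Z Λ f x c>0 N>0 M≤N hk hM hm hZ hf hΛ hx =
  *-cancelˡ-≤ (suc D * c) {{>-nonZero (pos* {suc D} (s≤s z≤n) c>0)}} (linear 1 (suc D * c * N + 1)
    (+-mono-≤ (+-mono-≤ (+-mono-≤ (*-monoʳ-≤ (suc D * c) two-k) (*-monoˡ-≤ N hM))
        (+-mono-≤ (≤-reflexive (sym hm)) hZ))
              (+-mono-≤ (+-mono-≤ (*-monoʳ-≤ 2 hf) (*-monoʳ-≤ (suc D) hΛ)) (*-monoʳ-≤ (suc D) hx)))
    (e D c s L (M * N) N m k Z Λ f x))
  where
  two-k : suc (2 * k) ≤ 2 * ((s + L + 1) * N)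
  two-k = ≤-trans (≤-trans (n≤1+n _) (≤-reflexive (e₁ k)))
      (*-monoʳ-≤ 2 (≤-trans hk (≤-trans (+-monoʳ-≤ ((s + L) * N) M≤N) (≤-reflexive (e₂ s L N)))))
    where
    e₁ : ∀ k → suc (suc (2 * k)) ≡ 2 * suc k
    e₁ = solve-∀
    e₂ : ∀ s L N → (s + L) * N + N ≡ (s + L + 1) * N
    e₂ = solve-∀
  e : ∀ D c s L MN N m k Z Λ f x →
    1 * (suc D * c * suc (2 * k)) +
      (suc D * c * (2 * ((s + L + 1) * N)) + MN + (m + (s + L) * N + (suc D * Z + 2 * f + 1)) +
          (2 * (s * N) + suc D * (N * Λ + L * N) + suc D * (c * x)))
      + (suc D * c * N + 1)
    ≡ 1 * (suc D * c * x) +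
      (suc D * c * suc (2 * k) + (3 * s + (D + 2) * L + suc D * c * (2 * s + 2 * L + 3)) * N + (MN + m) +
          (2 * suc f + suc D * Z + suc D * (N * Λ)))
  e = solve-∀

module Assembly {n g D M N′ m′ : ℕ} (g>0 : 0 < g) (D>0 : 0 < D) (G : Dense n g)
    (H : Host n g M (suc (suc N′)) (Dense.E G))
  (stars : ∀ {a} → a < M → (L : ℕ → ℕ) → (∀ i → L i < M) → Star n (suc (suc N′)) (star-constant g D) D
      (Dense.E G) (Host.V H) a L)
  (T : Rooted n D) (h′ s : ℕ) (h′-even : isOdd h′ ≡ false) (m≤n : suc m′ ≤ n) (M≤N : M ≤ suc (suc N′))
  (room : suc m′ + (s + label-count D h′) * suc (suc N′) ≡ M * suc (suc N′))
  (n< : n < M * suc (suc N′) + M)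
  (few : 8 * g * (suc m′ * (D * D * D + D * D + D)) < suc h′ * (s * suc (suc N′)))
  (wide : 3 * s + (D + 2) * label-count D h′ + suc D * star-constant g D * (2 * s + 2 * label-count D h′ + 3) ≤
      M) where
  open Dense G
  open Host H
  private
    N = suc (suc N′)
    m = suc m′
    c = star-constant g D
    T′ : Rooted m D
    T′ = restrict m≤n T
    abstract
      dec : Decomposition T′ (suc h′)
      dec = Decompose.decompose D>0 T′ h′
    open Rooted T
    module P = Placement T′ h′ dec h′-even E-sym V V-bound V-inj stars s (≤-reflexive room)
    open Labels T′ h′ dec using (fixed; kind; Kind; root; inner)
    open Centers T′ h′ dec using (center; many-centers)

    free = # m (λ v → not (fixed v))

    few-free : 8 * g * free < s * N
    few-free = *-cancelˡ-< (suc h′) _ _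
        (≤-trans (s≤s (≤-trans (≤-reflexive (e (suc h′) (8 * g) free))
        (*-monoʳ-≤ (8 * g) (Decomposition.few-free dec)))) few)
      where
      e : ∀ h a f → h * (a * f) ≡ a * (h * f)
      e = solve-∀

    module F = P.Free g rich many-rich rich-codegree few-free
    open F.Embedding F.embedding

    independent : ∀ i → suc i < m → center (suc i) ≡ true → center (par (suc i)) ≡ true → ⊥
    independent i l a b with ∧-elim {fixed (suc i)} a | ∧-elim {fixed (par (suc i))} b
    ... | fa , oa | fb , ob with kind (suc i) fa
    ... | root _ refl e = true≢false oa (cong (isOdd ∘ level) e)
    ... | inner _ j refl e ep _ = true≢false (trans (cong (isOdd ∘ level) (sym ep)) ob)
        (not-true (trans (cong (isOdd ∘ level) (sym e)) oa))

    module Ab = Absorption {n} E E-sym E-irrefl par par≤ m center independent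

    start : Ab.Embeds m φ
    start = record { bound = φ< ; edge = φ-edge ; inj = φ-inj }

    absorber-ok : ∀ w x z → z < m → P.absorber w x z ≡ true → Ab.ok φ m w x z ≡ true
    absorber-ok w x z l e = Ab.ok-intro z cz
        (trans (cong (E w) (φ-fixed z (proj₁ (∧-elim {fixed z} cz)))) (P.absorber-center l e)) below above
      where
      cz = proj₁ (∧-elim {center z} e)
      via : ∀ y → (fixed y ≡ true) × (E x (P.image y) ≡ true) → E x (φ y) ≡ true
      via y (f , h) = trans (cong (E x) (φ-fixed y f)) h
      below : ∀ i → suc i < m → par (suc i) ≡ z → E x (φ (suc i)) ≡ true
      below i il p = via (suc i) (P.absorber-child i il (subst (λ q → P.absorber w x q ≡ true) (sym p) e))
      above : ∀ i → z ≡ suc i → E x (φ (par (suc i))) ≡ true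
      above i p = via (par (suc i)) (P.absorber-parent i (subst (_< m) p l)
          (subst (λ q → P.absorber w x q ≡ true) p e))

    c>0 : 0 < c
    c>0 = pos* {4 * (64 * g)} (pos* {4} (s≤s z≤n) (pos* {64} (s≤s z≤n) g>0))
        (^-pos (16 * g) (suc (suc D)) (pos* {16} (s≤s z≤n) g>0))

    free< : free < s * N
    free< = ≤-trans (s≤s (m≤n*m free (8 * g) {{>-nonZero (pos* {8} (s≤s z≤n) g>0)}})) few-free

    k = n ∸ m

    k< : suc k ≤ (s + label-count D h′) * N + M
    k< = +-cancelˡ-≤ m _ _ (≤-trans (≤-reflexive (trans (+-suc m k) (cong suc (m+[n∸m]≡n m≤n))))
        (≤-trans n< (≤-reflexive (trans (cong (_+ M) (sym room)) (+-assoc m _ M)))))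

    enough : ∀ w x → w < n → x < n → 2 * k < # m (Ab.ok φ m w x)
    enough w x w< x< = ≤-trans (enough-absorbers D c s (label-count D h′) M N m k (# m center) (# m P.last) free
        (# m (P.absorber w x))
        c>0 (s≤s z≤n) M≤N k< wide room many-centers free< P.many-last (P.hits w< x<))
      (#-mono m (λ z l e → absorber-ok w x z l e))

  spanning : Σ (ℕ → ℕ) λ Φ → (∀ i → i < n → Φ i < n) × (∀ i → suc i < n → E (Φ (par (suc i))) (Φ (suc i)) ≡ true) ×
    (∀ i j → i < n → j < n → Φ i ≡ Φ j → i ≡ j)
  spanning = let r = Ab.absorb k ≤-refl (m+[n∸m]≡n m≤n) start enough in
    proj₁ r , Ab.Embeds.bound (proj₂ r) , Ab.Embeds.edge (proj₂ r) , Ab.Embeds.inj (proj₂ r)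

isOdd-double : ∀ x → isOdd (2 * x) ≡ false
isOdd-double zero = refl
isOdd-double (suc x) rewrite +-suc x (x + 0) | isOdd-double x = refl

-- The number suc h′ of levels of a component is large against c, so that there are few free vertices; M′ is large
-- against the number L of labels.
module Parameters (g D : ℕ) (g>0 : 0 < g) (D>0 : 0 < D) where
  c = star-constant g D
  P = 8 * g * (D * D * D + D * D + D)
  -- The total coefficient of `s` in `wide`.
  a = 3 + 2 * (suc D * c)
  -- Even, so that the last level of a component has no centers, and at least `a * P`, so that
  -- `a * s` fits into `M`.
  h′ = 2 * (a * P)
  L = label-count D h′
  -- With `s` as below, the left side of `wide` is `a * P * M′` plus the summands of `M′` other than
  -- `64 * g`; the latter gives `w≤M`.
  M′ = a + ((D + 2) * L + suc D * c * (2 * L + 3)) + 64 * g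
  M = suc h′ * M′
  -- As `M` is a multiple of `suc h′`, this is the least `s` with `P * M < suc h′ * s`, which yields
  -- `few`.
  s = P * M′ + 1
  w = 64 * g
  -- The numbers of requirements, at most `20 M³ N²` for the equipartition and `n²` with
  -- `n ≤ 4 * M * w * (N / w)` for the stars, are compared with quartics after squaring.
  C₁ = 20 * (M * M * M) * (20 * (M * M * M))
  C₂ = (4 * M * w) * (4 * M * w) * ((4 * M * w) * (4 * M * w))

  w>0 : 0 < w
  w>0 = pos* {64} (s≤s z≤n) g>0

  M′≤M : M′ ≤ M
  M′≤M = m≤m+n M′ _

  w≤M : w ≤ M
  w≤M = ≤-trans (m≤n+m w (a + ((D + 2) * L + suc D * c * (2 * L + 3)))) M′≤M

  M>0 : 0 < M
  M>0 = ≤-trans w>0 w≤M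

  wide : 3 * s + (D + 2) * L + suc D * c * (2 * s + 2 * L + 3) ≤ M
  wide = ≤-trans (m≤m+n _ (64 * g + a * P * M′)) (≤-reflexive (e (suc D * c) P M′ ((D + 2) * L) L (64 * g) refl))
    where
    e : ∀ K P M′ x L y → M′ ≡ 3 + 2 * K + (x + K * (2 * L + 3)) + y →
      3 * (P * M′ + 1) + x + K * (2 * (P * M′ + 1) + 2 * L + 3) + (y + (3 + 2 * K) * P * M′) ≡ suc
          (2 * ((3 + 2 * K) * P)) * M′
    e K P M′ x L y q = trans (e₁ K P M′ x L y) (trans (cong (_+ 2 * ((3 + 2 * K) * P) * M′) (sym q)) refl)
      where
      e₁ : ∀ K P M′ x L y → 3 * (P * M′ + 1) + x + K * (2 * (P * M′ + 1) + 2 * L + 3) + (y + (3 + 2 * K) * P * M′)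
        ≡ 3 + 2 * K + (x + K * (2 * L + 3)) + y + 2 * ((3 + 2 * K) * P) * M′
      e₁ = solve-∀

  s+L<M : s + L < M
  s+L<M = ≤-trans (≤-trans (m≤m+n _ (1 + 2 * (P * M′) + (D + 1) * L)) (≤-reflexive (e (P * M′) D L)))
      (≤-trans (m≤m+n _ _) wide)
    where
    e : ∀ x D L → suc (x + 1 + L) + (1 + 2 * x + (D + 1) * L) ≡ 3 * (x + 1) + (D + 2) * L
    e = solve-∀

  private
    instance
      nzM : NonZero M
      nzM = >-nonZero M>0
      nzw : NonZero w
      nzw = >-nonZero w>0
    Nₑ = proj₁ (equipartition M M>0 C₁)
    Jₛ = Drive.J₀ (star-base g D) C₂ (star-base>0 g D g>0)
    N₀ = 2 + 128 * g + M + Nₑ + Jₛ * w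

  n₀ : ℕ
  n₀ = N₀ * M

  Spanning : ∀ {n} → Dense n g → Rooted n D → Set
  Spanning {n} G T = Σ (ℕ → ℕ) λ Φ → (∀ i → i < n → Φ i < n) ×
    (∀ i → suc i < n → Dense.E G (Φ (Rooted.par T (suc i))) (Φ (suc i)) ≡ true) ×
        (∀ i j → i < n → j < n → Φ i ≡ Φ j → i ≡ j)

  private
    2≤N₀ : 2 ≤ N₀
    2≤N₀ = s≤s (s≤s z≤n)
    128g≤N₀ : 128 * g ≤ N₀
    128g≤N₀ = ≤-trans (≤-trans (m≤n+m _ 2) (m≤m+n _ M)) (≤-trans (m≤m+n _ Nₑ) (m≤m+n _ (Jₛ * w)))
    M≤N₀ : M ≤ N₀
    M≤N₀ = ≤-trans (m≤n+m M (2 + 128 * g)) (≤-trans (m≤m+n _ Nₑ) (m≤m+n _ (Jₛ * w)))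
    Nₑ≤N₀ : Nₑ ≤ N₀
    Nₑ≤N₀ = ≤-trans (m≤n+m Nₑ (2 + 128 * g + M)) (m≤m+n _ (Jₛ * w))
    Jₛw≤N₀ : Jₛ * w ≤ N₀
    Jₛw≤N₀ = m≤n+m _ (2 + 128 * g + M + Nₑ)

    with-blocks : ∀ {n} N → N₀ ≤ N → N * M ≤ n → n < N * M + M → (G : Dense n g) (T : Rooted n D) → Spanning G T
    with-blocks zero l _ _ _ _ = ⊥-elim (<⇒≱ (≤-trans (s≤s z≤n) 2≤N₀) l)
    with-blocks (suc zero) l _ _ _ _ = ⊥-elim (<⇒≱ 2≤N₀ l)
    with-blocks {n} N@(suc (suc N′)) N₀≤N NM≤n n< G T =
      Assembly.spanning {M = M} {N′ = N′} {m′ = m′} g>0 D>0 G H stars T h′ s (isOdd-double (a * P)) m≤n M≤N room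
          n<′ few wide
      where
      open Dense G
      M≤N : M ≤ N
      M≤N = ≤-trans M≤N₀ N₀≤N
      n>0 : 0 < n
      n>0 = ≤-trans (pos* {N} (s≤s z≤n) M>0) NM≤n
      n≤2NM : n ≤ 2 * (N * M)
      n≤2NM = ≤-trans (<⇒≤ n<) (+-monoʳ-≤ (N * M) (≤-trans (m≤n*m M N) (≤-reflexive (sym (+-identityʳ _)))))
      128g≤N = ≤-trans 128g≤N₀ N₀≤N
      w≤N : w ≤ N
      w≤N = ≤-trans (*-monoˡ-≤ g (m≤m+n 64 64)) 128g≤N
      fam = host-family g>0 n>0 G M N w≤M 128g≤N NM≤n n<
      fam-small : length fam * M * (length fam * M) ≤ C₁ * N ^ 4
      fam-small = ≤-trans (*-mono-≤ one one) (≤-reflexive (e₃ M N))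
        where
        e₁ : ∀ x → x * x + 4 * (x * x) ≡ 5 * (x * x)
        e₁ = solve-∀
        e₂ : ∀ M N → 5 * (2 * (N * M) * (2 * (N * M))) * M ≡ 20 * (M * M * M) * (N * N)
        e₂ = solve-∀
        e₃ : ∀ M N → 20 * (M * M * M) * (N * N) * (20 * (M * M * M) * (N * N)) ≡ 20 * (M * M * M) *
            (20 * (M * M * M)) * (N * (N * (N * (N * 1))))
        e₃ = solve-∀
        one : length fam * M ≤ 20 * (M * M * M) * (N * N)
        one = begin
          length fam * M                                ≡⟨
              cong (_* M) (host-family-length g>0 n>0 G M N w≤M 128g≤N NM≤n n<) ⟩
          (n + 4 * (n * n)) * M                         ≤⟨ *-monoˡ-≤ M (+-monoˡ-≤ _ (m≤m*n n n {{>-nonZero n>0}})) ⟩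
          (n * n + 4 * (n * n)) * M                     ≡⟨ cong (_* M) (e₁ n) ⟩
          5 * (n * n) * M                               ≤⟨ *-monoˡ-≤ M (*-monoʳ-≤ 5 (*-mono-≤ n≤2NM n≤2NM)) ⟩
          5 * (2 * (N * M) * (2 * (N * M))) * M         ≡⟨ e₂ M N ⟩
          20 * (M * M * M) * (N * N)                    ∎
          where open ≤-Reasoning
      abstract
        H : Host n g M N E
        H = host g>0 n>0 G M N w≤M 128g≤N NM≤n n<
            (proj₂ (equipartition M M>0 C₁) N (≤-trans Nₑ≤N₀ N₀≤N) fam fam-small)
        pairs-small : (n * n) * (n * n) ≤ C₂ * (N / w) ^ 4
        pairs-small = ≤-trans (*-mono-≤ (*-mono-≤ n≤ n≤) (*-mono-≤ n≤ n≤)) (≤-reflexive (e₂ (4 * M * w) (N / w)))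
          where
          e₁ : ∀ M w J → 2 * (2 * w * J * M) ≡ 4 * M * w * J
          e₁ = solve-∀
          e₂ : ∀ x J → x * J * (x * J) * (x * J * (x * J)) ≡ x * x * (x * x) * (J * (J * (J * (J * 1))))
          e₂ = solve-∀
          n≤ : n ≤ 4 * M * w * (N / w)
          n≤ = ≤-trans n≤2NM (≤-trans (*-monoʳ-≤ 2 (*-monoˡ-≤ M (≤-double-quotient N w w≤N)))
              (≤-reflexive (e₁ M w (N / w))))
        stars : ∀ {b} → b < M → (Lf : ℕ → ℕ) → (∀ i → Lf i < M) → Star n N c D E (Host.V H) b Lf
        stars b< Lf Lf< = StarExistence.star g>0 (s≤s z≤n) n>0 E-sym H D C₂
          (≤-trans (≤-reflexive (sym (m*n/n≡m Jₛ w))) (/-monoˡ-≤ w (≤-trans Jₛw≤N₀ N₀≤N))) pairs-small w≤N b< Lf Lf<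
      -- The initial subtree embedded before absorption leaves `s + L` parts of slack: `s` for the
      -- free vertices and one per label for rounding.
      m = (M ∸ (s + L)) * N
      m>0 : 0 < m
      m>0 = pos* (m<n⇒0<n∸m s+L<M) (s≤s z≤n)
      m′ = m ∸ 1
      suc-m′ : suc m′ ≡ m
      suc-m′ = m+[n∸m]≡n m>0
      room : suc m′ + (s + L) * N ≡ M * N
      room = trans (cong (_+ (s + L) * N) suc-m′)
          (trans (sym (*-distribʳ-+ N (M ∸ (s + L)) (s + L))) (cong (_* N) (m∸n+n≡m (<⇒≤ s+L<M))))
      m≤MN : suc m′ ≤ M * N
      m≤MN = ≤-trans (m≤m+n _ _) (≤-reflexive room)
      m≤n : suc m′ ≤ n
      m≤n = ≤-trans m≤MN (≤-trans (≤-reflexive (*-comm M N)) NM≤n)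
      n<′ : n < M * N + M
      n<′ = ≤-trans n< (≤-reflexive (cong (_+ M) (*-comm N M)))
      few : 8 * g * (suc m′ * (D * D * D + D * D + D)) < suc h′ * (s * N)
      few = begin-strict
        8 * g * (suc m′ * (D * D * D + D * D + D))   ≡⟨ e₁ (8 * g) (suc m′) (D * D * D + D * D + D) ⟩
        P * suc m′                                   ≤⟨ *-monoʳ-≤ P m≤MN ⟩
        P * (M * N)                                  <⟨ m<m+n (P * (M * N)) (pos* {suc h′} (s≤s z≤n) (s≤s z≤n)) ⟩
        P * (M * N) + suc h′ * N                     ≡⟨ e₂ P (suc h′) M′ N ⟩
        suc h′ * (s * N)                             ∎
        where
        open ≤-Reasoning
        e₁ : ∀ x m π → x * (m * π) ≡ x * π * m
        e₁ = solve-∀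
        e₂ : ∀ P h M′ N → P * (h * M′ * N) + h * N ≡ h * ((P * M′ + 1) * N)
        e₂ = solve-∀

  spanning-tree : ∀ n → n₀ ≤ n → (G : Dense n g) (T : Rooted n D) → Spanning G T
  spanning-tree n n₀≤n = with-blocks (n / M) (≤-trans (≤-reflexive (sym (m*n/n≡m N₀ M))) (/-monoˡ-≤ M n₀≤n))
      (m/n*n≤m n M)
    (≤-trans (s≤s (≤-reflexive (m≡m%n+[m/n]*n n M)))
        (≤-trans (+-monoˡ-≤ (n / M * M) (m%n<n n M)) (≤-reflexive (+-comm M _))))

-- Translating the hypotheses on `G` and the embedding of `T`.

subset-of : ∀ n → (ℕ → Bool) → Subset n
subset-of n a = Vec.tabulate (a ∘ toℕ)

subset-size : ∀ n a → ∣ subset-of n a ∣ ≡ # n a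
subset-size n a = trans (go n (a ∘ toℕ))
    (#-cong n (λ i l → trans (cong (ext false {n} (a ∘ toℕ)) (sym (Fin.toℕ-fromℕ< l)))
  (trans (ext-toℕ false (a ∘ toℕ) (fromℕ< l)) (cong a (Fin.toℕ-fromℕ< l)))))
  where
  go : ∀ n (f : Fin n → Bool) → ∣ Vec.tabulate f ∣ ≡ # n (ext false f)
  go zero f = refl
  go (suc n) f = trans (first (f Fin.zero) (Vec.tabulate (f ∘ Fin.suc)))
    (trans (cong (⟦ f Fin.zero ⟧ +_) (go n (f ∘ Fin.suc))) (sym (∑-front n (λ i → ⟦ ext false f i ⟧))))
    where
    first : ∀ b (v : Subset n) → ∣ b Vec.∷ v ∣ ≡ ⟦ b ⟧ + ∣ v ∣
    first true v = refl
    first false v = refl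

subset-∈ : ∀ {n} a (x : Fin n) → (x ∈ᵇ subset-of n a) ≡ a (toℕ x)
subset-∈ a x = trans (isIn-id _) (Vec.lookup∘tabulate (a ∘ toℕ) x)
  where
  isIn-id : ∀ b → isIn b ≡ b
  isIn-id true = refl
  isIn-id false = refl

-- An edge counted by `eAB` at `i < j` has `i` in the first set and `j` in the second, or
-- conversely. Exchanging the sums turns the second case into pairs with `j < i`, which are disjoint
-- from those of the first.
eAB-bound : ∀ {n} (G : Graph n) a b → eAB G (subset-of n a) (subset-of n b) ≤ ∑ n
    (λ x → # n (λ y → a x ∧ (b y ∧ adjᴺ G x y)))
eAB-bound {n} G a b = begin
  eAB G A B                                                             ≡⟨ sum-ext n _ ⟩
  ∑ n (ext 0 (λ u → count (h u)))                                       ≤⟨ ∑-mono n row ⟩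
  ∑ n (λ i → ∑ n (λ j → ⟦ i <ᵇ j ⟧ * f i j + ⟦ i <ᵇ j ⟧ * f j i))       ≡⟨ trans (∑-cong n (λ i _ → ∑-+ n _ _))
      (∑-+ n _ _) ⟩
  ∑ n (λ i → ∑ n (λ j → ⟦ i <ᵇ j ⟧ * f i j)) + ∑ n (λ i → ∑ n (λ j → ⟦ i <ᵇ j ⟧ * f j i))
    ≡⟨ cong (∑ n (λ i → ∑ n (λ j → ⟦ i <ᵇ j ⟧ * f i j)) +_) (∑-swap n n (λ i j → ⟦ i <ᵇ j ⟧ * f j i)) ⟩
  ∑ n (λ i → ∑ n (λ j → ⟦ i <ᵇ j ⟧ * f i j)) + ∑ n (λ i → ∑ n (λ j → ⟦ j <ᵇ i ⟧ * f i j))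
    ≡⟨ sym (trans (∑-cong n (λ i _ → ∑-+ n _ _)) (∑-+ n _ _)) ⟩
  ∑ n (λ i → ∑ n (λ j → ⟦ i <ᵇ j ⟧ * f i j + ⟦ j <ᵇ i ⟧ * f i j))       ≤⟨
      ∑-mono n (λ i _ → ∑-mono n (λ j _ → one-order i j)) ⟩
  ∑ n (λ i → ∑ n (λ j → f i j))                                         ∎
  where
  open ≤-Reasoning
  A = subset-of n a
  B = subset-of n b
  f : ℕ → ℕ → ℕ
  f i j = ⟦ a i ∧ (b j ∧ adjᴺ G i j) ⟧
  h : Fin n → Fin n → Bool
  h u v = if toℕ u <ᵇ toℕ v then adj G u v ∧ ((u ∈ᵇ A ∧ v ∈ᵇ B) ∨ (u ∈ᵇ B ∧ v ∈ᵇ A)) else false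
  one-order : ∀ i j → ⟦ i <ᵇ j ⟧ * f i j + ⟦ j <ᵇ i ⟧ * f i j ≤ f i j
  one-order i j = ≤-trans (≤-reflexive (sym (*-distribʳ-+ (f i j) ⟦ i <ᵇ j ⟧ ⟦ j <ᵇ i ⟧)))
      (≤-trans (*-monoˡ-≤ (f i j) (exclusive i j)) (≤-reflexive (*-identityˡ _)))
    where
    exclusive : ∀ i j → ⟦ i <ᵇ j ⟧ + ⟦ j <ᵇ i ⟧ ≤ 1
    exclusive zero zero = z≤n
    exclusive zero (suc j) = ≤-refl
    exclusive (suc i) zero = ≤-refl
    exclusive (suc i) (suc j) = exclusive i j
  cell : ∀ lt e ua ub va vb → ⟦ if lt then e ∧ ((ua ∧ vb) ∨ (ub ∧ va)) else false ⟧ ≤ ⟦ lt ⟧ *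
      ⟦ ua ∧ (vb ∧ e) ⟧ + ⟦ lt ⟧ * ⟦ va ∧ (ub ∧ e) ⟧
  cell false e ua ub va vb = z≤n
  cell true false ua ub va vb = z≤n
  cell true true true ub va true = s≤s z≤n
  cell true true true true true false = s≤s z≤n
  cell true true true true false false = z≤n
  cell true true true false va false = z≤n
  cell true true false true true vb = s≤s z≤n
  cell true true false true false vb = z≤n
  cell true true false false va vb = z≤n
  entry : ∀ u v → ⟦ h u v ⟧ ≤ ⟦ toℕ u <ᵇ toℕ v ⟧ * f (toℕ u) (toℕ v) + ⟦ toℕ u <ᵇ toℕ v ⟧ * f (toℕ v) (toℕ u)
  entry u v rewrite subset-∈ a u | subset-∈ b u | subset-∈ a v | subset-∈ b v | adjᴺ-toℕ G u v | adjᴺ-toℕ G v u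
      | Graph.sym G v u =
    cell (toℕ u <ᵇ toℕ v) (adj G u v) (a (toℕ u)) (b (toℕ u)) (a (toℕ v)) (b (toℕ v))
  row : ∀ i → i < n → ext 0 (λ u → count (h u)) i ≤ ∑ n (λ j → ⟦ i <ᵇ j ⟧ * f i j + ⟦ i <ᵇ j ⟧ * f j i)
  row i l with in-range n i
  ... | inj₂ g = ⊥-elim (<⇒≱ l g)
  ... | inj₁ (u , refl) = ≤-trans (≤-reflexive (trans (ext-toℕ 0 (λ u → count (h u)) u) (count-ext (h u))))
      (∑-mono n col)
    where
    col : ∀ j → j < n → ⟦ ext false (h u) j ⟧ ≤ ⟦ toℕ u <ᵇ j ⟧ * f (toℕ u) j + ⟦ toℕ u <ᵇ j ⟧ * f j (toℕ u)
    col j l′ with in-range n j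
    ... | inj₂ g = ⊥-elim (<⇒≱ l′ g)
    ... | inj₁ (v , refl) = ≤-trans (≤-reflexive (cong ⟦_⟧ (ext-toℕ false (h u) v))) (entry u v)

dense : ∀ {n} g (G : Graph n) → (∀ v → 64 * g * n ≤ 2 * (64 * g) * deg G v + 2 * n) →
  (∀ A B → ∣ A ∣ ≡ n / 2 → ∣ B ∣ ≡ n / 2 → n * n ≤ g * eAB G A B) → Dense n g
dense {n} g G min-degree non-extremal = record
  { E = adjᴺ G ; E-sym = adjᴺ-sym G ; E-irrefl = adjᴺ-irrefl G
  ; degree = degree
  ; nonextremal = λ a b ha hb → ≤-trans
      (non-extremal (subset-of n a) (subset-of n b) (trans (subset-size n a) ha) (trans (subset-size n b) hb))
      (*-monoʳ-≤ g (eAB-bound G a b)) }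
  where
  degree : ∀ v → v < n → 64 * g * n ≤ 2 * (64 * g) * # n (adjᴺ G v) + 2 * n
  degree v l with in-range n v
  ... | inj₂ q = ⊥-elim (<⇒≱ l q)
  ... | inj₁ (x , refl) = subst (λ d → 64 * g * n ≤ 2 * (64 * g) * d + 2 * n)
        (trans (count-ext (adj G x)) (#-cong n (λ j _ → sym (adjᴺ-row G x j)))) (min-degree x)

fraction : ℕ → ℕ → ℚᵘ.ℚᵘ
fraction k d = ℚᵘ.mkℚᵘ (ℤ.+ k) d

ℕ→ℚ-≃ : ∀ k → ℚ.toℚᵘ (ℕ→ℚ k) ℚᵘ.≃ fraction k 0
ℕ→ℚ-≃ k = ℚ.toℚᵘ-fromℚᵘ (fraction k 0)

1/[1+_] : ℕ → ℚ.ℚ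
1/[1+ k ] = ℚ.fromℚᵘ (fraction 1 k)

1/[1+_]>0 : ∀ k → ℚ.0ℚ ℚ.< 1/[1+ k ]
1/[1+ k ]>0 = ℚ.toℚᵘ-cancel-< (ℚᵘ.<-respʳ-≃ (ℚᵘ.≃-sym (ℚ.toℚᵘ-fromℚᵘ (fraction 1 k))) (ℚᵘ.*<* (ℤ.+<+ (s≤s z≤n))))

-- A positive rational has numerator at least 1, so it is at least the reciprocal of its
-- denominator.
density-bound : ∀ γ → ℚ.0ℚ ℚ.< γ → ∀ k e → γ ℚ.* ℕ→ℚ k ℚ.< ℕ→ℚ e → k ≤ ℚ.↧ₙ γ * e
density-bound (ℚ.mkℚ (ℤ.+ zero) d _) (ℚ.*<* (ℤ.+<+ ()))
density-bound (ℚ.mkℚ (-[1+ _ ]) d _) (ℚ.*<* ())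
density-bound γ@(ℚ.mkℚ (ℤ.+ suc a) d _) _ k e h = begin
  k                     ≤⟨ m≤m+n k (a * k) ⟩
  suc a * k             ≡⟨ sym (*-identityʳ _) ⟩
  suc a * k * 1         ≤⟨ <⇒≤ (ℤ.drop‿+<+ (subst₂ ℤ._<_ left right (ℚᵘ.drop-*<* un))) ⟩
  e * (suc d * 1)       ≡⟨ trans (cong (e *_) (*-identityʳ (suc d))) (*-comm e (suc d)) ⟩
  suc d * e             ∎
  where
  open ≤-Reasoning
  un : ℚᵘ.mkℚᵘ (ℤ.+ suc a) d ℚᵘ.* fraction k 0 ℚᵘ.< fraction e 0
  un = ℚᵘ.<-respʳ-≃ (ℕ→ℚ-≃ e) (ℚᵘ.<-respˡ-≃
      (ℚᵘ.≃-trans (ℚ.toℚᵘ-homo-* γ (ℕ→ℚ k)) (ℚᵘ.*-congˡ {ℚ.toℚᵘ γ} (ℕ→ℚ-≃ k))) (ℚ.toℚᵘ-mono-< h))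
  left : (ℤ.+ suc a ℤ.* ℤ.+ k) ℤ.* ℤ.+ 1 ≡ ℤ.+ (suc a * k * 1)
  left = trans (cong (ℤ._* ℤ.+ 1) (sym (ℤ.pos-* (suc a) k))) (sym (ℤ.pos-* (suc a * k) 1))
  right : ℤ.+ e ℤ.* ℤ.+ (suc d * 1) ≡ ℤ.+ (e * (suc d * 1))
  right = sym (ℤ.pos-* e (suc d * 1))

-- With `W = suc w`: `n/2 ≤ d + ν n ≤ d + n/W`, multiplied by `2 W`.
degree-bound : ∀ w ν → ν ℚ.< 1/[1+ w ] → ∀ n d → (ℚ.½ ℚ.- ν) ℚ.* ℕ→ℚ n ℚ.≤ ℕ→ℚ d → suc w * n ≤ 2 * suc w * d + 2 * n
degree-bound w ν ν< n d h = linear 1 0 (ℤ.drop‿+≤+ (subst₂ ℤ._≤_ left right (ℚᵘ.drop-*≤* un))) (e (suc w) n d)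
  where
  instance
    n≥0 : ℚ.NonNegative (ℕ→ℚ n)
    n≥0 = ℚ.nonNegative (ℚ.toℚᵘ-cancel-≤
        (ℚᵘ.≤-respʳ-≃ (ℚᵘ.≃-sym (ℕ→ℚ-≃ n)) (ℚᵘ.*≤* (subst₂ ℤ._≤_ refl (ℤ.pos-* n 1) (ℤ.+≤+ z≤n)))))
  half : ℚ.½ ℚ.* ℕ→ℚ n ℚ.≤ ℕ→ℚ d ℚ.+ 1/[1+ w ] ℚ.* ℕ→ℚ n
  half = ℚ.≤-trans (ℚ.≤-reflexive (trans (cong (ℚ._* ℕ→ℚ n) cancel) (ℚ.*-distribʳ-+ (ℕ→ℚ n) (ℚ.½ ℚ.- ν) ν)))
    (ℚ.+-mono-≤ h (ℚ.*-monoʳ-≤-nonNeg (ℕ→ℚ n) (ℚ.<⇒≤ ν<)))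
    where
    cancel : ℚ.½ ≡ (ℚ.½ ℚ.- ν) ℚ.+ ν
    cancel = sym (trans (ℚ.+-assoc ℚ.½ (ℚ.- ν) ν) (trans (cong (ℚ.½ ℚ.+_) (ℚ.+-inverseˡ ν)) (ℚ.+-identityʳ ℚ.½)))
  un : fraction 1 1 ℚᵘ.* fraction n 0 ℚᵘ.≤ fraction d 0 ℚᵘ.+ fraction 1 w ℚᵘ.* fraction n 0
  un = ℚᵘ.≤-respʳ-≃ (ℚᵘ.≃-trans (ℚ.toℚᵘ-homo-+ (ℕ→ℚ d) (1/[1+ w ] ℚ.* ℕ→ℚ n))
         (ℚᵘ.+-cong (ℕ→ℚ-≃ d) (ℚᵘ.≃-trans (ℚ.toℚᵘ-homo-* 1/[1+ w ] (ℕ→ℚ n))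
             (ℚᵘ.*-cong (ℚ.toℚᵘ-fromℚᵘ (fraction 1 w)) (ℕ→ℚ-≃ n)))))
       (ℚᵘ.≤-respˡ-≃ (ℚᵘ.≃-trans (ℚ.toℚᵘ-homo-* ℚ.½ (ℕ→ℚ n)) (ℚᵘ.*-congˡ {ℚ.toℚᵘ ℚ.½} (ℕ→ℚ-≃ n)))
           (ℚ.toℚᵘ-mono-≤ half))
  W = suc w * 1
  left : (ℤ.+ 1 ℤ.* ℤ.+ n) ℤ.* ℤ.+ (1 * W) ≡ ℤ.+ (1 * n * (1 * W))
  left = trans (cong (ℤ._* ℤ.+ (1 * W)) (sym (ℤ.pos-* 1 n))) (sym (ℤ.pos-* (1 * n) (1 * W)))
  right : (ℤ.+ d ℤ.* ℤ.+ W ℤ.+ (ℤ.+ 1 ℤ.* ℤ.+ n) ℤ.* ℤ.+ 1) ℤ.* ℤ.+ 2 ≡ ℤ.+ ((d * W + 1 * n * 1) * 2)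
  right = trans (cong (ℤ._* ℤ.+ 2)
      (trans (cong₂ ℤ._+_ (sym (ℤ.pos-* d W))
      (trans (cong (ℤ._* ℤ.+ 1) (sym (ℤ.pos-* 1 n))) (sym (ℤ.pos-* (1 * n) 1))))
    (sym (ℤ.pos-+ (d * W) (1 * n * 1))))) (sym (ℤ.pos-* (d * W + 1 * n * 1) 2))
  e : ∀ w n d → 1 * (w * n) + (d * (w * 1) + 1 * n * 1) * 2 + 0 ≡ 1 * (2 * w * d + 2 * n) + 1 * n * (1 * (w * 1))
  e = solve-∀

tree-embedding : ∀ {n g} (G : Graph n) (d : Dense n g) → Dense.E d ≡ adjᴺ G → ∀ {D} (T : Graph n) → IsTree T →
    MaxDegreeAtMost T D →
  (∀ (R : Rooted n D) → Σ (ℕ → ℕ) λ Φ → (∀ i → i < n → Φ i < n) ×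
    (∀ i → suc i < n → Dense.E d (Φ (Rooted.par R (suc i))) (Φ (suc i)) ≡ true) ×
        (∀ i j → i < n → j < n → Φ i ≡ Φ j → i ≡ j)) →
  SubgraphOf T G
tree-embedding {zero} G _ _ T _ _ _ = id , (λ e → e) , λ ()
tree-embedding {suc n′} G d refl {D} T (connected , acyclic) Δ span with span (Ordering.rooted T connected acyclic Δ)
... | Φ , Φ< , Φ-edge , Φ-inj = φ , φ-inj , λ u v e → φ-edge u v (num-edge u v e)
  where
  open Ordering T connected acyclic
  n = suc n′
  bound : ∀ x → Φ (num x) < n
  bound x = Φ< (num x) (proj₁ (num-spec x))
  φ : Fin n → Fin n
  φ x = fromℕ< (bound x)
  toℕ-φ : ∀ x → toℕ (φ x) ≡ Φ (num x)
  toℕ-φ x = Fin.toℕ-fromℕ< (bound x)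
  φ-inj : ∀ {x y} → φ x ≡ φ y → x ≡ y
  φ-inj {x} {y} e = num-inj (Φ-inj (num x) (num y) (proj₁ (num-spec x)) (proj₁ (num-spec y))
      (trans (sym (toℕ-φ x)) (trans (cong toℕ e) (toℕ-φ y))))
  adj-φ : ∀ u v → adjᴺ G (Φ (num u)) (Φ (num v)) ≡ true → φ u ~[ G ] φ v
  adj-φ u v e = trans (sym (adjᴺ-toℕ G (φ u) (φ v))) (trans (cong₂ (adjᴺ G) (toℕ-φ u) (toℕ-φ v)) e)
  φ-edge : ∀ u v → (Σ ℕ λ i → suc i < n ×
      ((num u ≡ p (suc i) × num v ≡ suc i) ⊎ (num v ≡ p (suc i) × num u ≡ suc i))) → φ u ~[ G ] φ v
  φ-edge u v (i , l , inj₁ (eu , ev)) = adj-φ u v (trans (cong₂ (λ x y → adjᴺ G (Φ x) (Φ y)) eu ev) (Φ-edge i l))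
  φ-edge u v (i , l , inj₂ (ev , eu)) =
      adj-φ u v (trans (adjᴺ-sym G (Φ (num u)) (Φ (num v)))
      (trans (cong₂ (λ x y → adjᴺ G (Φ x) (Φ y)) ev eu) (Φ-edge i l)))

theorem2 : Σ ℚ.ℚ λ γ₀ → ℚ.0ℚ ℚ.< γ₀ ×
    ((γ : ℚ.ℚ) → ℚ.0ℚ ℚ.< γ → γ ℚ.< γ₀ →
    Σ ℚ.ℚ λ ν₀ → ℚ.0ℚ ℚ.< ν₀ ×
    ((ν : ℚ.ℚ) → ℚ.0ℚ ℚ.< ν → ν ℚ.< ν₀ →
    (D : ℕ) → 2 ≤ D →
    Σ ℕ λ n₀ → (n : ℕ) → n₀ ≤ n →
    (G : Graph n) → NonExtremal γ G →
    MinDegreeAtLeast G ((ℚ.½ ℚ.- ν) ℚ.* ℕ→ℚ n) →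
    (T : Graph n) → IsTree T → MaxDegreeAtMost T D →
    SubgraphOf T G))
-- The denominator of γ is taken as `g`, since `1/g ≤ γ`.
theorem2 = ℚ.1ℚ , ℚ.*<* (ℤ.+<+ (s≤s z≤n)) , λ γ γ>0 _ → 1/[1+ w γ ] , 1/[1+ w γ ]>0 , λ ν _ ν< D 2≤D →
  Parameters.n₀ (ℚ.↧ₙ γ) D (s≤s z≤n) (≤-trans (s≤s z≤n) 2≤D) , λ n n₀≤n G NE MD T tree Δ →
  let d = dense (ℚ.↧ₙ γ) G (λ v → degree-bound (w γ) ν ν< n (deg G v) (MD v)) (λ A B hA hB → density-bound γ γ>0 (n * n) (eAB G A B) (NE A B hA hB)) in
  tree-embedding G d refl T tree Δ (Parameters.spanning-tree (ℚ.↧ₙ γ) D (s≤s z≤n) (≤-trans (s≤s z≤n) 2≤D) n n₀≤n d)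
  where
  w : ℚ.ℚ → ℕ
  -- The denominator of `1/[1+ w γ ]` is one more than `w γ`, which makes it `1/(64 g)`.
  w γ = 64 * ℚ.↧ₙ γ ∸ 1
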